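{- Let $n\in\mathbb{N}$ and let $\mathbf{i}=(i_1,\dots,i_n)$ be a weight vector. Then every $\mathbf{i}$-badly approximable vector is $\mathbf{i}$-Dirichlet improvable, i.e. $\mathbf{Bad}_n(\mathbf{i})\subseteq\mathcal{D}_n(\mathbf{i})$.
   Context: For a real number $x$, $\|x\|$ denotes the distance from $x$ to the nearest integer. A weight vector is $\mathbf{i}=(i_1,\dots,i_n)\in\mathbb{R}^n$ with $0\le i_j\le 1$ for all $j$ and $i_1+\dots+i_n=1$. A vector $\boldsymbol{\alpha}=(\alpha_1,\dots,\alpha_n)$ is $\mathbf{i}$-badly approximable, written $\boldsymbol{\alpha}\in\mathbf{Bad}_n(\mathbf{i})$, if $$\liminf_{q\to\infty}\max_{1\le j\le n}q^{i_j}\|q\alpha_j\|>0 .$$ A vector $\boldsymbol{\alpha}\in\mathbb{R}^n$ is $\mathbf{i}$-Dirichlet improvable, written $\boldsymbol{\alpha}\in\mathcal{D}_n(\mathbf{i})$, if there exists a constant $0<c<1$ such that for all sufficiently large $Q\in\mathbb{N}$ there is an integer $q$ with $1\le q\le Q$ and $$\|q\alpha_j\|<c\,Q^{ -i_j}\quad\text{for all }j\in\{1,\dots,n\}.$$ -}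

module Defs where

open import Algebra.Bundles using (CommutativeRing)
open import Data.Integer.Base as ℤ using (ℤ; +_; -[1+_]; +≤+; -≤+; -≤-)
import Data.Integer.Properties as ℤ
open import Data.Nat.Base as ℕ using (ℕ; zero; suc; NonZero; z≤n; s≤s)
import Data.Nat.Properties as ℕ
open import Data.Product.Base using (∃; Σ; _×_; _,_; proj₁; proj₂)
open import Data.Sum.Base using (_⊎_; inj₁; inj₂)
open import Data.Vec.Functional using (Vector; foldr)
open import Function.Base using (flip; _∘_)
open import Level using (0ℓ)
open import Relation.Binary.Bundles using (StrictTotalOrder)
open import Relation.Binary.Core using (Rel)
open import Relation.Binary.Definitions using (tri<; tri≈; tri>)
open import Relation.Binary.PropositionalEquality.Core as ≡ using (_≡_)
open import Relation.Binary.Structures using (IsStrictTotalOrder)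
open import Relation.Nullary using (¬_; Dec; yes; no; contradiction)
open import Relation.Nullary.Construct.Add.Extrema using (_±; [_])
open import Relation.Unary using (Pred)

module _ {A : Set} (_<_ : Rel A 0ℓ) where

  IsUpperBound : Pred A 0ℓ → Pred A 0ℓ
  IsUpperBound P u = ∀ {x} → P x → ¬ (u < x)

  -- In a totally ordered set, an upper bound is a least one exactly when
  -- every smaller element is exceeded by some member of P.
  IsSupremum : Pred A 0ℓ → Pred A 0ℓ
  IsSupremum P s = IsUpperBound P s × (∀ {y} → y < s → ∃ λ x → P x × y < x)

IsInfimum : {A : Set} → Rel A 0ℓ → Pred A 0ℓ → Pred A 0ℓ
IsInfimum _<_ = IsSupremum (flip _<_)

-- The real numbers, axiomatised up to isomorphism as a Dedekind-complete
-- totally ordered field.  Trichotomy and completeness together entail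
-- excluded middle for Set (see `excludedMiddle` below), so what is
-- described is the classical field of real numbers.
record CompleteOrderedField : Set₁ where
  field
    commutativeRing : CommutativeRing 0ℓ 0ℓ

  open CommutativeRing commutativeRing public
    renaming (Carrier to ℝ)

  infix 4 _<_
  field
    _<_                : Rel ℝ 0ℓ
    isStrictTotalOrder : IsStrictTotalOrder _≈_ _<_
    1≉0                : ¬ (1# ≈ 0#)
    inverse            : ∀ x → ¬ (x ≈ 0#) → ∃ λ y → x * y ≈ 1#
    +-monoˡ-<          : ∀ z {x y} → x < y → x + z < y + z
    *-pos              : ∀ {x y} → 0# < x → 0# < y → 0# < x * y
    supremum           : (P : Pred ℝ 0ℓ) → ∃ P → ∃ (IsUpperBound _<_ P) →
                         ∃ (IsSupremum _<_ P)

  strictTotalOrder : StrictTotalOrder 0ℓ 0ℓ 0ℓ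
  strictTotalOrder = record { isStrictTotalOrder = isStrictTotalOrder }

module RealAnalysis (R : CompleteOrderedField) where

  open CompleteOrderedField R public
  open StrictTotalOrder strictTotalOrder public
    using (compare; _<?_; irrefl; asym; <-resp-≈; <-respˡ-≈; <-respʳ-≈)
    renaming (trans to <-trans)
  open import Relation.Binary.Properties.StrictTotalOrder strictTotalOrder public
    using (_≤_; decTotalOrder; totalOrder)
    renaming (refl to ≤-refl; reflexive to ≤-reflexive; trans to ≤-trans;
              total to ≤-total)
  open import Algebra.Construct.NaturalChoice.Max totalOrder public
    using (_⊔_; ⊔-lub; x≤x⊔y; x≤y⊔x)
  open import Algebra.Properties.Semiring.Mult semiring public
    using () renaming (_×_ to _·_; ×-homo-+ to ·-homo-+)
  open import Algebra.Properties.Semiring.Exp semiring public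
    using (_^_; ^-homo-*; ^-assocʳ)
  open import Algebra.Properties.Monoid.Sum +-monoid public
    using (sum)
  open import Algebra.Properties.Ring ring
  open import Relation.Binary.Reasoning.StrictPartialOrder
    (StrictTotalOrder.strictPartialOrder strictTotalOrder)

  fromℕ : ℕ → ℝ
  fromℕ n = n · 1#

  fromℤ : ℤ → ℝ
  fromℤ (+ n)    = fromℕ n
  fromℤ -[1+ n ] = - fromℕ (suc n)

  ∣_∣ : ℝ → ℝ
  ∣ x ∣ = x ⊔ (- x)

  [x+y]-y≈x : ∀ x y → (x + y) - y ≈ x
  [x+y]-y≈x x y = begin-equality
    (x + y) - y  ≈⟨ +-assoc x y (- y) ⟩
    x + (y - y)  ≈⟨ +-congˡ (-‿inverseʳ y) ⟩
    x + 0#       ≈⟨ +-identityʳ x ⟩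
    x            ∎

  [x-y]+y≈x : ∀ x y → (x - y) + y ≈ x
  [x-y]+y≈x x y = begin-equality
    (x - y) + y    ≈⟨ +-assoc x (- y) y ⟩
    x + (- y + y)  ≈⟨ +-congˡ (-‿inverseˡ y) ⟩
    x + 0#         ≈⟨ +-identityʳ x ⟩
    x              ∎

  <⇒≤ : ∀ {x y} → x < y → x ≤ y
  <⇒≤ = inj₁

  ≮⇒≥ : ∀ {x y} → ¬ (x < y) → y ≤ x
  ≮⇒≥ {x} {y} x≮y with compare x y
  ... | tri< x<y _ _ = contradiction x<y x≮y
  ... | tri≈ _ x≈y _ = inj₂ (sym x≈y)
  ... | tri> _ _ y<x = inj₁ y<x

  ≤⇒≯ : ∀ {x y} → x ≤ y → ¬ (y < x)
  ≤⇒≯ (inj₁ x<y) y<x = asym x<y y<x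
  ≤⇒≯ (inj₂ x≈y) y<x = irrefl (sym x≈y) y<x

  +-monoʳ-< : ∀ z {x y} → x < y → z + x < z + y
  +-monoʳ-< z {x} {y} x<y = begin-strict
    z + x  ≈⟨ +-comm z x ⟩
    x + z  <⟨ +-monoˡ-< z x<y ⟩
    y + z  ≈⟨ +-comm y z ⟩
    z + y  ∎

  +-monoˡ-≤ : ∀ z {x y} → x ≤ y → x + z ≤ y + z
  +-monoˡ-≤ z (inj₁ x<y) = inj₁ (+-monoˡ-< z x<y)
  +-monoˡ-≤ z (inj₂ x≈y) = inj₂ (+-congʳ x≈y)

  +-monoʳ-≤ : ∀ z {x y} → x ≤ y → z + x ≤ z + y
  +-monoʳ-≤ z (inj₁ x<y) = inj₁ (+-monoʳ-< z x<y)
  +-monoʳ-≤ z (inj₂ x≈y) = inj₂ (+-congˡ x≈y)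

  neg-mono-< : ∀ {x y} → x < y → - y < - x
  neg-mono-< {x} {y} x<y = begin-strict
    - y              ≈⟨ [x+y]-y≈x (- y) x ⟨
    (- y + x) - x    <⟨ +-monoˡ-< (- x) (+-monoʳ-< (- y) x<y) ⟩
    (- y + y) - x    ≈⟨ +-congʳ (-‿inverseˡ y) ⟩
    0# - x           ≈⟨ +-identityˡ (- x) ⟩
    - x              ∎

  neg-mono-≤ : ∀ {x y} → x ≤ y → - y ≤ - x
  neg-mono-≤ (inj₁ x<y) = inj₁ (neg-mono-< x<y)
  neg-mono-≤ (inj₂ x≈y) = inj₂ (sym (-‿cong x≈y))

  *-monoˡ-< : ∀ {z} → 0# < z → ∀ {x y} → x < y → x * z < y * z
  *-monoˡ-< {z} 0<z {x} {y} x<y = begin-strict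
    x * z                    ≈⟨ +-identityˡ (x * z) ⟨
    0# + x * z               <⟨ +-monoˡ-< (x * z) (*-pos 0<y-x 0<z) ⟩
    (y - x) * z + x * z      ≈⟨ distribʳ z (y - x) x ⟨
    ((y - x) + x) * z        ≈⟨ *-congʳ ([x-y]+y≈x y x) ⟩
    y * z                    ∎
    where
    0<y-x : 0# < y - x
    0<y-x = begin-strict
      0#     ≈⟨ -‿inverseʳ x ⟨
      x - x  <⟨ +-monoˡ-< (- x) x<y ⟩
      y - x  ∎

  *-monoˡ-≤ : ∀ {z} → 0# ≤ z → ∀ {x y} → x ≤ y → x * z ≤ y * z
  *-monoˡ-≤ _          (inj₂ x≈y) = inj₂ (*-congʳ x≈y)
  *-monoˡ-≤ (inj₁ 0<z) (inj₁ x<y) = inj₁ (*-monoˡ-< 0<z x<y)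
  *-monoˡ-≤ {z} (inj₂ 0≈z) {x} {y} (inj₁ _) = inj₂ (begin-equality
    x * z   ≈⟨ *-congˡ 0≈z ⟨
    x * 0#  ≈⟨ zeroʳ x ⟩
    0#      ≈⟨ zeroʳ y ⟨
    y * 0#  ≈⟨ *-congˡ 0≈z ⟩
    y * z   ∎)

  *-monoʳ-≤ : ∀ {z} → 0# ≤ z → ∀ {x y} → x ≤ y → z * x ≤ z * y
  *-monoʳ-≤ {z} 0≤z {x} {y} x≤y = begin
    z * x  ≈⟨ *-comm z x ⟩
    x * z  ≤⟨ *-monoˡ-≤ 0≤z x≤y ⟩
    y * z  ≈⟨ *-comm y z ⟩
    z * y  ∎

  0<1 : 0# < 1#
  0<1 with compare 0# 1#
  ... | tri< 0<1 _ _ = 0<1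
  ... | tri≈ _ 0≈1 _ = contradiction (sym 0≈1) 1≉0
  ... | tri> _ _ 1<0 = begin-strict
    0#           <⟨ *-pos 0<-1 0<-1 ⟩
    - 1# * - 1#  ≈⟨ -1*x≈-x (- 1#) ⟩
    - - 1#       ≈⟨ -‿involutive 1# ⟩
    1#           ∎
    where
    0<-1 : 0# < - 1#
    0<-1 = begin-strict
      0#    ≈⟨ -0#≈0# ⟨
      - 0#  <⟨ neg-mono-< 1<0 ⟩
      - 1#  ∎

  x<1+x : ∀ x → x < 1# + x
  x<1+x x = begin-strict
    x       ≈⟨ +-identityˡ x ⟨
    0# + x  <⟨ +-monoˡ-< x 0<1 ⟩
    1# + x  ∎

  fromℕ-mono-≤ : ∀ {m n} → m ℕ.≤ n → fromℕ m ≤ fromℕ n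
  fromℕ-mono-≤ {n = zero}  z≤n       = ≤-refl
  fromℕ-mono-≤ {n = suc n} z≤n       =
    ≤-trans (fromℕ-mono-≤ {n = n} z≤n) (<⇒≤ (x<1+x (fromℕ n)))
  fromℕ-mono-≤             (s≤s m≤n) = +-monoʳ-≤ 1# (fromℕ-mono-≤ m≤n)

  fromℕ-pos : ∀ n .{{_ : NonZero n}} → 0# < fromℕ n
  fromℕ-pos (suc n) = begin-strict
    0#            ≤⟨ fromℕ-mono-≤ {n = n} z≤n ⟩
    fromℕ n       <⟨ x<1+x (fromℕ n) ⟩
    fromℕ (suc n) ∎

  1≤fromℕ : ∀ n .{{_ : NonZero n}} → 1# ≤ fromℕ n
  1≤fromℕ (suc n) = begin
    1#             ≈⟨ +-identityʳ 1# ⟨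
    fromℕ 1        ≤⟨ fromℕ-mono-≤ {n = suc n} (s≤s z≤n) ⟩
    fromℕ (suc n)  ∎

  ^-pos : ∀ {x} → 0# < x → ∀ n → 0# < x ^ n
  ^-pos 0<x zero    = 0<1
  ^-pos 0<x (suc n) = *-pos 0<x (^-pos 0<x n)

  ^-monoˡ-≤ : ∀ n {x y} → 0# ≤ x → x < y → x ^ n ≤ y ^ n
  ^-monoˡ-≤ zero    _   _   = ≤-refl
  ^-monoˡ-≤ (suc n) {x} {y} 0≤x x<y = begin
    x * x ^ n  ≤⟨ *-monoʳ-≤ 0≤x (^-monoˡ-≤ n 0≤x x<y) ⟩
    x * y ^ n  <⟨ *-monoˡ-< (^-pos 0<y n) x<y ⟩
    y * y ^ n  ∎
    where
    0<y : 0# < y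
    0<y = begin-strict 0# ≤⟨ 0≤x ⟩ x <⟨ x<y ⟩ y ∎

  ^-monoˡ-< : ∀ n .{{_ : NonZero n}} {x y} → 0# ≤ x → x < y → x ^ n < y ^ n
  ^-monoˡ-< (suc n) {x} {y} 0≤x x<y = begin-strict
    x * x ^ n  ≤⟨ *-monoʳ-≤ 0≤x (^-monoˡ-≤ n 0≤x x<y) ⟩
    x * y ^ n  <⟨ *-monoˡ-< (^-pos 0<y n) x<y ⟩
    y * y ^ n  ∎
    where
    0<y : 0# < y
    0<y = begin-strict 0# ≤⟨ 0≤x ⟩ x <⟨ x<y ⟩ y ∎

  ^-monoʳ-≤ : ∀ {x} → 1# ≤ x → ∀ {m n} → m ℕ.≤ n → x ^ m ≤ x ^ n
  ^-monoʳ-≤ {x} 1≤x {n = zero}  z≤n = ≤-refl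
  ^-monoʳ-≤ {x} 1≤x {n = suc n} z≤n = begin
    1#          ≤⟨ ^-monoʳ-≤ 1≤x {n = n} z≤n ⟩
    x ^ n       ≈⟨ *-identityˡ (x ^ n) ⟨
    1# * x ^ n  ≤⟨ *-monoˡ-≤ (<⇒≤ (^-pos 0<x n)) 1≤x ⟩
    x * x ^ n   ∎
    where
    0<x : 0# < x
    0<x = begin-strict 0# <⟨ 0<1 ⟩ 1# ≤⟨ 1≤x ⟩ x ∎
  ^-monoʳ-≤ {x} 1≤x (s≤s m≤n) = *-monoʳ-≤ (≤-trans (<⇒≤ 0<1) 1≤x) (^-monoʳ-≤ 1≤x m≤n)

  excludedMiddle : (P : Set) → Dec P
  excludedMiddle P = decide (supremum S (0# , inj₁ refl) (1# , S≤1))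
    where
    S : Pred ℝ 0ℓ
    S x = x ≈ 0# ⊎ (x ≈ 1# × P)
    S≤1 : IsUpperBound _<_ S 1#
    S≤1 (inj₁ x≈0)       1<x = asym 0<1 (<-respʳ-≈ x≈0 1<x)
    S≤1 (inj₂ (x≈1 , _)) 1<x = irrefl (sym x≈1) 1<x
    decide : ∃ (IsSupremum _<_ S) → Dec P
    decide (s , s-ub , s-approx) with 0# <? s
    ... | no  0≮s = no λ p →
      ≤⇒≯ (≮⇒≥ 0≮s) (begin-strict 0# <⟨ 0<1 ⟩ 1# ≤⟨ ≮⇒≥ (s-ub (inj₂ (refl , p))) ⟩ s ∎)
    ... | yes 0<s with s-approx 0<s
    ...   | _ , inj₁ x≈0       , 0<x = contradiction 0<x (irrefl (sym x≈0))
    ...   | _ , inj₂ (_ , p)   , _   = yes p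

  archimedean : ∀ x → ∃ λ n → x < fromℕ n
  archimedean x with excludedMiddle (∃ λ n → x < fromℕ n)
  ... | yes found = found
  ... | no  none  = contradiction s<1+n (s-ub (suc n , refl))
    where
    N : Pred ℝ 0ℓ
    N y = ∃ λ n → y ≈ fromℕ n
    N≤x : IsUpperBound _<_ N x
    N≤x (n , y≈n) x<y = none (n , <-respʳ-≈ y≈n x<y)
    sup = supremum N (0# , 0 , refl) (x , N≤x)
    s = proj₁ sup
    s-ub : IsUpperBound _<_ N s
    s-ub = proj₁ (proj₂ sup)
    s-1<s : s - 1# < s
    s-1<s = begin-strict
      s - 1#         <⟨ x<1+x (s - 1#) ⟩
      1# + (s - 1#)  ≈⟨ +-comm 1# (s - 1#) ⟩
      (s - 1#) + 1#  ≈⟨ [x-y]+y≈x s 1# ⟩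
      s              ∎
    approx = proj₂ (proj₂ sup) s-1<s
    n = proj₁ (proj₁ (proj₂ approx))
    s<1+n : s < fromℕ (suc n)
    s<1+n = begin-strict
      s               ≈⟨ [x-y]+y≈x s 1# ⟨
      (s - 1#) + 1#   <⟨ +-monoˡ-< 1# (proj₂ (proj₂ approx)) ⟩
      proj₁ approx + 1#   ≈⟨ +-congʳ (proj₂ (proj₁ (proj₂ approx))) ⟩
      fromℕ n + 1#    ≈⟨ +-comm (fromℕ n) 1# ⟩
      fromℕ (suc n)   ∎

  fromℤ-mono-≤ : ∀ {j k} → j ℤ.≤ k → fromℤ j ≤ fromℤ k
  fromℤ-mono-≤ (+≤+ m≤n) = fromℕ-mono-≤ m≤n
  fromℤ-mono-≤ (-≤- n≤m) = neg-mono-≤ (fromℕ-mono-≤ (s≤s n≤m))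
  fromℤ-mono-≤ (-≤+ {m} {n}) = begin
    - fromℕ (suc m)  ≤⟨ neg-mono-≤ (fromℕ-mono-≤ {n = suc m} z≤n) ⟩
    - 0#             ≈⟨ -0#≈0# ⟩
    0#               ≤⟨ fromℕ-mono-≤ {n = n} z≤n ⟩
    fromℕ n          ∎

  fromℤ-suc : ∀ k → fromℤ (ℤ.suc k) ≈ 1# + fromℤ k
  fromℤ-suc (+ n)          = refl
  fromℤ-suc -[1+ zero ]    = begin-equality
    0#               ≈⟨ -‿inverseʳ 1# ⟨
    1# - 1#          ≈⟨ +-congˡ (-‿cong (+-identityʳ 1#)) ⟨
    1# - (1# + 0#)   ∎
  fromℤ-suc -[1+ suc n ]   = begin-equality
    - y              ≈⟨ +-identityˡ (- y) ⟨
    0# - y           ≈⟨ +-congʳ (-‿inverseʳ 1#) ⟨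
    (1# - 1#) - y    ≈⟨ +-assoc 1# (- 1#) (- y) ⟩
    1# + (- 1# - y)  ≈⟨ +-congˡ (-‿+-comm 1# y) ⟩
    1# - (1# + y)    ∎
    where y = fromℕ (suc n)

  floor : ∀ x → ∃ λ p → fromℤ p ≤ x × x < 1# + fromℤ p
  floor x = search (proj₁ above) base (<⇒≤ base<x) x<top
    where
    below = archimedean (- x)
    base = -[1+ proj₁ below ]
    base<x : fromℤ base < x
    base<x = begin-strict
      - fromℕ (suc (proj₁ below))  <⟨ neg-mono-< (x<1+x (fromℕ (proj₁ below))) ⟩
      - fromℕ (proj₁ below)        <⟨ neg-mono-< (proj₂ below) ⟩
      - - x                        ≈⟨ -‿involutive x ⟩
      x                            ∎
    above = archimedean (x - fromℤ base)
    x<top : x < fromℕ (proj₁ above) + fromℤ base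
    x<top = begin-strict
      x                                    ≈⟨ [x-y]+y≈x x (fromℤ base) ⟨
      (x - fromℤ base) + fromℤ base      <⟨ +-monoˡ-< (fromℤ base) (proj₂ above) ⟩
      fromℕ (proj₁ above) + fromℤ base    ∎
    search : ∀ n k → fromℤ k ≤ x → x < fromℕ n + fromℤ k →
             ∃ λ p → fromℤ p ≤ x × x < 1# + fromℤ p
    search zero    k k≤x x<n+k =
      contradiction (<-respʳ-≈ (+-identityˡ (fromℤ k)) x<n+k) (≤⇒≯ k≤x)
    search (suc n) k k≤x x<n+k with x <? (1# + fromℤ k)
    ... | yes x<1+k = k , k≤x , x<1+k
    ... | no  x≮1+k = search n (ℤ.suc k)
      (begin
        fromℤ (ℤ.suc k)  ≈⟨ fromℤ-suc k ⟩
        1# + fromℤ k     ≤⟨ ≮⇒≥ x≮1+k ⟩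
        x                ∎)
      (begin-strict
        x                              <⟨ x<n+k ⟩
        (1# + fromℕ n) + fromℤ k       ≈⟨ +-congʳ (+-comm 1# (fromℕ n)) ⟩
        (fromℕ n + 1#) + fromℤ k       ≈⟨ +-assoc (fromℕ n) 1# (fromℤ k) ⟩
        fromℕ n + (1# + fromℤ k)       ≈⟨ +-congˡ (fromℤ-suc k) ⟨
        fromℕ n + fromℤ (ℤ.suc k)      ∎)

  nearestInteger : ∀ x → ∃ λ p → ∀ k → ∣ x - fromℤ p ∣ ≤ ∣ x - fromℤ k ∣
  nearestInteger x with floor x
  ... | p , p≤x , x<1+p = choose (≤-total lo hi)
    where
    f = fromℤ p
    lo = x - f
    hi = (1# + f) - x

    diff-neg : ∀ y z → - (y - z) ≈ z - y
    diff-neg y z = ⁻¹-anti-homo‿- y z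

    0≤lo : 0# ≤ lo
    0≤lo = begin
      0#     ≈⟨ -‿inverseʳ f ⟨
      f - f  ≤⟨ +-monoˡ-≤ (- f) p≤x ⟩
      x - f  ∎

    0≤hi : 0# ≤ hi
    0≤hi = begin
      0#            ≈⟨ -‿inverseʳ x ⟨
      x - x         ≤⟨ +-monoˡ-≤ (- x) (<⇒≤ x<1+p) ⟩
      (1# + f) - x  ∎

    nonneg⇒neg≤ : ∀ {y} → 0# ≤ y → - y ≤ y
    nonneg⇒neg≤ {y} 0≤y = begin
      - y   ≤⟨ neg-mono-≤ 0≤y ⟩
      - 0#  ≈⟨ -0#≈0# ⟩
      0#    ≤⟨ 0≤y ⟩
      y     ∎

    ∣x-p∣≤lo : ∣ x - f ∣ ≤ lo
    ∣x-p∣≤lo = ⊔-lub ≤-refl (nonneg⇒neg≤ 0≤lo)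

    ∣x-sp∣≤hi : ∣ x - fromℤ (ℤ.suc p) ∣ ≤ hi
    ∣x-sp∣≤hi = ⊔-lub
      (begin
        x - fromℤ (ℤ.suc p)  ≈⟨ +-congˡ (-‿cong (fromℤ-suc p)) ⟩
        x - (1# + f)         ≈⟨ diff-neg (1# + f) x ⟨
        - hi                 ≤⟨ nonneg⇒neg≤ 0≤hi ⟩
        hi                   ∎)
      (begin
        - (x - fromℤ (ℤ.suc p))  ≈⟨ diff-neg x (fromℤ (ℤ.suc p)) ⟩
        fromℤ (ℤ.suc p) - x      ≈⟨ +-congʳ (fromℤ-suc p) ⟩
        hi                       ∎)

    d≤∣x-k∣ : ∀ {d} → d ≤ lo → d ≤ hi → ∀ k → d ≤ ∣ x - fromℤ k ∣
    d≤∣x-k∣ {d} d≤lo d≤hi k with k ℤ.≤? p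
    ... | yes k≤p = begin
      d                ≤⟨ d≤lo ⟩
      x - f            ≤⟨ +-monoʳ-≤ x (neg-mono-≤ (fromℤ-mono-≤ k≤p)) ⟩
      x - fromℤ k      ≤⟨ x≤x⊔y _ _ ⟩
      ∣ x - fromℤ k ∣  ∎
    ... | no  k≰p = begin
      d                        ≤⟨ d≤hi ⟩
      (1# + f) - x             ≈⟨ +-congʳ (fromℤ-suc p) ⟨
      fromℤ (ℤ.suc p) - x      ≤⟨ +-monoˡ-≤ (- x) (fromℤ-mono-≤ (ℤ.i<j⇒suc[i]≤j (ℤ.≰⇒> k≰p))) ⟩
      fromℤ k - x              ≈⟨ diff-neg x (fromℤ k) ⟨
      - (x - fromℤ k)          ≤⟨ x≤y⊔x _ _ ⟩
      ∣ x - fromℤ k ∣          ∎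

    choose : lo ≤ hi ⊎ hi ≤ lo → ∃ λ p → ∀ k → ∣ x - fromℤ p ∣ ≤ ∣ x - fromℤ k ∣
    choose (inj₁ lo≤hi) = p , λ k → ≤-trans ∣x-p∣≤lo (d≤∣x-k∣ ≤-refl lo≤hi k)
    choose (inj₂ hi≤lo) = ℤ.suc p , λ k → ≤-trans ∣x-sp∣≤hi (d≤∣x-k∣ hi≤lo ≤-refl k)

  ‖_‖ : ℝ → ℝ
  ‖ x ‖ = ∣ x - fromℤ (proj₁ (nearestInteger x)) ∣

  -- Up to the sign condition, r ∈ RationalPowersBelow q x says that
  -- r ≤ q ^ ((m - k) / b) for some rational (m - k) / b ≤ x.
  RationalPowersBelow : ℕ → ℝ → Pred ℝ 0ℓ
  RationalPowersBelow q x r = 0# ≤ r × ∃ λ m → ∃ λ k → ∃ λ b →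
    NonZero b ×
    fromℕ m - fromℕ k ≤ fromℕ b * x ×
    r ^ b * fromℕ q ^ k ≤ fromℕ q ^ m

  powerSupremum : ∀ q .{{_ : NonZero q}} x →
                  ∃ (IsSupremum _<_ (RationalPowersBelow q x))
  powerSupremum q x = supremum _ (0# , inhabited) (fromℕ q ^ N , bounded)
    where
    k₀ = proj₁ (archimedean (- x))
    N  = proj₁ (archimedean x)

    inhabited : RationalPowersBelow q x 0#
    inhabited = ≤-refl , 0 , k₀ , 1 , _ ,
      (begin
        0# - fromℕ k₀    ≈⟨ +-identityˡ _ ⟩
        - fromℕ k₀       <⟨ neg-mono-< (proj₂ (archimedean (- x))) ⟩
        - - x            ≈⟨ -‿involutive x ⟩
        x                ≈⟨ *-identityˡ x ⟨
        1# * x           ≈⟨ *-congʳ (+-identityʳ 1#) ⟨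
        fromℕ 1 * x      ∎) ,
      (begin
        (0# * 1#) * fromℕ q ^ k₀  ≈⟨ *-congʳ (zeroˡ 1#) ⟩
        0# * fromℕ q ^ k₀         ≈⟨ zeroˡ _ ⟩
        0#                        <⟨ 0<1 ⟩
        1#                        ∎)

    fromℕ-*-< : ∀ b .{{_ : NonZero b}} → fromℕ b * x < fromℕ (N ℕ.* b)
    fromℕ-*-< b = begin-strict
      fromℕ b * x        ≈⟨ *-comm _ x ⟩
      x * fromℕ b        <⟨ *-monoˡ-< (fromℕ-pos b) (proj₂ (archimedean x)) ⟩
      fromℕ N * fromℕ b  ≈⟨ ×1-homo-* N b ⟨
      fromℕ (N ℕ.* b)    ∎
      where open import Algebra.Properties.Semiring.Mult semiring using (×1-homo-*)

    bounded : IsUpperBound _<_ (RationalPowersBelow q x) (fromℕ q ^ N)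
    bounded {r} (_ , m , k , b , b≢0 , m-k≤bx , rᵇqᵏ≤qᵐ) qᴺ<r = ≤⇒≯
      (fromℕ-mono-≤ Nb+k≤m)
      (begin-strict
        fromℕ m                        ≈⟨ [x-y]+y≈x (fromℕ m) (fromℕ k) ⟨
        (fromℕ m - fromℕ k) + fromℕ k  ≤⟨ +-monoˡ-≤ (fromℕ k) m-k≤bx ⟩
        fromℕ b * x + fromℕ k          <⟨ +-monoˡ-< (fromℕ k) (fromℕ-*-< b {{b≢0}}) ⟩
        fromℕ (N ℕ.* b) + fromℕ k      ≈⟨ ·-homo-+ 1# (N ℕ.* b) k ⟨
        fromℕ (N ℕ.* b ℕ.+ k)          ∎)
      where
      0<q : 0# < fromℕ q
      0<q = fromℕ-pos q
      qᴺᵇ⁺ᵏ<qᵐ : fromℕ q ^ (N ℕ.* b ℕ.+ k) < fromℕ q ^ m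
      qᴺᵇ⁺ᵏ<qᵐ = begin-strict
        fromℕ q ^ (N ℕ.* b ℕ.+ k)         ≈⟨ ^-homo-* (fromℕ q) (N ℕ.* b) k ⟩
        fromℕ q ^ (N ℕ.* b) * fromℕ q ^ k ≈⟨ *-congʳ (^-assocʳ (fromℕ q) N b) ⟨
        (fromℕ q ^ N) ^ b * fromℕ q ^ k   <⟨ *-monoˡ-< (^-pos 0<q k) (^-monoˡ-< b {{b≢0}} (<⇒≤ (^-pos 0<q N)) qᴺ<r) ⟩
        r ^ b * fromℕ q ^ k               ≤⟨ rᵇqᵏ≤qᵐ ⟩
        fromℕ q ^ m                       ∎
      Nb+k≤m : N ℕ.* b ℕ.+ k ℕ.≤ m
      Nb+k≤m with ℕ.≤-total (N ℕ.* b ℕ.+ k) m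
      ... | inj₁ le = le
      ... | inj₂ ge = contradiction qᴺᵇ⁺ᵏ<qᵐ (≤⇒≯ (^-monoʳ-≤ (1≤fromℕ q) ge))

  infixr 8 _^ʳ_

  -- As q ≥ 1, q ^ʳ x is the supremum of the q ^ s over rational s ≤ x.
  _^ʳ_ : (q : ℕ) .{{_ : NonZero q}} → ℝ → ℝ
  q ^ʳ x = proj₁ (powerSupremum q x)

  open import Relation.Binary.Construct.Add.Extrema.Strict _<_ public
    using (_<±_)

  Tail : (ℕ → ℝ) → ℕ → Pred (ℝ ±) 0ℓ
  Tail a N x = ∃ λ q → N ℕ.≤ q × x ≡ [ a q ]

  -- The liminf is the supremum over N of the infima of a over q ≥ N, taken
  -- in the extended real line, where it always exists.
  IsLiminf : (ℕ → ℝ) → Pred (ℝ ±) 0ℓ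
  IsLiminf a = IsSupremum _<±_ (λ m → ∃ λ N → IsInfimum _<±_ (Tail a N) m)

  -- The value 0# for the empty vector is harmless: the maximum is only
  -- taken of vectors with non-negative entries.
  maximum : ∀ {n} → Vector ℝ n → ℝ
  maximum = foldr _⊔_ 0#

  IsWeightVector : ∀ {n} → Pred (Vector ℝ n) 0ℓ
  IsWeightVector i = (∀ j → 0# ≤ i j × i j ≤ 1#) × sum i ≈ 1#

  weightedDistance : ∀ {n} (i α : Vector ℝ n) (q : ℕ) .{{_ : NonZero q}} → ℝ
  weightedDistance i α q = maximum (λ j → q ^ʳ i j * ‖ fromℕ q * α j ‖)

  -- The sequence is indexed from q = 1, since 0 has no real powers.
  Bad : ∀ {n} → Vector ℝ n → Pred (Vector ℝ n) 0ℓ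
  Bad i α = ∃ λ l → IsLiminf (λ q → weightedDistance i α (suc q)) l × [ 0# ] <± l

  DirichletImprovable : ∀ {n} → Vector ℝ n → Pred (Vector ℝ n) 0ℓ
  DirichletImprovable i α = ∃ λ c → 0# < c × c < 1# ×
    ∃ λ Q₀ → ∀ Q .{{_ : NonZero Q}} → Q₀ ℕ.≤ Q →
    ∃ λ q → 1 ℕ.≤ q × q ℕ.≤ Q ×
    (∀ j → ‖ fromℕ q * α j ‖ < c * Q ^ʳ (- i j))

{-# OPTIONS --safe #-}

-- If Dirichlet's theorem cannot be improved by a factor close to 1 at Q, then
-- the boxes with sides slightly below Q^(-i_j) around the points qα, 0 ≤ q ≤ Q,
-- are disjoint modulo 1, and their total volume is almost 1.  Over a point of
-- such a box the times q at which qα returns to it are at least Q + 1 apart,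
-- and since there is almost no uncovered volume, on average not much further
-- apart.  Hence if qα is much closer to an integer point than the size of the
-- box, then q = k(Q + 1) + ρ with ρ/Q small.  Dirichlet's theorem provides two
-- such approximations q = k(Q + 1) + ρ and q′ = l(Q + 1) + σ, the second much
-- more precise than the first.  The combination l q - k q′ = l ρ - k σ is tiny
-- compared with Q, so a badly approximable α forces it to vanish.  But then the
-- two approximations are proportional and the first is as precise as the
-- second, which contradicts bad approximability again.

module Submission where

open import Defs
import Algebra.Solver.Ring
open import Algebra.Solver.Ring.AlmostCommutativeRing
  using (fromCommutativeRing; _-Raw-AlmostCommutative⟶_)
open import Data.Fin.Base as Fin using (Fin; zero; suc; toℕ; fromℕ<; combine; finToFun; funToFin)
import Data.Fin.Properties as Fin
open import Data.Integer.Base as ℤ using (ℤ; +_; -[1+_])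
import Data.Integer.DivMod as ℤ
import Data.Integer.Properties as ℤ
import Data.Integer.Solver as ℤ
import Data.Maybe.Base as Maybe
open import Data.Nat.Base as ℕ using (ℕ; zero; suc; NonZero; z≤n; s≤s)
import Data.Nat.DivMod as ℕ
import Data.Nat.Properties as ℕ
import Data.Nat.Solver as ℕ
open import Data.Product.Base as Product using (∃; _×_; _,_; proj₁; proj₂)
open import Data.Product.Function.NonDependent.Propositional using (_×-↔_)
open import Data.Sum.Base as Sum using (_⊎_; inj₁; inj₂; [_,_]′)
open import Data.Sum.Function.Propositional using (_⊎-↔_)
open import Data.Vec.Functional using (Vector; foldr; tail)
open import Function.Base using (_∘_)
open import Function.Bundles using (_↔_; Injection)
open import Function.Definitions using (Injective)
open import Function.Properties.Inverse using (↔-refl; ↔-sym; ↔-trans; ↔⇒↣)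
open import Relation.Binary.Bundles using (StrictTotalOrder)
open import Relation.Binary.Definitions using (Tri; tri<; tri≈; tri>)
import Relation.Binary.PropositionalEquality as ≡
open ≡ using (_≡_; _≗_; _≢_)
open import Relation.Nullary using (¬_; Dec; yes; no; contradiction)
open import Relation.Nullary.Decidable.Core using (decidable-stable; dec⇒maybe)
open import Relation.Unary using (_⊆_)

-- Volumes are replaced by cardinalities. Coordinate j of the torus is stretched by an integer M_j
-- close to a multiple of Q^(i_j) and cut into unit cells, and a box becomes a cube of 3g offsets
-- per side. The averaging over return times becomes one injection into k copies of the grid. The
-- factor 3 leaves a middle third whose points stay in the cube when displaced by at most g. The
-- last step has two obstacles. Where a weight is zero, Q^(i_j) = 1 does not grow, so a small time
-- gives no gain; bad approximability is therefore first restated with a coordinate of positive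
-- weight. Secondly, the precision h of the second approximation has to beat the multipliers k and
-- l, while the bound on l grows with h. This is no circle: in the parallel case only the multiplier
-- k of the coarse approximation enters, and its bound K₁ is fixed before h. The constants are
-- chosen in the order D, K₁, h, K, A, κ, g₀, all of them independent of Q.

module OrderedField (R : CompleteOrderedField) where

  open RealAnalysis R public hiding (zero)
  open import Algebra.Properties.Semiring.Mult semiring public using (×1-homo-*)
  open import Algebra.Properties.Ring ring public
    using (-‿involutive; -0#≈0#; -‿distribˡ-*; -‿distribʳ-*; -‿+-comm; ⁻¹-anti-homo‿-)
  open import Relation.Binary.Reasoning.StrictPartialOrder
    (StrictTotalOrder.strictPartialOrder strictTotalOrder) public

  -- Naturals and integers in the ordered field

  fromℕ-homo-+ : ∀ m n → fromℕ (m ℕ.+ n) ≈ fromℕ m + fromℕ n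
  fromℕ-homo-+ = ·-homo-+ 1#

  fromℕ-homo-* : ∀ m n → fromℕ (m ℕ.* n) ≈ fromℕ m * fromℕ n
  fromℕ-homo-* = ×1-homo-*

  fromℕ-1 : fromℕ 1 ≈ 1#
  fromℕ-1 = +-identityʳ 1#

  fromℕ-homo-^ : ∀ m n → fromℕ (m ℕ.^ n) ≈ fromℕ m ^ n
  fromℕ-homo-^ m zero    = fromℕ-1
  fromℕ-homo-^ m (suc n) = trans (fromℕ-homo-* m (m ℕ.^ n)) (*-congˡ (fromℕ-homo-^ m n))

  fromℤ-neg : ∀ k → fromℤ (ℤ.- k) ≈ - fromℤ k
  fromℤ-neg (+ zero)  = sym -0#≈0#
  fromℤ-neg (+ suc n) = refl
  fromℤ-neg -[1+ n ]  = sym (-‿involutive _)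

  fromℤ-⊖ : ∀ m n → fromℤ (m ℤ.⊖ n) ≈ fromℕ m - fromℕ n
  fromℤ-⊖ m zero = begin-equality
    fromℕ m       ≈⟨ +-identityʳ _ ⟨
    fromℕ m + 0#  ≈⟨ +-congˡ -0#≈0# ⟨
    fromℕ m - 0#  ∎
  fromℤ-⊖ zero    (suc n) = sym (+-identityˡ _)
  fromℤ-⊖ (suc m) (suc n) = begin-equality
    fromℤ (suc m ℤ.⊖ suc n)               ≡⟨ ≡.cong fromℤ (ℤ.[1+m]⊖[1+n]≡m⊖n m n) ⟩
    fromℤ (m ℤ.⊖ n)                       ≈⟨ fromℤ-⊖ m n ⟩
    fromℕ m - fromℕ n                     ≈⟨ +-congʳ ([x+y]-y≈x (fromℕ m) 1#) ⟨
    ((fromℕ m + 1#) - 1#) - fromℕ n       ≈⟨ +-assoc _ _ _ ⟩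
    (fromℕ m + 1#) + (- 1# - fromℕ n)     ≈⟨ +-cong (+-comm _ _) (-‿+-comm 1# (fromℕ n)) ⟩
    fromℕ (suc m) - fromℕ (suc n)         ∎

  fromℤ-homo-+ : ∀ j k → fromℤ (j ℤ.+ k) ≈ fromℤ j + fromℤ k
  fromℤ-homo-+ (+ m)    (+ n)    = fromℕ-homo-+ m n
  fromℤ-homo-+ (+ m)    -[1+ n ] = fromℤ-⊖ m (suc n)
  fromℤ-homo-+ -[1+ m ] (+ n)    = trans (fromℤ-⊖ n (suc m)) (+-comm _ _)
  fromℤ-homo-+ -[1+ m ] -[1+ n ] = begin-equality
    - fromℕ (suc (suc (m ℕ.+ n)))        ≡⟨ ≡.cong (λ k → - fromℕ k) (ℕ.+-suc (suc m) n) ⟨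
    - fromℕ (suc m ℕ.+ suc n)            ≈⟨ -‿cong (fromℕ-homo-+ (suc m) (suc n)) ⟩
    - (fromℕ (suc m) + fromℕ (suc n))    ≈⟨ -‿+-comm _ _ ⟨
    - fromℕ (suc m) - fromℕ (suc n)      ∎

  private
    fromℤ-homo-+* : ∀ m k → fromℤ (+ m ℤ.* k) ≈ fromℕ m * fromℤ k
    fromℤ-homo-+* m (+ n) =
      trans (reflexive (≡.cong fromℤ (≡.sym (ℤ.pos-* m n)))) (fromℕ-homo-* m n)
    fromℤ-homo-+* m -[1+ n ] = begin-equality
      fromℤ (+ m ℤ.* ℤ.- (+ suc n))     ≡⟨ ≡.cong fromℤ (ℤ.neg-distribʳ-* (+ m) (+ suc n)) ⟨
      fromℤ (ℤ.- (+ m ℤ.* + suc n))     ≈⟨ fromℤ-neg (+ m ℤ.* + suc n) ⟩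
      - fromℤ (+ m ℤ.* + suc n)         ≈⟨ -‿cong (fromℤ-homo-+* m (+ suc n)) ⟩
      - (fromℕ m * fromℕ (suc n))       ≈⟨ -‿distribʳ-* _ _ ⟩
      fromℕ m * - fromℕ (suc n)         ∎

  fromℤ-homo-* : ∀ j k → fromℤ (j ℤ.* k) ≈ fromℤ j * fromℤ k
  fromℤ-homo-* (+ m)    k = fromℤ-homo-+* m k
  fromℤ-homo-* -[1+ m ] k = begin-equality
    fromℤ (ℤ.- (+ suc m) ℤ.* k)    ≡⟨ ≡.cong fromℤ (ℤ.neg-distribˡ-* (+ suc m) k) ⟨
    fromℤ (ℤ.- (+ suc m ℤ.* k))    ≈⟨ fromℤ-neg (+ suc m ℤ.* k) ⟩
    - fromℤ (+ suc m ℤ.* k)        ≈⟨ -‿cong (fromℤ-homo-+* (suc m) k) ⟩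
    - (fromℕ (suc m) * fromℤ k)    ≈⟨ -‿distribˡ-* _ _ ⟩
    - fromℕ (suc m) * fromℤ k      ∎

  private
    morphism : ℤ.+-*-rawRing -Raw-AlmostCommutative⟶ fromCommutativeRing commutativeRing
    morphism = record
      { ⟦_⟧    = fromℤ
      ; +-homo = fromℤ-homo-+
      ; *-homo = fromℤ-homo-*
      ; -‿homo = fromℤ-neg
      ; 0-homo = refl
      ; 1-homo = fromℕ-1
      }

  -- The coefficients are integers because their equality is decided by computation, which the
  -- cancellation of terms relies on.
  module Solver = Algebra.Solver.Ring ℤ.+-*-rawRing (fromCommutativeRing commutativeRing) morphism
    (λ j k → Maybe.map (λ j≡k → reflexive (≡.cong fromℤ j≡k)) (dec⇒maybe (j ℤ.≟ k)))
  open Solver using (solve; con; _:+_; _:*_; _:=_)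

  -- Inequalities, absolute values and rounding

  ≰⇒> : ∀ {x y} → ¬ (x ≤ y) → y < x
  ≰⇒> {x} {y} x≰y with compare x y
  ... | tri< x<y _ _ = contradiction (<⇒≤ x<y) x≰y
  ... | tri≈ _ x≈y _ = contradiction (inj₂ x≈y) x≰y
  ... | tri> _ _ y<x = y<x

  +-mono-≤ : ∀ {w x y z} → w ≤ x → y ≤ z → w + y ≤ x + z
  +-mono-≤ {w} {x} {y} {z} w≤x y≤z = ≤-trans (+-monoˡ-≤ y w≤x) (+-monoʳ-≤ x y≤z)

  +-mono-<-≤ : ∀ {w x y z} → w < x → y ≤ z → w + y < x + z
  +-mono-<-≤ {w} {x} {y} {z} w<x y≤z = begin-strict
    w + y <⟨ +-monoˡ-< y w<x ⟩ x + y ≤⟨ +-monoʳ-≤ x y≤z ⟩ x + z ∎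

  +-mono-≤-< : ∀ {w x y z} → w ≤ x → y < z → w + y < x + z
  +-mono-≤-< {w} {x} {y} {z} w≤x y<z = begin-strict
    w + y ≤⟨ +-monoˡ-≤ y w≤x ⟩ x + y <⟨ +-monoʳ-< x y<z ⟩ x + z ∎

  *-monoʳ-< : ∀ {z} → 0# < z → ∀ {x y} → x < y → z * x < z * y
  *-monoʳ-< {z} 0<z {x} {y} x<y = begin-strict
    z * x ≈⟨ *-comm z x ⟩ x * z <⟨ *-monoˡ-< 0<z x<y ⟩ y * z ≈⟨ *-comm y z ⟩ z * y ∎

  *-mono-≤ : ∀ {w x y z} → 0# ≤ w → 0# ≤ z → w ≤ x → y ≤ z → w * y ≤ x * z
  *-mono-≤ {w} {x} {y} {z} 0≤w 0≤z w≤x y≤z = ≤-trans (*-monoʳ-≤ 0≤w y≤z) (*-monoˡ-≤ 0≤z w≤x)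

  *-cancelˡ-< : ∀ {z} → 0# ≤ z → ∀ {x y} → z * x < z * y → x < y
  *-cancelˡ-< 0≤z zx<zy = ≰⇒> λ y≤x → ≤⇒≯ (*-monoʳ-≤ 0≤z y≤x) zx<zy

  *-cancelˡ-≤ : ∀ {z} → 0# < z → ∀ {x y} → z * x ≤ z * y → x ≤ y
  *-cancelˡ-≤ 0<z zx≤zy = ≮⇒≥ λ y<x → ≤⇒≯ zx≤zy (*-monoʳ-< 0<z y<x)

  *-nonNeg : ∀ {x y} → 0# ≤ x → 0# ≤ y → 0# ≤ x * y
  *-nonNeg {x} {y} 0≤x 0≤y = begin
    0# ≈⟨ zeroʳ x ⟨ x * 0# ≤⟨ *-monoʳ-≤ 0≤x 0≤y ⟩ x * y ∎

  0≤fromℕ : ∀ n → 0# ≤ fromℕ n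
  0≤fromℕ n = fromℕ-mono-≤ {n = n} z≤n

  fromℕ-mono-< : ∀ {m n} → m ℕ.< n → fromℕ m < fromℕ n
  fromℕ-mono-< {m} {n} m<n = begin-strict
    fromℕ m <⟨ x<1+x _ ⟩ fromℕ (suc m) ≤⟨ fromℕ-mono-≤ m<n ⟩ fromℕ n ∎

  fromℕ-cancel-≤ : ∀ {m n} → fromℕ m ≤ fromℕ n → m ℕ.≤ n
  fromℕ-cancel-≤ m≤n = ℕ.≮⇒≥ λ n<m → ≤⇒≯ m≤n (fromℕ-mono-< n<m)

  positiveInverse : ∀ {x} → 0# < x → ∃ λ y → 0# < y × x * y ≈ 1#
  positiveInverse {x} 0<x with inverse x (λ x≈0 → irrefl (sym x≈0) 0<x)
  ... | y , xy≈1 = y , *-cancelˡ-< (<⇒≤ 0<x) (begin-strict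
    x * 0# ≈⟨ zeroʳ x ⟩ 0# <⟨ 0<1 ⟩ 1# ≈⟨ xy≈1 ⟨ x * y ∎) , xy≈1

  dense : ∀ {x y} → x < y → ∃ λ z → x < z × z < y
  dense {x} {y} x<y with positiveInverse (fromℕ-pos 2)
  ... | h , _ , 2h≈1 =
    (x + y) * h
    , *-cancelˡ-< (0≤fromℕ 2) (begin-strict
        fromℕ 2 * x                ≈⟨ double x ⟩
        x + x                      <⟨ +-monoʳ-< x x<y ⟩
        x + y                      ≈⟨ halve (x + y) ⟨
        fromℕ 2 * ((x + y) * h)    ∎)
    , *-cancelˡ-< (0≤fromℕ 2) (begin-strict
        fromℕ 2 * ((x + y) * h)    ≈⟨ halve (x + y) ⟩
        x + y                      <⟨ +-monoˡ-< y x<y ⟩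
        y + y                      ≈⟨ double y ⟨
        fromℕ 2 * y                ∎)
    where
    double : ∀ z → fromℕ 2 * z ≈ z + z
    double = solve 1 (λ z → con (+ 2) :* z := z :+ z) refl
    halve : ∀ z → fromℕ 2 * (z * h) ≈ z
    halve z = begin-equality
      fromℕ 2 * (z * h)  ≈⟨ solve 3 (λ a z h → a :* (z :* h) := (a :* h) :* z) refl (fromℕ 2) z h ⟩
      (fromℕ 2 * h) * z  ≈⟨ *-congʳ 2h≈1 ⟩
      1# * z             ≈⟨ *-identityˡ z ⟩
      z                  ∎

  ∣∣-lub : ∀ {x a} → x ≤ a → - x ≤ a → ∣ x ∣ ≤ a
  ∣∣-lub = ⊔-lub

  ∣∣-lub-< : ∀ {x a} → x < a → - x < a → ∣ x ∣ < a
  ∣∣-lub-< {x} x<a -x<a with ≤-total x (- x)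
  ... | inj₁ x≤-x = begin-strict _ ≤⟨ ⊔-lub x≤-x ≤-refl ⟩ _ <⟨ -x<a ⟩ _ ∎
  ... | inj₂ -x≤x = begin-strict _ ≤⟨ ⊔-lub ≤-refl -x≤x ⟩ _ <⟨ x<a ⟩ _ ∎

  x≤∣x∣ : ∀ x → x ≤ ∣ x ∣
  x≤∣x∣ x = x≤x⊔y _ _

  -x≤∣x∣ : ∀ x → - x ≤ ∣ x ∣
  -x≤∣x∣ x = x≤y⊔x _ _

  -∣x∣≤x : ∀ x → - ∣ x ∣ ≤ x
  -∣x∣≤x x = begin
    - ∣ x ∣ ≤⟨ neg-mono-≤ (-x≤∣x∣ x) ⟩ - - x ≈⟨ -‿involutive x ⟩ x ∎

  0≤∣x∣ : ∀ x → 0# ≤ ∣ x ∣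
  0≤∣x∣ x with ≤-total 0# x
  ... | inj₁ 0≤x = ≤-trans 0≤x (x≤∣x∣ x)
  ... | inj₂ x≤0 = begin
    0# ≈⟨ -0#≈0# ⟨ - 0# ≤⟨ neg-mono-≤ x≤0 ⟩ - x ≤⟨ -x≤∣x∣ x ⟩ ∣ x ∣ ∎

  ∣∣-cong : ∀ {x y} → x ≈ y → ∣ x ∣ ≈ ∣ y ∣
  ∣∣-cong {x} {y} x≈y = antisym (le x≈y) (le (sym x≈y))
    where
    open import Relation.Binary.Properties.StrictTotalOrder strictTotalOrder using (antisym)
    le : ∀ {x y} → x ≈ y → ∣ x ∣ ≤ ∣ y ∣
    le {x} {y} x≈y = ⊔-lub (≤-trans (inj₂ x≈y) (x≤∣x∣ y)) (≤-trans (inj₂ (-‿cong x≈y)) (-x≤∣x∣ y))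

  ∣-x∣≤∣x∣ : ∀ x → ∣ - x ∣ ≤ ∣ x ∣
  ∣-x∣≤∣x∣ x = ⊔-lub (-x≤∣x∣ x) (≤-trans (inj₂ (-‿involutive x)) (x≤∣x∣ x))

  ∣x+y∣≤∣x∣+∣y∣ : ∀ x y → ∣ x + y ∣ ≤ ∣ x ∣ + ∣ y ∣
  ∣x+y∣≤∣x∣+∣y∣ x y = ⊔-lub (+-mono-≤ (x≤∣x∣ x) (x≤∣x∣ y))
    (≤-trans (inj₂ (sym (-‿+-comm x y))) (+-mono-≤ (-x≤∣x∣ x) (-x≤∣x∣ y)))

  ∣x-y∣≤∣x∣+∣y∣ : ∀ x y → ∣ x - y ∣ ≤ ∣ x ∣ + ∣ y ∣
  ∣x-y∣≤∣x∣+∣y∣ x y = ≤-trans (∣x+y∣≤∣x∣+∣y∣ x (- y)) (+-monoʳ-≤ ∣ x ∣ (∣-x∣≤∣x∣ y))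

  ∣ax∣≤a∣x∣ : ∀ {a} → 0# ≤ a → ∀ x → ∣ a * x ∣ ≤ a * ∣ x ∣
  ∣ax∣≤a∣x∣ {a} 0≤a x = ⊔-lub (*-monoʳ-≤ 0≤a (x≤∣x∣ x))
    (≤-trans (inj₂ (-‿distribʳ-* a x)) (*-monoʳ-≤ 0≤a (-x≤∣x∣ x)))

  a∣x∣≤∣ax∣ : ∀ {a} → 0# ≤ a → ∀ x → a * ∣ x ∣ ≤ ∣ a * x ∣
  a∣x∣≤∣ax∣ {a} 0≤a x with ≤-total 0# x
  ... | inj₁ 0≤x = begin
    a * ∣ x ∣  ≤⟨ *-monoʳ-≤ 0≤a (⊔-lub ≤-refl (≤-trans (neg-mono-≤ 0≤x) (≤-trans (inj₂ -0#≈0#) 0≤x))) ⟩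
    a * x      ≤⟨ x≤∣x∣ (a * x) ⟩
    ∣ a * x ∣  ∎
  ... | inj₂ x≤0 = begin
    a * ∣ x ∣  ≤⟨ *-monoʳ-≤ 0≤a (⊔-lub (≤-trans x≤0 (≤-trans (inj₂ (sym -0#≈0#)) (neg-mono-≤ x≤0))) ≤-refl) ⟩
    a * - x    ≈⟨ -‿distribʳ-* a x ⟨
    - (a * x)  ≤⟨ -x≤∣x∣ (a * x) ⟩
    ∣ a * x ∣  ∎

  ∣fromℤ∣<1⇒≡0 : ∀ k → ∣ fromℤ k ∣ < 1# → k ≡ + 0
  ∣fromℤ∣<1⇒≡0 (+ zero)  _    = ≡.refl
  ∣fromℤ∣<1⇒≡0 (+ suc n) ∣k∣<1 = contradiction ∣k∣<1
    (≤⇒≯ (≤-trans (1≤fromℕ (suc n)) (x≤∣x∣ _)))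
  ∣fromℤ∣<1⇒≡0 -[1+ n ]  ∣k∣<1 = contradiction ∣k∣<1
    (≤⇒≯ (≤-trans (1≤fromℕ (suc n)) (≤-trans (inj₂ (sym (-‿involutive _))) (-x≤∣x∣ _))))

  -- Abstract, so that type checking never unfolds the search behind `floor`.
  abstract
    ⌊_⌋ : ℝ → ℤ
    ⌊ x ⌋ = proj₁ (floor x)

    ⌊x⌋≤x : ∀ x → fromℤ ⌊ x ⌋ ≤ x
    ⌊x⌋≤x x = proj₁ (proj₂ (floor x))

    x<1+⌊x⌋ : ∀ x → x < 1# + fromℤ ⌊ x ⌋
    x<1+⌊x⌋ x = proj₂ (proj₂ (floor x))

  floorℕ : ∀ {x} → 0# ≤ x → ∃ λ n → fromℕ n ≤ x × x < fromℕ (suc n)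
  floorℕ {x} 0≤x = conclude ⌊ x ⌋ (⌊x⌋≤x x) (x<1+⌊x⌋ x)
    where
    conclude : ∀ k → fromℤ k ≤ x → x < 1# + fromℤ k → ∃ λ n → fromℕ n ≤ x × x < fromℕ (suc n)
    conclude (+ n)    n≤x x<1+n = n , n≤x , x<1+n
    conclude -[1+ n ] _   x<1+k = contradiction 0≤x (≤⇒≯′ (begin-strict
      x                            <⟨ x<1+k ⟩
      1# - fromℕ (suc n)           ≤⟨ +-monoˡ-≤ _ (1≤fromℕ (suc n)) ⟩
      fromℕ (suc n) - fromℕ (suc n) ≈⟨ -‿inverseʳ _ ⟩
      0#                           ∎))
      where
      ≤⇒≯′ : ∀ {x y} → x < y → ¬ (y ≤ x)
      ≤⇒≯′ x<y y≤x = ≤⇒≯ y≤x x<y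

  ceiling : ∀ {x} → 1# ≤ x → ∃ λ m → NonZero m × x ≤ fromℕ m × fromℕ m ≤ 1# + x
  ceiling {x} 1≤x = suc (proj₁ n) , _ , <⇒≤ (proj₂ (proj₂ n)) , +-monoʳ-≤ 1# (proj₁ (proj₂ n))
    where n = floorℕ (≤-trans (<⇒≤ 0<1) 1≤x)

-- Real powers of natural numbers

ℕ^-distribʳ-* : ∀ o m n → (m ℕ.* n) ℕ.^ o ≡ m ℕ.^ o ℕ.* n ℕ.^ o
ℕ^-distribʳ-* zero    m n = ≡.refl
ℕ^-distribʳ-* (suc o) m n = ≡.trans (≡.cong (m ℕ.* n ℕ.*_) (ℕ^-distribʳ-* o m n))
  (ℕ.[m*n]*[o*p]≡[m*o]*[n*p] m n (m ℕ.^ o) (n ℕ.^ o))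

module RealPowers (R : CompleteOrderedField) where

  open OrderedField R
  open Solver using (solve; con; _:+_; _:*_; _:-_; _:=_)
  open import Algebra.Properties.CommutativeSemiring.Exp commutativeSemiring
    using (^-distrib-*; ^-congˡ)

  ^-mono-≤ : ∀ n {x y} → 0# ≤ x → x ≤ y → x ^ n ≤ y ^ n
  ^-mono-≤ n 0≤x (inj₁ x<y) = ^-monoˡ-≤ n 0≤x x<y
  ^-mono-≤ n 0≤x (inj₂ x≈y) = inj₂ (^-congˡ n x≈y)

  ^-cancelˡ-≤ : ∀ n .{{_ : NonZero n}} {x y} → 0# ≤ y → x ^ n ≤ y ^ n → x ≤ y
  ^-cancelˡ-≤ n 0≤y xⁿ≤yⁿ = ≮⇒≥ λ y<x → ≤⇒≯ xⁿ≤yⁿ (^-monoˡ-< n 0≤y y<x)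

  1^n≈1 : ∀ n → 1# ^ n ≈ 1#
  1^n≈1 zero    = refl
  1^n≈1 (suc n) = trans (*-identityˡ _) (1^n≈1 n)

  ^-nonNeg : ∀ {x} → 0# ≤ x → ∀ n → 0# ≤ x ^ n
  ^-nonNeg 0≤x zero    = <⇒≤ 0<1
  ^-nonNeg 0≤x (suc n) = *-nonNeg 0≤x (^-nonNeg 0≤x n)

  bernoulli : ∀ {h} → 0# ≤ h → ∀ n → 1# + fromℕ n * h ≤ (1# + h) ^ n
  bernoulli {h} _   zero    = inj₂ (trans (+-congˡ (zeroˡ h)) (+-identityʳ 1#))
  bernoulli {h} 0≤h (suc n) = begin
    1# + (1# + fromℕ n) * h           ≈⟨ +-identityʳ _ ⟨
    (1# + (1# + fromℕ n) * h) + 0#    ≤⟨ +-monoʳ-≤ _ (*-nonNeg 0≤h (*-nonNeg (0≤fromℕ n) 0≤h)) ⟩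
    (1# + (1# + fromℕ n) * h) + h * (fromℕ n * h)
      -- The solver reads `con (+ 1)` as `fromℕ 1`, which unfolds to `1# + 0#` and not to `1#`.
      ≈⟨ +-congʳ (+-congʳ fromℕ-1) ⟨
    (fromℕ 1 + (1# + fromℕ n) * h) + h * (fromℕ n * h)
      ≈⟨ +-congʳ (+-congˡ (*-congʳ (+-congʳ fromℕ-1))) ⟨
    (fromℕ 1 + (fromℕ 1 + fromℕ n) * h) + h * (fromℕ n * h)
      ≈⟨ identity (fromℕ n) h ⟩
    (fromℕ 1 + h) * (fromℕ 1 + fromℕ n * h)
      ≈⟨ *-cong (+-congʳ fromℕ-1) (+-congʳ fromℕ-1) ⟩
    (1# + h) * (1# + fromℕ n * h)     ≤⟨ *-monoʳ-≤ (≤-trans (<⇒≤ 0<1) 1≤1+h) (bernoulli 0≤h n) ⟩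
    (1# + h) * (1# + h) ^ n           ∎
    where
    1≤1+h : 1# ≤ 1# + h
    1≤1+h = begin 1# ≈⟨ +-identityʳ 1# ⟨ 1# + 0# ≤⟨ +-monoʳ-≤ 1# 0≤h ⟩ 1# + h ∎
    identity : ∀ n h → (fromℕ 1 + (fromℕ 1 + n) * h) + h * (n * h) ≈
                       (fromℕ 1 + h) * (fromℕ 1 + n * h)
    identity = solve 2 (λ n h → (con (+ 1) :+ (con (+ 1) :+ n) :* h) :+ h :* (n :* h) :=
                                (con (+ 1) :+ h) :* (con (+ 1) :+ n :* h)) refl

  -- By Bernoulli's inequality the powers of the inverse `1# + h` of `x` grow at least linearly, so
  -- one of them reaches `z`.
  geometric-decay : ∀ {x} → 0# < x → x < 1# → ∀ z → ∃ λ n → NonZero n × x ^ n * z ≤ 1#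
  geometric-decay {x} 0<x x<1 z = suc n , _ , (begin
    x ^ suc n * z               ≤⟨ *-monoʳ-≤ (<⇒≤ (^-pos 0<x (suc n))) z≤yⁿ ⟩
    x ^ suc n * y ^ suc n       ≈⟨ ^-distrib-* x y (suc n) ⟨
    (x * y) ^ suc n             ≈⟨ ^-congˡ (suc n) xy≈1 ⟩
    1# ^ suc n                  ≈⟨ 1^n≈1 (suc n) ⟩
    1#                          ∎)
    where
    y = proj₁ (positiveInverse 0<x)
    0<y = proj₁ (proj₂ (positiveInverse 0<x))
    xy≈1 = proj₂ (proj₂ (positiveInverse 0<x))
    h = y - 1#
    0<h : 0# < h
    0<h = begin-strict
      0#       ≈⟨ -‿inverseʳ 1# ⟨
      1# - 1#  <⟨ +-monoˡ-< (- 1#) (begin-strict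
                   1#     ≈⟨ xy≈1 ⟨
                   x * y  <⟨ *-monoˡ-< 0<y x<1 ⟩
                   1# * y ≈⟨ *-identityˡ y ⟩
                   y      ∎) ⟩
      y - 1#   ∎
    h⁻¹ = proj₁ (positiveInverse 0<h)
    hh⁻¹≈1 = proj₂ (proj₂ (positiveInverse 0<h))
    n = proj₁ (archimedean (z * h⁻¹))
    z≤yⁿ : z ≤ y ^ suc n
    z≤yⁿ = begin
      z                           ≈⟨ *-identityʳ z ⟨
      z * 1#                      ≈⟨ *-congˡ (trans (*-comm h⁻¹ h) hh⁻¹≈1) ⟨
      z * (h⁻¹ * h)               ≈⟨ *-assoc z h⁻¹ h ⟨
      (z * h⁻¹) * h               ≤⟨ *-monoˡ-≤ (<⇒≤ 0<h) (<⇒≤ (proj₂ (archimedean (z * h⁻¹)))) ⟩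
      fromℕ n * h                 ≤⟨ *-monoˡ-≤ (<⇒≤ 0<h) (fromℕ-mono-≤ (ℕ.n≤1+n n)) ⟩
      fromℕ (suc n) * h           ≤⟨ <⇒≤ (x<1+x _) ⟩
      1# + fromℕ (suc n) * h      ≤⟨ bernoulli (<⇒≤ 0<h) (suc n) ⟩
      (1# + h) ^ suc n            ≈⟨ ^-congˡ (suc n) (trans (+-comm 1# h) ([x-y]+y≈x y 1#)) ⟩
      y ^ suc n                   ∎

  infixr 8 _^ᵃ_

  -- A copy of _^ʳ_ whose defining supremum is never unfolded during
  -- conversion checking.
  abstract
    _^ᵃ_ : (q : ℕ) .{{_ : NonZero q}} → ℝ → ℝ
    q ^ᵃ x = q ^ʳ x

    ^ᵃ≈^ʳ : ∀ q .{{_ : NonZero q}} x → q ^ᵃ x ≈ q ^ʳ x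
    ^ᵃ≈^ʳ q x = refl

    ^ᵃ-isSupremum : ∀ q .{{_ : NonZero q}} x →
                    IsSupremum _<_ (RationalPowersBelow q x) (q ^ᵃ x)
    ^ᵃ-isSupremum q x = proj₂ (powerSupremum q x)

  module _ (q : ℕ) .{{_ : NonZero q}} where

    ≤-^ᵃ : ∀ {x r} → RationalPowersBelow q x r → r ≤ q ^ᵃ x
    ≤-^ᵃ {x} r∈ = ≮⇒≥ (proj₁ (^ᵃ-isSupremum q x) r∈)

    0≤^ᵃ : ∀ x → 0# ≤ q ^ᵃ x
    0≤^ᵃ x = ≤-^ᵃ (≤-refl , 0 , k , 1 , _
      , (begin
          0# - fromℕ k   ≈⟨ +-identityˡ _ ⟩
          - fromℕ k      ≤⟨ neg-mono-≤ (<⇒≤ (proj₂ (archimedean (- x)))) ⟩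
          - - x          ≈⟨ -‿involutive x ⟩
          x              ≈⟨ *-identityˡ x ⟨
          1# * x         ≈⟨ *-congʳ fromℕ-1 ⟨
          fromℕ 1 * x    ∎)
      , (begin
          (0# * 1#) * fromℕ q ^ k   ≈⟨ trans (*-congʳ (zeroˡ 1#)) (zeroˡ _) ⟩
          0#                        <⟨ 0<1 ⟩
          1#                        ∎))
      where k = proj₁ (archimedean (- x))

    module _ {x : ℝ} (0≤x : 0# ≤ x) where

      -- For a non-negative exponent no negative powers of q are needed.
      NaturalPowersBelow : ℝ → Set
      NaturalPowersBelow r = 0# ≤ r × ∃ λ e → ∃ λ b → NonZero b ×
        fromℕ e ≤ fromℕ b * x × r ^ b ≤ fromℕ (q ℕ.^ e)

      naturalPowers≤ : ∀ {r} → NaturalPowersBelow r → r ≤ q ^ᵃ x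
      naturalPowers≤ {r} (0≤r , e , b , b≢0 , e≤bx , rᵇ≤qᵉ) = ≤-^ᵃ (0≤r , e , 0 , b , b≢0
        , (begin
            fromℕ e - 0#    ≈⟨ trans (+-congˡ -0#≈0#) (+-identityʳ _) ⟩
            fromℕ e         ≤⟨ e≤bx ⟩
            fromℕ b * x     ∎)
        , (begin
            r ^ b * 1#      ≈⟨ *-identityʳ _ ⟩
            r ^ b           ≤⟨ rᵇ≤qᵉ ⟩
            fromℕ (q ℕ.^ e) ≈⟨ fromℕ-homo-^ q e ⟩
            fromℕ q ^ e     ∎))

      -- Truncated subtraction treats both signs of the exponent at once. If `m` is below `k`,
      -- replacing the exponent by 0 weakens the bound on `r`, and 0 still lies below `b * x`
      -- because `x` is non-negative.
      toNaturalPowers : ∀ {r} → RationalPowersBelow q x r → NaturalPowersBelow r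
      toNaturalPowers {r} (0≤r , m , k , b , b≢0 , m-k≤bx , rᵇqᵏ≤qᵐ) =
        0≤r , e , b , b≢0 , [ above , below ]′ (ℕ.≤-total k m)
        , *-cancelˡ-≤ 0<qᵏ (begin
            fromℕ q ^ k * r ^ b             ≈⟨ *-comm _ _ ⟩
            r ^ b * fromℕ q ^ k             ≤⟨ rᵇqᵏ≤qᵐ ⟩
            fromℕ q ^ m                     ≤⟨ ^-monoʳ-≤ (1≤fromℕ q) (ℕ.m≤n+m∸n m k) ⟩
            fromℕ q ^ (k ℕ.+ e)             ≈⟨ ^-homo-* (fromℕ q) k e ⟩
            fromℕ q ^ k * fromℕ q ^ e       ≈⟨ *-congˡ (fromℕ-homo-^ q e) ⟨
            fromℕ q ^ k * fromℕ (q ℕ.^ e)   ∎)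
        where
        e = m ℕ.∸ k
        0<qᵏ : 0# < fromℕ q ^ k
        0<qᵏ = ^-pos (fromℕ-pos q) k
        above : k ℕ.≤ m → fromℕ e ≤ fromℕ b * x
        above k≤m = begin
          fromℕ e                        ≈⟨ [x+y]-y≈x _ (fromℕ k) ⟨
          (fromℕ e + fromℕ k) - fromℕ k  ≈⟨ +-congʳ (fromℕ-homo-+ e k) ⟨
          fromℕ (e ℕ.+ k) - fromℕ k      ≡⟨ ≡.cong (λ m → fromℕ m - fromℕ k) (ℕ.m∸n+n≡m k≤m) ⟩
          fromℕ m - fromℕ k              ≤⟨ m-k≤bx ⟩
          fromℕ b * x                    ∎
        below : m ℕ.≤ k → fromℕ e ≤ fromℕ b * x
        below m≤k = begin
          fromℕ e        ≡⟨ ≡.cong fromℕ (ℕ.m≤n⇒m∸n≡0 m≤k) ⟩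
          0#             ≤⟨ *-nonNeg (0≤fromℕ b) 0≤x ⟩
          fromℕ b * x    ∎

      ^ᵃ-lub : ∀ {z} → (∀ {r} → NaturalPowersBelow r → r ≤ z) → q ^ᵃ x ≤ z
      ^ᵃ-lub {z} bound = ≮⇒≥ λ z<q^x → exceed (proj₂ (^ᵃ-isSupremum q x) z<q^x)
        where
        exceed : ¬ (∃ λ r → RationalPowersBelow q x r × z < r)
        exceed (r , r∈ , z<r) = ≤⇒≯ (bound (toNaturalPowers r∈)) z<r

      *-^ᵃ-lub : ∀ {c z} → 0# < c → (∀ {r} → NaturalPowersBelow r → c * r ≤ z) → c * q ^ᵃ x ≤ z
      *-^ᵃ-lub {c} {z} 0<c bound = begin
        c * q ^ᵃ x     ≤⟨ *-monoʳ-≤ (<⇒≤ 0<c) (^ᵃ-lub λ {r} r∈ → *-cancelˡ-≤ 0<c (begin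
                            c * r          ≤⟨ bound r∈ ⟩
                            z              ≈⟨ c[dz]≈z ⟨
                            c * (d * z)    ∎)) ⟩
        c * (d * z)    ≈⟨ c[dz]≈z ⟩
        z              ∎
        where
        d = proj₁ (positiveInverse 0<c)
        c[dz]≈z : c * (d * z) ≈ z
        c[dz]≈z = trans (sym (*-assoc c d z))
          (trans (*-congʳ (proj₂ (proj₂ (positiveInverse 0<c)))) (*-identityˡ z))

      1≤^ᵃ : 1# ≤ q ^ᵃ x
      1≤^ᵃ = naturalPowers≤ (<⇒≤ 0<1 , 0 , 1 , _
        , *-nonNeg (0≤fromℕ 1) 0≤x , inj₂ (trans (1^n≈1 1) (sym fromℕ-1)))

      0<^ᵃ : 0# < q ^ᵃ x
      0<^ᵃ = begin-strict 0# <⟨ 0<1 ⟩ 1# ≤⟨ 1≤^ᵃ ⟩ q ^ᵃ x ∎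

  exponent≤ : ∀ {e b x} → x ≤ 1# → fromℕ e ≤ fromℕ b * x → e ℕ.≤ b
  exponent≤ {e} {b} {x} x≤1 e≤bx = fromℕ-cancel-≤ (begin
    fromℕ e         ≤⟨ e≤bx ⟩
    fromℕ b * x     ≤⟨ *-monoʳ-≤ (0≤fromℕ b) x≤1 ⟩
    fromℕ b * 1#    ≈⟨ *-identityʳ _ ⟩
    fromℕ b         ∎)

  ^ᵃ-≤-base : ∀ q .{{_ : NonZero q}} {x} → 0# ≤ x → x ≤ 1# → q ^ᵃ x ≤ fromℕ q
  ^ᵃ-≤-base q {x} 0≤x x≤1 = ^ᵃ-lub q 0≤x λ { {r} (0≤r , e , b , b≢0 , e≤bx , rᵇ≤qᵉ) →
    ^-cancelˡ-≤ b {{b≢0}} (0≤fromℕ q) (begin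
      r ^ b              ≤⟨ rᵇ≤qᵉ ⟩
      fromℕ (q ℕ.^ e)    ≤⟨ fromℕ-mono-≤ (ℕ.^-monoʳ-≤ q (exponent≤ {e} {b} x≤1 e≤bx)) ⟩
      fromℕ (q ℕ.^ b)    ≈⟨ fromℕ-homo-^ q b ⟩
      fromℕ q ^ b        ∎) }

  -- The reason is that the power of `k` with exponent `x ≤ 1#` is at most `k`. On the level of
  -- members: dividing `r` by `k` keeps `e` and `b`, since `e ≤ b` bounds `k ^ e` by `k ^ b`.
  ^ᵃ-≤-multiple : ∀ {x} → 0# ≤ x → x ≤ 1# → ∀ {q q′ k} .{{_ : NonZero q}} .{{_ : NonZero q′}}
                  .{{_ : NonZero k}} → q′ ℕ.≤ k ℕ.* q → q′ ^ᵃ x ≤ fromℕ k * q ^ᵃ x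
  ^ᵃ-≤-multiple {x} 0≤x x≤1 {q} {q′} {k} q′≤kq = begin
    q′ ^ᵃ x                        ≈⟨ *-identityˡ _ ⟨
    1# * q′ ^ᵃ x                   ≈⟨ *-congʳ kκ≈1 ⟨
    (fromℕ k * κ) * q′ ^ᵃ x        ≈⟨ *-assoc _ _ _ ⟩
    fromℕ k * (κ * q′ ^ᵃ x)        ≤⟨ *-monoʳ-≤ (0≤fromℕ k) (*-^ᵃ-lub q′ 0≤x 0<κ scaled) ⟩
    fromℕ k * q ^ᵃ x               ∎
    where
    κ = proj₁ (positiveInverse (fromℕ-pos k))
    0<κ = proj₁ (proj₂ (positiveInverse (fromℕ-pos k)))
    kκ≈1 = proj₂ (proj₂ (positiveInverse (fromℕ-pos k)))
    scaled : ∀ {r} → NaturalPowersBelow q′ 0≤x r → κ * r ≤ q ^ᵃ x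
    scaled {r} (0≤r , e , b , b≢0 , e≤bx , rᵇ≤q′ᵉ) =
      naturalPowers≤ q 0≤x (*-nonNeg (<⇒≤ 0<κ) 0≤r , e , b , b≢0 , e≤bx , (begin
        (κ * r) ^ b                                ≈⟨ ^-distrib-* κ r b ⟩
        κ ^ b * r ^ b                              ≤⟨ *-monoʳ-≤ (<⇒≤ (^-pos 0<κ b)) rᵇ≤q′ᵉ ⟩
        κ ^ b * fromℕ (q′ ℕ.^ e)                   ≤⟨ *-monoʳ-≤ (<⇒≤ (^-pos 0<κ b)) (fromℕ-mono-≤ q′ᵉ≤kᵇqᵉ) ⟩
        κ ^ b * fromℕ (k ℕ.^ b ℕ.* q ℕ.^ e)        ≈⟨ *-congˡ (fromℕ-homo-* (k ℕ.^ b) (q ℕ.^ e)) ⟩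
        κ ^ b * (fromℕ (k ℕ.^ b) * fromℕ (q ℕ.^ e)) ≈⟨ *-assoc _ _ _ ⟨
        (κ ^ b * fromℕ (k ℕ.^ b)) * fromℕ (q ℕ.^ e) ≈⟨ *-congʳ (*-congˡ (fromℕ-homo-^ k b)) ⟩
        (κ ^ b * fromℕ k ^ b) * fromℕ (q ℕ.^ e)    ≈⟨ *-congʳ (^-distrib-* κ (fromℕ k) b) ⟨
        (κ * fromℕ k) ^ b * fromℕ (q ℕ.^ e)        ≈⟨ *-congʳ (^-congˡ b (trans (*-comm κ _) kκ≈1)) ⟩
        1# ^ b * fromℕ (q ℕ.^ e)                   ≈⟨ *-congʳ (1^n≈1 b) ⟩
        1# * fromℕ (q ℕ.^ e)                       ≈⟨ *-identityˡ _ ⟩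
        fromℕ (q ℕ.^ e)                            ∎))
      where
      q′ᵉ≤kᵇqᵉ : q′ ℕ.^ e ℕ.≤ k ℕ.^ b ℕ.* q ℕ.^ e
      q′ᵉ≤kᵇqᵉ = ℕ.≤-trans (ℕ.^-monoˡ-≤ e q′≤kq) (ℕ.≤-trans (ℕ.≤-reflexive (ℕ^-distribʳ-* e k q))
        (ℕ.*-monoˡ-≤ (q ℕ.^ e) (ℕ.^-monoʳ-≤ k (exponent≤ {e} {b} x≤1 e≤bx))))

  -- If `c * x` is at least 1 and `k = a ^ c`, then the power of `k` with exponent `x` is at least
  -- `a`. This is where a positive weight makes its power grow with the base.
  ^ᵃ-unbounded-ratio : ∀ {x} → 0# < x → ∀ a .{{_ : NonZero a}} → ∃ λ k → NonZero k ×
    (∀ {q q′} .{{_ : NonZero q}} .{{_ : NonZero q′}} → k ℕ.* q ℕ.≤ q′ →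
     fromℕ a * q ^ᵃ x ≤ q′ ^ᵃ x)
  ^ᵃ-unbounded-ratio {x} 0<x a = k , ℕ.m^n≢0 a c , λ {q} {q′} kq≤q′ →
    *-^ᵃ-lub q 0≤x (fromℕ-pos a) (scaled q q′ kq≤q′)
    where
    0≤x = <⇒≤ 0<x
    x⁻¹ = proj₁ (positiveInverse 0<x)
    c = suc (proj₁ (archimedean x⁻¹))
    k = a ℕ.^ c
    1≤cx : 1# ≤ fromℕ c * x
    1≤cx = begin
      1#               ≈⟨ proj₂ (proj₂ (positiveInverse 0<x)) ⟨
      x * x⁻¹          ≈⟨ *-comm _ _ ⟩
      x⁻¹ * x          ≤⟨ *-monoˡ-≤ 0≤x (≤-trans (<⇒≤ (proj₂ (archimedean x⁻¹))) (<⇒≤ (x<1+x _))) ⟩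
      fromℕ c * x      ∎
    scaled : ∀ q q′ .{{_ : NonZero q}} .{{_ : NonZero q′}} → k ℕ.* q ℕ.≤ q′ →
             ∀ {r} → NaturalPowersBelow q 0≤x r → fromℕ a * r ≤ q′ ^ᵃ x
    scaled q q′ kq≤q′ {r} (0≤r , e , b , b≢0 , e≤bx , rᵇ≤qᵉ) =
      naturalPowers≤ q′ 0≤x (*-nonNeg (0≤fromℕ a) 0≤r , f , c ℕ.* b , ℕ.m*n≢0 c b {{_}} {{b≢0}}
        , [ (λ f≡ → ≤-trans (inj₂ (reflexive (≡.cong fromℕ f≡))) b≤cbx)
          , (λ f≡ → ≤-trans (inj₂ (reflexive (≡.cong fromℕ f≡))) ce≤cbx) ]′ (ℕ.⊔-sel b (c ℕ.* e))
        , (begin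
          (fromℕ a * r) ^ (c ℕ.* b)                       ≈⟨ ^-distrib-* (fromℕ a) r (c ℕ.* b) ⟩
          fromℕ a ^ (c ℕ.* b) * r ^ (c ℕ.* b)             ≈⟨ *-cong (^-assocʳ (fromℕ a) c b) (trans (^-assocʳ r b c) (reflexive (≡.cong (r ^_) (ℕ.*-comm b c)))) ⟨
          (fromℕ a ^ c) ^ b * (r ^ b) ^ c                 ≤⟨ *-monoʳ-≤ (^-nonNeg (^-nonNeg (0≤fromℕ a) c) b) (^-mono-≤ c (^-nonNeg 0≤r b) rᵇ≤qᵉ) ⟩
          (fromℕ a ^ c) ^ b * fromℕ (q ℕ.^ e) ^ c         ≈⟨ *-cong (trans (fromℕ-homo-^ k b) (^-congˡ b (fromℕ-homo-^ a c))) (fromℕ-homo-^ (q ℕ.^ e) c) ⟨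
          fromℕ (k ℕ.^ b) * fromℕ ((q ℕ.^ e) ℕ.^ c)       ≈⟨ fromℕ-homo-* (k ℕ.^ b) _ ⟨
          fromℕ (k ℕ.^ b ℕ.* (q ℕ.^ e) ℕ.^ c)             ≤⟨ fromℕ-mono-≤ powers ⟩
          fromℕ (q′ ℕ.^ f)                                ∎))
      where
      -- To apply `k * q ≤ q′`, the factors `k ^ b` and `q ^ (c * e)` need a common exponent. Both
      -- `b` and `c * e` are at most `c * b * x`, hence so is their maximum.
      f = b ℕ.⊔ (c ℕ.* e)
      b≤cbx : fromℕ b ≤ fromℕ (c ℕ.* b) * x
      b≤cbx = begin
        fromℕ b                      ≈⟨ *-identityʳ _ ⟨
        fromℕ b * 1#                 ≤⟨ *-monoʳ-≤ (0≤fromℕ b) 1≤cx ⟩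
        fromℕ b * (fromℕ c * x)      ≈⟨ *-assoc _ _ _ ⟨
        (fromℕ b * fromℕ c) * x      ≈⟨ *-congʳ (trans (fromℕ-homo-* c b) (*-comm _ _)) ⟨
        fromℕ (c ℕ.* b) * x          ∎
      ce≤cbx : fromℕ (c ℕ.* e) ≤ fromℕ (c ℕ.* b) * x
      ce≤cbx = begin
        fromℕ (c ℕ.* e)              ≈⟨ fromℕ-homo-* c e ⟩
        fromℕ c * fromℕ e            ≤⟨ *-monoʳ-≤ (0≤fromℕ c) e≤bx ⟩
        fromℕ c * (fromℕ b * x)      ≈⟨ *-assoc _ _ _ ⟨
        (fromℕ c * fromℕ b) * x      ≈⟨ *-congʳ (fromℕ-homo-* c b) ⟨
        fromℕ (c ℕ.* b) * x          ∎
      powers : k ℕ.^ b ℕ.* (q ℕ.^ e) ℕ.^ c ℕ.≤ q′ ℕ.^ f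
      powers = ℕ.≤-trans
        (ℕ.*-mono-≤ (ℕ.^-monoʳ-≤ k {{ℕ.m^n≢0 a c}} (ℕ.m≤m⊔n b (c ℕ.* e)))
          (ℕ.≤-trans (ℕ.≤-reflexive (≡.trans (ℕ.^-*-assoc q e c) (≡.cong (q ℕ.^_) (ℕ.*-comm e c))))
            (ℕ.^-monoʳ-≤ q (ℕ.m≤n⊔m b (c ℕ.* e)))))
        (ℕ.≤-trans (ℕ.≤-reflexive (≡.sym (ℕ^-distribʳ-* f k q))) (ℕ.^-monoˡ-≤ f kq≤q′))

  -- Members with exponents `e / b` and `f / c` multiply to one with exponent
  -- `(e * c + f * b) / (b * c)`. Through `product-^ᵃ-≤` this bounds the number of cells of a grid
  -- from above.
  ^ᵃ-superadditive : ∀ q .{{_ : NonZero q}} {x y} → 0# ≤ x → 0# ≤ y →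
                     q ^ᵃ x * q ^ᵃ y ≤ q ^ᵃ (x + y)
  ^ᵃ-superadditive q {x} {y} 0≤x 0≤y = *-^ᵃ-lub q 0≤y (0<^ᵃ q 0≤x) λ {s} s∈ → [
    (λ 0<s → begin
      q ^ᵃ x * s   ≈⟨ *-comm _ s ⟩
      s * q ^ᵃ x   ≤⟨ *-^ᵃ-lub q 0≤x 0<s (λ {r} r∈ → ≤-trans (inj₂ (*-comm s r)) (product∈ r∈ s∈)) ⟩
      q ^ᵃ (x + y) ∎)
    , (λ 0≈s → begin
      q ^ᵃ x * s   ≈⟨ trans (*-congˡ (sym 0≈s)) (zeroʳ _) ⟩
      0#           ≤⟨ 0≤^ᵃ q (x + y) ⟩
      q ^ᵃ (x + y) ∎) ]′ (proj₁ s∈)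
    where
    0≤x+y : 0# ≤ x + y
    0≤x+y = ≤-trans (inj₂ (sym (+-identityʳ 0#))) (+-mono-≤ 0≤x 0≤y)
    product∈ : ∀ {r s} → NaturalPowersBelow q 0≤x r → NaturalPowersBelow q 0≤y s →
               r * s ≤ q ^ᵃ (x + y)
    product∈ {r} {s} (0≤r , e , b , b≢0 , e≤bx , rᵇ≤qᵉ) (0≤s , f , c , c≢0 , f≤cy , sᶜ≤qᶠ) =
      naturalPowers≤ q 0≤x+y (*-nonNeg 0≤r 0≤s , e ℕ.* c ℕ.+ f ℕ.* b , b ℕ.* c
        , ℕ.m*n≢0 b c {{b≢0}} {{c≢0}}
        , (begin
          fromℕ (e ℕ.* c ℕ.+ f ℕ.* b)                   ≈⟨ fromℕ-homo-+ (e ℕ.* c) (f ℕ.* b) ⟩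
          fromℕ (e ℕ.* c) + fromℕ (f ℕ.* b)             ≈⟨ +-cong (fromℕ-homo-* e c) (fromℕ-homo-* f b) ⟩
          fromℕ e * fromℕ c + fromℕ f * fromℕ b         ≤⟨ +-mono-≤ (*-monoˡ-≤ (0≤fromℕ c) e≤bx) (*-monoˡ-≤ (0≤fromℕ b) f≤cy) ⟩
          (fromℕ b * x) * fromℕ c + (fromℕ c * y) * fromℕ b ≈⟨ identity (fromℕ b) x (fromℕ c) y ⟩
          (fromℕ b * fromℕ c) * (x + y)                 ≈⟨ *-congʳ (fromℕ-homo-* b c) ⟨
          fromℕ (b ℕ.* c) * (x + y)                     ∎)
        , (begin
          (r * s) ^ (b ℕ.* c)                           ≈⟨ ^-distrib-* r s (b ℕ.* c) ⟩
          r ^ (b ℕ.* c) * s ^ (b ℕ.* c)                 ≈⟨ *-cong (^-assocʳ r b c) (trans (^-assocʳ s c b) (reflexive (≡.cong (s ^_) (ℕ.*-comm c b)))) ⟨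
          (r ^ b) ^ c * (s ^ c) ^ b                     ≤⟨ *-mono-≤ (^-nonNeg (^-nonNeg 0≤r b) c) (^-nonNeg (0≤fromℕ (q ℕ.^ f)) b)
                                                             (^-mono-≤ c (^-nonNeg 0≤r b) rᵇ≤qᵉ) (^-mono-≤ b (^-nonNeg 0≤s c) sᶜ≤qᶠ) ⟩
          fromℕ (q ℕ.^ e) ^ c * fromℕ (q ℕ.^ f) ^ b     ≈⟨ *-cong (fromℕ-homo-^ (q ℕ.^ e) c) (fromℕ-homo-^ (q ℕ.^ f) b) ⟨
          fromℕ ((q ℕ.^ e) ℕ.^ c) * fromℕ ((q ℕ.^ f) ℕ.^ b) ≈⟨ fromℕ-homo-* ((q ℕ.^ e) ℕ.^ c) _ ⟨
          fromℕ ((q ℕ.^ e) ℕ.^ c ℕ.* (q ℕ.^ f) ℕ.^ b)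
            ≡⟨ ≡.cong fromℕ (≡.trans (≡.cong₂ ℕ._*_ (ℕ.^-*-assoc q e c) (ℕ.^-*-assoc q f b)) (≡.sym (ℕ.^-distribˡ-+-* q (e ℕ.* c) (f ℕ.* b)))) ⟩
          fromℕ (q ℕ.^ (e ℕ.* c ℕ.+ f ℕ.* b))           ∎))
      where
      identity : ∀ b x c y → (b * x) * c + (c * y) * b ≈ (b * c) * (x + y)
      identity = solve 4 (λ b x c y → (b :* x) :* c :+ (c :* y) :* b := (b :* c) :* (x :+ y)) refl

  sum-nonNeg : ∀ {n} {x : Vector ℝ n} → (∀ j → 0# ≤ x j) → 0# ≤ sum x
  sum-nonNeg {zero}  _   = ≤-refl
  sum-nonNeg {suc n} 0≤x = ≤-trans (inj₂ (sym (+-identityʳ 0#))) (+-mono-≤ (0≤x zero) (sum-nonNeg (0≤x ∘ suc)))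

  product-^ᵃ-≤ : ∀ q .{{_ : NonZero q}} {n} {x : Vector ℝ n} → (∀ j → 0# ≤ x j) →
                 foldr _*_ 1# (λ j → q ^ᵃ x j) ≤ q ^ᵃ sum x
  product-^ᵃ-≤ q {zero}      _   = 1≤^ᵃ q ≤-refl
  product-^ᵃ-≤ q {suc n} {x} 0≤x = ≤-trans
    (*-monoʳ-≤ (0≤^ᵃ q _) (product-^ᵃ-≤ q (0≤x ∘ suc)))
    (^ᵃ-superadditive q (0≤x zero) (sum-nonNeg (0≤x ∘ suc)))

  -- If the product were below 1, then so would be A * C for some A, C above
  -- the two suprema; comparing A ^ b and C ^ b with powers of q for every b
  -- gives 1 < (A * C) ^ b * q, which fails for large b.
  1≤^ᵃ*^ᵃ- : ∀ q .{{_ : NonZero q}} {x} → 0# ≤ x → 1# ≤ q ^ᵃ x * q ^ᵃ (- x)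
  1≤^ᵃ*^ᵃ- q {x} 0≤x = ≮⇒≥ λ product<1 → refute (bracket product<1)
    where
    bracket : q ^ᵃ x * q ^ᵃ (- x) < 1# →
              ∃ λ a → ∃ λ c → q ^ᵃ x < a × q ^ᵃ (- x) < c × a * c < 1#
    bracket product<1 = a , c , X<a , Y<c , (begin-strict
      a * c      <⟨ *-monoˡ-< 0<c a<c⁻¹ ⟩
      c⁻¹ * c    ≈⟨ trans (*-comm _ _) cc⁻¹≈1 ⟩
      1#         ∎)
      where
      X⁻¹ = proj₁ (positiveInverse (0<^ᵃ q 0≤x))
      XX⁻¹≈1 = proj₂ (proj₂ (positiveInverse (0<^ᵃ q 0≤x)))
      Y<X⁻¹ : q ^ᵃ (- x) < X⁻¹
      Y<X⁻¹ = *-cancelˡ-< (0≤^ᵃ q x) (begin-strict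
        q ^ᵃ x * q ^ᵃ (- x)  <⟨ product<1 ⟩
        1#                   ≈⟨ XX⁻¹≈1 ⟨
        q ^ᵃ x * X⁻¹         ∎)
      c = proj₁ (dense Y<X⁻¹)
      Y<c = proj₁ (proj₂ (dense Y<X⁻¹))
      c<X⁻¹ = proj₂ (proj₂ (dense Y<X⁻¹))
      0<c : 0# < c
      0<c = begin-strict 0# ≤⟨ 0≤^ᵃ q (- x) ⟩ q ^ᵃ (- x) <⟨ Y<c ⟩ c ∎
      c⁻¹ = proj₁ (positiveInverse 0<c)
      cc⁻¹≈1 = proj₂ (proj₂ (positiveInverse 0<c))
      X<c⁻¹ : q ^ᵃ x < c⁻¹
      X<c⁻¹ = *-cancelˡ-< (<⇒≤ 0<c) (begin-strict
        c * q ^ᵃ x     <⟨ *-monoˡ-< (0<^ᵃ q 0≤x) c<X⁻¹ ⟩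
        X⁻¹ * q ^ᵃ x   ≈⟨ trans (*-comm _ _) XX⁻¹≈1 ⟩
        1#             ≈⟨ cc⁻¹≈1 ⟨
        c * c⁻¹        ∎)
      a = proj₁ (dense X<c⁻¹)
      X<a = proj₁ (proj₂ (dense X<c⁻¹))
      a<c⁻¹ = proj₂ (proj₂ (dense X<c⁻¹))
    refute : ¬ (∃ λ a → ∃ λ c → q ^ᵃ x < a × q ^ᵃ (- x) < c × a * c < 1#)
    refute (a , c , X<a , Y<c , ac<1) = ≤⇒≯ decayed (*-cancelˡ-< (<⇒≤ 0<qᵉ) (begin-strict
      Qᵉ * 1#                            ≈⟨ *-identityʳ _ ⟩
      Qᵉ                                 <⟨ qᵉ<aᵇ ⟩
      a ^ b                              ≈⟨ *-identityʳ _ ⟨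
      a ^ b * 1#                         <⟨ *-monoʳ-< (^-pos 0<a b) 1<cᵇq¹⁺ᵉ ⟩
      a ^ b * (c ^ b * (fromℕ q * Qᵉ))   ≈⟨ identity (a ^ b) (c ^ b) (fromℕ q) Qᵉ ⟩
      Qᵉ * ((a ^ b * c ^ b) * fromℕ q)   ≈⟨ *-congˡ (*-congʳ (^-distrib-* a c b)) ⟨
      Qᵉ * ((a * c) ^ b * fromℕ q)       ∎))
      where
      0<a : 0# < a
      0<a = begin-strict 0# ≤⟨ 0≤^ᵃ q x ⟩ q ^ᵃ x <⟨ X<a ⟩ a ∎
      0<c : 0# < c
      0<c = begin-strict 0# ≤⟨ 0≤^ᵃ q (- x) ⟩ q ^ᵃ (- x) <⟨ Y<c ⟩ c ∎
      decay = geometric-decay (*-pos 0<a 0<c) ac<1 (fromℕ q)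
      b = proj₁ decay
      b≢0 = proj₁ (proj₂ decay)
      decayed : (a * c) ^ b * fromℕ q ≤ 1#
      decayed = proj₂ (proj₂ decay)
      -- The integers `e` and `suc e` enclose `b * x`: the former is tested against the exponent
      -- `x`, the latter against `- x`.
      e = proj₁ (floorℕ (*-nonNeg (0≤fromℕ b) 0≤x))
      e≤bx = proj₁ (proj₂ (floorℕ (*-nonNeg (0≤fromℕ b) 0≤x)))
      bx<1+e = proj₂ (proj₂ (floorℕ (*-nonNeg (0≤fromℕ b) 0≤x)))
      Qᵉ = fromℕ q ^ e
      0<qᵉ : 0# < Qᵉ
      0<qᵉ = ^-pos (fromℕ-pos q) e
      qᵉ<aᵇ : Qᵉ < a ^ b
      qᵉ<aᵇ = ≰⇒> λ aᵇ≤qᵉ → ≤⇒≯ (naturalPowers≤ q 0≤x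
        (<⇒≤ 0<a , e , b , b≢0 , e≤bx , ≤-trans aᵇ≤qᵉ (inj₂ (sym (fromℕ-homo-^ q e))))) X<a
      1<cᵇq¹⁺ᵉ : 1# < c ^ b * (fromℕ q * Qᵉ)
      1<cᵇq¹⁺ᵉ = ≰⇒> λ ≤1 → ≤⇒≯ (≤-^ᵃ q (<⇒≤ 0<c , 0 , suc e , b , b≢0
        , (begin
          0# - fromℕ (suc e)     ≈⟨ +-identityˡ _ ⟩
          - fromℕ (suc e)        ≤⟨ neg-mono-≤ (<⇒≤ bx<1+e) ⟩
          - (fromℕ b * x)        ≈⟨ -‿distribʳ-* _ _ ⟩
          fromℕ b * - x          ∎)
        , ≤1)) Y<c
      identity : ∀ a c q e → a * (c * (q * e)) ≈ e * ((a * c) * q)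
      identity = solve 4 (λ a c q e → a :* (c :* (q :* e)) := e :* ((a :* c) :* q)) refl

-- Finite encodings and residues

m+o≤n+o+p : ∀ {m p} n o → m ℕ.≤ p → m ℕ.+ o ℕ.≤ (n ℕ.+ o) ℕ.+ p
m+o≤n+o+p {m} {p} n o m≤p = begin
  m ℕ.+ o            ≤⟨ ℕ.+-monoˡ-≤ o m≤p ⟩
  p ℕ.+ o            ≡⟨ ℕ.+-comm p o ⟩
  o ℕ.+ p            ≤⟨ ℕ.+-monoˡ-≤ p (ℕ.m≤n+m o n) ⟩
  (n ℕ.+ o) ℕ.+ p    ∎
  where open ℕ.≤-Reasoning

+-mono-≤-suc : ∀ {m n p o} q → m ℕ.≤ n → p ℕ.≤ q ℕ.+ o → m ℕ.+ p ℕ.< q ℕ.+ (suc n ℕ.+ o)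
+-mono-≤-suc {m} {n} {p} {o} q m≤n p≤q+o = begin-strict
  m ℕ.+ p                ≤⟨ ℕ.+-mono-≤ m≤n p≤q+o ⟩
  n ℕ.+ (q ℕ.+ o)        <⟨ ℕ.≤-refl ⟩
  suc n ℕ.+ (q ℕ.+ o)    ≡⟨ ℕ.+-assoc (suc n) q o ⟨
  (suc n ℕ.+ q) ℕ.+ o    ≡⟨ ≡.cong (ℕ._+ o) (ℕ.+-comm (suc n) q) ⟩
  (q ℕ.+ suc n) ℕ.+ o    ≡⟨ ℕ.+-assoc q (suc n) o ⟩
  q ℕ.+ (suc n ℕ.+ o)    ∎
  where open ℕ.≤-Reasoning

∏ : ∀ {n} → Vector ℕ n → ℕ
∏ = foldr ℕ._*_ 1

encode : ∀ {n} (M : Vector ℕ n) → (∀ j → Fin (M j)) → Fin (∏ M)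
encode {zero}  M f = zero
encode {suc n} M f = combine (f zero) (encode (tail M) (f ∘ suc))

encode-injective : ∀ {n} (M : Vector ℕ n) {f g : ∀ j → Fin (M j)} →
                   encode M f ≡ encode M g → ∀ j → f j ≡ g j
encode-injective M eq zero    = Fin.combine-injectiveˡ _ _ _ _ eq
encode-injective M eq (suc j) =
  encode-injective (tail M) (Fin.combine-injectiveʳ {M zero} _ _ _ _ eq) j

funToFin-cong : ∀ {m n} {f g : Fin m → Fin n} → f ≗ g → funToFin f ≡ funToFin g
funToFin-cong {zero}  _   = ≡.refl
funToFin-cong {suc m} f≗g = ≡.cong₂ combine (f≗g zero) (funToFin-cong (f≗g ∘ suc))

finToFun-injective : ∀ {m n} {u v : Fin (m ℕ.^ n)} →
                     finToFun {m} {n} u ≗ finToFun v → u ≡ v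
finToFun-injective {m} {n} {u} {v} u≗v =
  ≡.trans (≡.sym (Fin.funToFin-finToFin {n} {m} u))
    (≡.trans (funToFin-cong u≗v) (Fin.funToFin-finToFin {n} {m} v))

%ℕ-≡⇒≡+* : ∀ {m} .{{_ : NonZero m}} a b → a ℤ.%ℕ m ≡ b ℤ.%ℕ m →
            ∃ λ p → a ≡ b ℤ.+ p ℤ.* + m
%ℕ-≡⇒≡+* {m} a b eq = a ℤ./ℕ m ℤ.- b ℤ./ℕ m , (begin
  a                                                    ≡⟨ ℤ.a≡a%ℕn+[a/ℕn]*n a m ⟩
  + (a ℤ.%ℕ m) ℤ.+ a ℤ./ℕ m ℤ.* + m                    ≡⟨ ≡.cong (λ r → + r ℤ.+ a ℤ./ℕ m ℤ.* + m) eq ⟩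
  + (b ℤ.%ℕ m) ℤ.+ a ℤ./ℕ m ℤ.* + m                    ≡⟨ rearrange (+ (b ℤ.%ℕ m)) (a ℤ./ℕ m) (b ℤ./ℕ m) (+ m) ⟩
  (+ (b ℤ.%ℕ m) ℤ.+ b ℤ./ℕ m ℤ.* + m) ℤ.+ (a ℤ./ℕ m ℤ.- b ℤ./ℕ m) ℤ.* + m
                                                       ≡⟨ ≡.cong (ℤ._+ (a ℤ./ℕ m ℤ.- b ℤ./ℕ m) ℤ.* + m) (ℤ.a≡a%ℕn+[a/ℕn]*n b m) ⟨
  b ℤ.+ (a ℤ./ℕ m ℤ.- b ℤ./ℕ m) ℤ.* + m                ∎)
  where
  open ≡.≡-Reasoning
  rearrange : ∀ r s t u → r ℤ.+ s ℤ.* u ≡ (r ℤ.+ t ℤ.* u) ℤ.+ (s ℤ.- t) ℤ.* u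
  rearrange = solve 4 (λ r s t u → r :+ s :* u := (r :+ t :* u) :+ (s :- t) :* u) ≡.refl
    where open ℤ.+-*-Solver

-- Orbits on a grid of cells and the packing bound

module Cells (R : CompleteOrderedField) {n : ℕ} (α : Vector (CompleteOrderedField.ℝ R) n) where

  open OrderedField R
  open Solver using (solve; _:+_; _:*_; _:-_; :-_; _:=_)

  -- The error is measured against an arbitrary integer vector instead of the nearest one, which
  -- makes it linear in the pair `(q, p)`.
  dev : ℕ → Vector ℤ n → Vector ℝ n
  dev q p j = fromℕ q * α j - fromℤ (p j)

  dev-0 : ∀ p j → dev 0 p j ≈ - fromℤ (p j)
  dev-0 p j = trans (+-congʳ (zeroˡ (α j))) (+-identityˡ _)

  ∣dev-0∣<1⇒≡0 : ∀ p j → ∣ dev 0 p j ∣ < 1# → p j ≡ + 0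
  ∣dev-0∣<1⇒≡0 p j ∣dev-0∣<1 = ∣fromℤ∣<1⇒≡0 (p j) (begin-strict
    ∣ fromℤ (p j) ∣      ≈⟨ ∣∣-cong (-‿involutive _) ⟨
    ∣ - - fromℤ (p j) ∣  ≤⟨ ∣-x∣≤∣x∣ _ ⟩
    ∣ - fromℤ (p j) ∣    ≈⟨ ∣∣-cong (dev-0 p j) ⟨
    ∣ dev 0 p j ∣        <⟨ ∣dev-0∣<1 ⟩
    1#                   ∎)

  module _ (M : Vector ℕ n) (M≢0 : ∀ j → NonZero (M j)) where

    -- The orbit of `α` on the torus with side lengths `M j`, translated by an integer offset `y`.
    -- In this scale all cells are unit cubes.
    point : ℕ → Vector ℕ n → Vector ℝ n
    point t y j = fromℕ (y j) + fromℕ t * (fromℕ (M j) * α j)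

    private
      %ℕ-≡⇒close : ∀ m .{{_ : NonZero m}} x y → ⌊ x ⌋ ℤ.%ℕ m ≡ ⌊ y ⌋ ℤ.%ℕ m →
                   ∃ λ p → ∣ (x - y) - fromℕ m * fromℤ p ∣ < 1#
      %ℕ-≡⇒close m x y eq = k , ∣∣-lub-<
        (begin-strict
          (x - y) - fromℕ m * p             <⟨ +-monoˡ-< _ (+-mono-<-≤ (x<1+⌊x⌋ x) (neg-mono-≤ (⌊x⌋≤x y))) ⟩
          ((1# + f) - g) - fromℕ m * p      ≈⟨ +-congʳ (+-congʳ (+-congˡ f≈g+pm)) ⟩
          ((1# + (g + p * fromℕ m)) - g) - fromℕ m * p
                                            ≈⟨ cancel₁ 1# g p (fromℕ m) ⟩
          1#                                ∎)
        (begin-strict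
          - ((x - y) - fromℕ m * p)         ≈⟨ negate x y (fromℕ m) p ⟩
          (y - x) + fromℕ m * p             <⟨ +-monoˡ-< _ (+-mono-<-≤ (x<1+⌊x⌋ y) (neg-mono-≤ (⌊x⌋≤x x))) ⟩
          ((1# + g) - f) + fromℕ m * p      ≈⟨ +-congʳ (+-congˡ (-‿cong f≈g+pm)) ⟩
          ((1# + g) - (g + p * fromℕ m)) + fromℕ m * p
                                            ≈⟨ cancel₂ 1# g p (fromℕ m) ⟩
          1#                                ∎)
        where
        k = proj₁ (%ℕ-≡⇒≡+* ⌊ x ⌋ ⌊ y ⌋ eq)
        f = fromℤ ⌊ x ⌋
        g = fromℤ ⌊ y ⌋
        p = fromℤ k
        f≈g+pm : f ≈ g + p * fromℕ m
        f≈g+pm = begin-equality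
          f                                 ≡⟨ ≡.cong fromℤ (proj₂ (%ℕ-≡⇒≡+* ⌊ x ⌋ ⌊ y ⌋ eq)) ⟩
          fromℤ (⌊ y ⌋ ℤ.+ k ℤ.* + m)       ≈⟨ fromℤ-homo-+ ⌊ y ⌋ (k ℤ.* + m) ⟩
          g + fromℤ (k ℤ.* + m)             ≈⟨ +-congˡ (fromℤ-homo-* k (+ m)) ⟩
          g + p * fromℕ m                   ∎
        cancel₁ : ∀ i g p m → ((i + (g + p * m)) - g) - m * p ≈ i
        cancel₁ = solve 4 (λ i g p m → ((i :+ (g :+ p :* m)) :- g) :- m :* p := i) refl
        negate : ∀ x y m p → - ((x - y) - m * p) ≈ (y - x) + m * p
        negate = solve 4 (λ x y m p → :- ((x :- y) :- m :* p) := (y :- x) :+ m :* p) refl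
        cancel₂ : ∀ i g p m → ((i + g) - (g + p * m)) + m * p ≈ i
        cancel₂ = solve 4 (λ i g p m → ((i :+ g) :- (g :+ p :* m)) :+ m :* p := i) refl

    abstract
      cell : ℕ → Vector ℕ n → Fin (∏ M)
      cell t y = encode M λ j → fromℕ< (ℤ.n%ℕd<d ⌊ point t y j ⌋ (M j) {{M≢0 j}})

      cell-≡⇒%ℕ-≡ : ∀ t y t′ y′ → cell t y ≡ cell t′ y′ → ∀ j →
        ℤ._%ℕ_ ⌊ point t y j ⌋ (M j) {{M≢0 j}} ≡ ℤ._%ℕ_ ⌊ point t′ y′ j ⌋ (M j) {{M≢0 j}}
      cell-≡⇒%ℕ-≡ t y t′ y′ eq j = Fin.fromℕ<-injective _ _ _ _ (encode-injective M eq j)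

    -- Two points of one unit cube differ by less than 1 in each coordinate once multiples of `M j`
    -- are removed; these multiples make up the vector `p`.
    cell-≡⇒close : ∀ d t y y′ → cell (t ℕ.+ d) y′ ≡ cell t y → ∃ λ p → ∀ j →
                   ∣ fromℕ (M j) * dev d p j + (fromℕ (y′ j) - fromℕ (y j)) ∣ < 1#
    cell-≡⇒close d t y y′ eq = proj₁ ∘ shift , λ j → begin-strict
      ∣ fromℕ (M j) * dev d (proj₁ ∘ shift) j + (fromℕ (y′ j) - fromℕ (y j)) ∣
        ≈⟨ ∣∣-cong (rearrange j) ⟩
      ∣ (point (t ℕ.+ d) y′ j - point t y j) - fromℕ (M j) * fromℤ (proj₁ (shift j)) ∣
        <⟨ proj₂ (shift j) ⟩
      1# ∎
      where
      shift : ∀ j → ∃ λ p →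
              ∣ (point (t ℕ.+ d) y′ j - point t y j) - fromℕ (M j) * fromℤ p ∣ < 1#
      shift j = %ℕ-≡⇒close (M j) {{M≢0 j}} _ _ (cell-≡⇒%ℕ-≡ (t ℕ.+ d) y′ t y eq j)
      rearrange : ∀ j → fromℕ (M j) * dev d (proj₁ ∘ shift) j + (fromℕ (y′ j) - fromℕ (y j)) ≈
                  (point (t ℕ.+ d) y′ j - point t y j) - fromℕ (M j) * fromℤ (proj₁ (shift j))
      rearrange j = begin-equality
        m * (fromℕ d * a - p) + (u′ - u)
          ≈⟨ identity m (fromℕ d) a p u′ u (fromℕ t) ⟩
        ((u′ + (fromℕ t + fromℕ d) * (m * a)) - (u + fromℕ t * (m * a))) - m * p
          ≈⟨ +-congʳ (+-congʳ (+-congˡ (*-congʳ (fromℕ-homo-+ t d)))) ⟨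
        ((u′ + fromℕ (t ℕ.+ d) * (m * a)) - (u + fromℕ t * (m * a))) - m * p ∎
        where
        identity : ∀ m d a p u′ u t → m * (d * a - p) + (u′ - u) ≈
                   ((u′ + (t + d) * (m * a)) - (u + t * (m * a))) - m * p
        identity = solve 7 (λ m d a p u′ u t → m :* (d :* a :- p) :+ (u′ :- u) :=
          ((u′ :+ (t :+ d) :* (m :* a)) :- (u :+ t :* (m :* a))) :- m :* p) refl
        m = fromℕ (M j)
        a = α j
        p = fromℤ (proj₁ (shift j))
        u′ = fromℕ (y′ j)
        u = fromℕ (y j)

    -- The bound in `isolated` is the side `3 * g` of a cube of offsets plus 1 for the rounding to
    -- cells: it is what two overlapping cubes would violate.
    module Packing (g Q : ℕ) (3g<M : ∀ j → 3 ℕ.* g ℕ.< M j)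
      (isolated : ∀ d p → 1 ℕ.≤ d → d ℕ.≤ Q →
                  ¬ (∀ j → ∣ fromℕ (M j) * dev d p j ∣ < fromℕ (suc (3 ℕ.* g)))) where

      private
        L = 3 ℕ.* g

        ∣m-n∣≤L : ∀ {m n} → m ℕ.≤ L → n ℕ.≤ L → ∣ fromℕ m - fromℕ n ∣ ≤ fromℕ L
        ∣m-n∣≤L {m} {n} m≤L n≤L = ∣∣-lub (diff≤ m n m≤L)
          (≤-trans (inj₂ (⁻¹-anti-homo‿- (fromℕ m) (fromℕ n))) (diff≤ n m n≤L))
          where
          diff≤ : ∀ m n → m ℕ.≤ L → fromℕ m - fromℕ n ≤ fromℕ L
          diff≤ m n m≤L = begin
            fromℕ m - fromℕ n   ≤⟨ +-mono-≤ (fromℕ-mono-≤ m≤L) (neg-mono-≤ (0≤fromℕ n)) ⟩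
            fromℕ L - 0#        ≈⟨ +-congˡ -0#≈0# ⟩
            fromℕ L + 0#        ≈⟨ +-identityʳ _ ⟩
            fromℕ L             ∎

      -- A common cell yields an error below `suc L`, which `isolated` forbids for positive `d`. For
      -- `d = 0` the error is an integer vector, which vanishes because `L` is below every `M j`;
      -- what remains are integer offsets at distance below 1.
      separated : ∀ d t {y y′} → d ℕ.≤ Q → (∀ j → y j ℕ.< L) → (∀ j → y′ j ℕ.< L) →
                  cell (t ℕ.+ d) y′ ≡ cell t y → d ≡ 0 × y ≗ y′
      separated d t {y} {y′} d≤Q y<L y′<L eq = conclude d d≤Q p small close
        where
        p = proj₁ (cell-≡⇒close d t y y′ eq)
        close = proj₂ (cell-≡⇒close d t y y′ eq)
        small : ∀ j → ∣ fromℕ (M j) * dev d p j ∣ < fromℕ (suc L)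
        small j = begin-strict
          ∣ a ∣              ≈⟨ ∣∣-cong ([x+y]-y≈x a b) ⟨
          ∣ (a + b) - b ∣    ≤⟨ ∣x-y∣≤∣x∣+∣y∣ (a + b) b ⟩
          ∣ a + b ∣ + ∣ b ∣  <⟨ +-mono-<-≤ (close j) (∣m-n∣≤L (ℕ.<⇒≤ (y′<L j)) (ℕ.<⇒≤ (y<L j))) ⟩
          1# + fromℕ L       ∎
          where
          a = fromℕ (M j) * dev d p j
          b = fromℕ (y′ j) - fromℕ (y j)
        conclude : ∀ d → d ℕ.≤ Q → ∀ p → (∀ j → ∣ fromℕ (M j) * dev d p j ∣ < fromℕ (suc L)) →
          (∀ j → ∣ fromℕ (M j) * dev d p j + (fromℕ (y′ j) - fromℕ (y j)) ∣ < 1#) →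
          d ≡ 0 × y ≗ y′
        conclude (suc d) d≤Q p small _ = contradiction small (isolated (suc d) p (s≤s z≤n) d≤Q)
        conclude zero _ p small close = ≡.refl , λ j → ≡.sym (ℤ.+-injective (ℤ.i-j≡0⇒i≡j _ _
          (∣fromℤ∣<1⇒≡0 _ (begin-strict
            ∣ fromℤ (+ y′ j ℤ.- + y j) ∣         ≡⟨ ≡.cong (∣_∣ ∘ fromℤ) (ℤ.m-n≡m⊖n (y′ j) (y j)) ⟩
            ∣ fromℤ (y′ j ℤ.⊖ y j) ∣             ≈⟨ ∣∣-cong (fromℤ-⊖ (y′ j) (y j)) ⟩
            ∣ fromℕ (y′ j) - fromℕ (y j) ∣       ≈⟨ ∣∣-cong (drop-dev j) ⟨
            ∣ fromℕ (M j) * dev 0 p j + (fromℕ (y′ j) - fromℕ (y j)) ∣  <⟨ close j ⟩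
            1#                                   ∎))))
          where
          ∣dev∣<1 : ∀ j → ∣ dev 0 p j ∣ < 1#
          ∣dev∣<1 j = *-cancelˡ-< (0≤fromℕ (M j)) (begin-strict
            fromℕ (M j) * ∣ dev 0 p j ∣  ≤⟨ a∣x∣≤∣ax∣ (0≤fromℕ (M j)) _ ⟩
            ∣ fromℕ (M j) * dev 0 p j ∣  <⟨ small j ⟩
            fromℕ (suc L)                ≤⟨ fromℕ-mono-≤ (3g<M j) ⟩
            fromℕ (M j)                  ≈⟨ *-identityʳ _ ⟨
            fromℕ (M j) * 1#             ∎)
          p≡0 : ∀ j → p j ≡ + 0
          p≡0 j = ∣dev-0∣<1⇒≡0 p j (∣dev∣<1 j)
          drop-dev : ∀ j → fromℕ (M j) * dev 0 p j + (fromℕ (y′ j) - fromℕ (y j)) ≈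
                     fromℕ (y′ j) - fromℕ (y j)
          drop-dev j = begin-equality
            fromℕ (M j) * dev 0 p j + c  ≈⟨ +-congʳ (*-congˡ (trans (dev-0 p j) (trans (-‿cong (reflexive (≡.cong fromℤ (p≡0 j)))) -0#≈0#))) ⟩
            fromℕ (M j) * 0# + c         ≈⟨ +-congʳ (zeroʳ _) ⟩
            0# + c                       ≈⟨ +-identityˡ c ⟩
            c                            ∎
            where c = fromℕ (y′ j) - fromℕ (y j)

      separated′ : ∀ {t t′ y y′} → t ℕ.≤ t′ ℕ.+ Q → t′ ℕ.≤ t ℕ.+ Q →
                   (∀ j → y j ℕ.< L) → (∀ j → y′ j ℕ.< L) →
                   cell t y ≡ cell t′ y′ → t ≡ t′ × y ≗ y′
      separated′ {t} {t′} {y} {y′} t≤t′+Q t′≤t+Q y<L y′<L eq = [ up , down ]′ (ℕ.≤-total t t′)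
        where
        ordered : ∀ {t t′ y y′} → t ℕ.≤ t′ → t′ ℕ.≤ t ℕ.+ Q →
                  (∀ j → y j ℕ.< L) → (∀ j → y′ j ℕ.< L) →
                  cell t y ≡ cell t′ y′ → t ≡ t′ × y ≗ y′
        ordered {t} {t′} {y} {y′} t≤t′ t′≤t+Q y<L y′<L eq =
          ℕ.≤-antisym t≤t′ (ℕ.m∸n≡0⇒m≤n (proj₁ sep)) , proj₂ sep
          where
          sep : t′ ℕ.∸ t ≡ 0 × y ≗ y′
          sep = separated (t′ ℕ.∸ t) t (ℕ.m≤n+o⇒m∸n≤o t′ t t′≤t+Q) y<L y′<L
            (≡.trans (≡.cong (λ s → cell s y′) (ℕ.m+[n∸m]≡n t≤t′)) (≡.sym eq))
        up : t ℕ.≤ t′ → t ≡ t′ × y ≗ y′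
        up t≤t′ = ordered t≤t′ t′≤t+Q y<L y′<L eq
        down : t′ ℕ.≤ t → t ≡ t′ × y ≗ y′
        down t′≤t = Product.map ≡.sym (λ y′≗y → ≡.sym ∘ y′≗y) (ordered t′≤t t≤t′+Q y′<L y<L (≡.sym eq))

      module _ (k ρ : ℕ) (ρ≤Q : ρ ℕ.≤ Q) (v : Vector ℤ n)
        (v-small : ∀ j → ∣ fromℕ (M j) * dev (k ℕ.* suc Q ℕ.+ ρ) v j ∣ ≤ fromℕ g) where

        -- Up to rounding, Hit y t says that y + t M α lies in the cube
        -- [0, L)ⁿ modulo M.
        Hit : Vector ℕ n → ℕ → Set
        Hit y t = ∃ λ p → ∀ j → - 1# < fromℕ (M j) * dev t p j + fromℕ (y j) ×
                                fromℕ (M j) * dev t p j + fromℕ (y j) < fromℕ L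

        -- Subtracting two hits cancels `y` and leaves an error below `suc L` for the elapsed time,
        -- so `isolated` makes that time exceed `Q`.
        hit-gap : ∀ y {t t′} → Hit y t → Hit y t′ → t ℕ.< t′ → t ℕ.+ suc Q ℕ.≤ t′
        hit-gap y {t} {t′} (p , lo) (p′ , hi) t<t′ = ≡.subst (t ℕ.+ suc Q ℕ.≤_) t+d≡t′
          (ℕ.+-monoʳ-≤ t (ℕ.≰⇒> λ d≤Q → isolated d (λ j → p′ j ℤ.- p j) (ℕ.m<n⇒0<n∸m t<t′) d≤Q λ j →
            begin-strict
              ∣ fromℕ (M j) * dev d (λ j → p′ j ℤ.- p j) j ∣     ≈⟨ ∣∣-cong (difference j) ⟩
              ∣ z t′ p′ j - z t p j ∣
                <⟨ ∣∣-lub-< (z-z< (proj₂ (hi j)) (proj₁ (lo j)))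
                            (begin-strict
                              - (z t′ p′ j - z t p j)  ≈⟨ ⁻¹-anti-homo‿- _ _ ⟩
                              z t p j - z t′ p′ j      <⟨ z-z< (proj₂ (lo j)) (proj₁ (hi j)) ⟩
                              fromℕ (suc L)            ∎) ⟩
              fromℕ (suc L) ∎))
          where
          d = t′ ℕ.∸ t
          t+d≡t′ : t ℕ.+ d ≡ t′
          t+d≡t′ = ℕ.m+[n∸m]≡n (ℕ.<⇒≤ t<t′)
          z : ℕ → Vector ℤ n → Vector ℝ n
          z t p j = fromℕ (M j) * dev t p j + fromℕ (y j)
          z-z< : ∀ {a b} → a < fromℕ L → - 1# < b → a - b < fromℕ (suc L)
          z-z< {a} {b} a<L -1<b = begin-strict
            a - b             <⟨ +-mono-<-≤ a<L (<⇒≤ (neg-mono-< -1<b)) ⟩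
            fromℕ L - - 1#    ≈⟨ +-congˡ (-‿involutive 1#) ⟩
            fromℕ L + 1#      ≈⟨ +-comm _ _ ⟩
            fromℕ (suc L)     ∎
          identity : ∀ m t d a p p′ u →
            m * (d * a - (p′ - p)) ≈ (m * ((t + d) * a - p′) + u) - (m * (t * a - p) + u)
          identity = solve 7 (λ m t d a p p′ u → m :* (d :* a :- (p′ :- p)) :=
            (m :* ((t :+ d) :* a :- p′) :+ u) :- (m :* (t :* a :- p) :+ u)) refl
          difference : ∀ j → fromℕ (M j) * dev d (λ j → p′ j ℤ.- p j) j ≈
                       z t′ p′ j - z t p j
          difference j = begin-equality
            fromℕ (M j) * (fromℕ d * α j - fromℤ (p′ j ℤ.- p j))
              ≈⟨ *-congˡ (+-congˡ (-‿cong (trans (fromℤ-homo-+ (p′ j) (ℤ.- p j)) (+-congˡ (fromℤ-neg (p j)))))) ⟩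
            fromℕ (M j) * (fromℕ d * α j - (fromℤ (p′ j) - fromℤ (p j)))
              ≈⟨ identity (fromℕ (M j)) (fromℕ t) (fromℕ d) (α j) (fromℤ (p j)) (fromℤ (p′ j)) (fromℕ (y j)) ⟩
            (fromℕ (M j) * ((fromℕ t + fromℕ d) * α j - fromℤ (p′ j)) + fromℕ (y j)) - z t p j
              ≈⟨ +-congʳ (+-congʳ (*-congˡ (+-congʳ (*-congʳ (trans (reflexive (≡.cong fromℕ (≡.sym t+d≡t′))) (fromℕ-homo-+ t d)))))) ⟨
            z t′ p′ j - z t p j ∎

        -- The middle third of the cube, which a displacement by at most `g` in each coordinate
        -- cannot move out of the cube.
        Inner : Vector ℕ n → Set
        Inner y = ∀ j → g ℕ.≤ y j × y j ℕ.< 2 ℕ.* g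

        inner<L : ∀ {y} → Inner y → ∀ j → y j ℕ.< L
        inner<L inner j = ℕ.<-≤-trans (proj₂ (inner j)) (ℕ.m≤n+m (2 ℕ.* g) g)

        near⇒hit : ∀ {y} t p → (∀ j → ∣ fromℕ (M j) * dev t p j ∣ ≤ fromℕ g) → Inner y → Hit y t
        near⇒hit {y} t p near inner = p , λ j →
          (begin-strict
            - 1#                                     ≈⟨ +-identityʳ _ ⟨
            - 1# + 0#                                <⟨ +-monoˡ-< 0# (neg-mono-< 0<1) ⟩
            - 0# + 0#                                ≈⟨ trans (+-identityʳ _) -0#≈0# ⟩
            0#                                       ≈⟨ -‿inverseˡ (fromℕ g) ⟨
            - fromℕ g + fromℕ g                      ≤⟨ +-mono-≤ (≤-trans (neg-mono-≤ (near j)) (-∣x∣≤x _)) (fromℕ-mono-≤ (proj₁ (inner j))) ⟩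
            fromℕ (M j) * dev t p j + fromℕ (y j)    ∎)
          , (begin-strict
            fromℕ (M j) * dev t p j + fromℕ (y j)    <⟨ +-mono-≤-< (≤-trans (x≤∣x∣ _) (near j)) (fromℕ-mono-< (proj₂ (inner j))) ⟩
            fromℕ g + fromℕ (2 ℕ.* g)                ≈⟨ fromℕ-homo-+ g (2 ℕ.* g) ⟨
            fromℕ L                                  ∎)

        hit-0 : ∀ {y} → Inner y → Hit y 0
        hit-0 = near⇒hit 0 (λ _ → + 0) λ j → begin
          ∣ fromℕ (M j) * (0# * α j - 0#) ∣   ≈⟨ ∣∣-cong (*-congˡ (+-cong (zeroˡ (α j)) -0#≈0#)) ⟩
          ∣ fromℕ (M j) * (0# + 0#) ∣         ≈⟨ ∣∣-cong (trans (*-congˡ (+-identityʳ 0#)) (zeroʳ _)) ⟩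
          ∣ 0# ∣                              ≤⟨ ∣∣-lub ≤-refl (inj₂ -0#≈0#) ⟩
          0#                                  ≤⟨ 0≤fromℕ g ⟩
          fromℕ g                             ∎

        -- Undoing the first `r` steps carries the cube at time `r` back to the cube at the origin,
        -- and with it the orbit point of `y`.
        cell-≡⇒hit : ∀ {t r y y′} → r ℕ.≤ t → (∀ j → y′ j ℕ.< L) → cell t y ≡ cell r y′ →
                     Hit y (t ℕ.∸ r)
        cell-≡⇒hit {t} {r} {y} {y′} r≤t y′<L eq = p , λ j →
          (begin-strict
            - 1#                       ≈⟨ +-identityʳ _ ⟨
            - 1# + 0#                  <⟨ +-mono-<-≤ (lower (close j)) (0≤fromℕ (y′ j)) ⟩
            w j + fromℕ (y′ j)         ≈⟨ recombine _ _ _ ⟩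
            z j                        ∎)
          , (begin-strict
            z j                        ≈⟨ recombine _ _ _ ⟨
            w j + fromℕ (y′ j)         <⟨ +-monoˡ-< _ (upper (close j)) ⟩
            fromℕ (suc (y′ j))         ≤⟨ fromℕ-mono-≤ (y′<L j) ⟩
            fromℕ L                    ∎)
          where
          closeness = cell-≡⇒close (t ℕ.∸ r) r y′ y
            (≡.trans (≡.cong (λ s → cell s y) (ℕ.m+[n∸m]≡n r≤t)) eq)
          p = proj₁ closeness
          close = proj₂ closeness
          w z : Vector ℝ n
          w j = fromℕ (M j) * dev (t ℕ.∸ r) p j + (fromℕ (y j) - fromℕ (y′ j))
          z j = fromℕ (M j) * dev (t ℕ.∸ r) p j + fromℕ (y j)
          recombine : ∀ a b c → (a + (b - c)) + c ≈ a + b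
          recombine = solve 3 (λ a b c → (a :+ (b :- c)) :+ c := a :+ b) refl
          lower : ∀ {x} → ∣ x ∣ < 1# → - 1# < x
          lower {x} ∣x∣<1 = begin-strict - 1# <⟨ neg-mono-< ∣x∣<1 ⟩ - ∣ x ∣ ≤⟨ -∣x∣≤x x ⟩ x ∎
          upper : ∀ {x} → ∣ x ∣ < 1# → x < 1#
          upper {x} ∣x∣<1 = begin-strict x ≤⟨ x≤∣x∣ x ⟩ ∣ x ∣ <⟨ ∣x∣<1 ⟩ 1# ∎

        module _ {σ : ℕ} (σ<ρ : σ ℕ.< ρ) {y : Vector ℕ n} (inner : Inner y) where

          -- Some hit of y falls into the m-th of k consecutive windows of
          -- Q + 1 times, starting after σ.  If all windows contained hits, the
          -- last of these would be less than Q + 1 before the hit at time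
          -- k (Q + 1) + ρ.
          Covered : ℕ → Set
          Covered m = ∃ λ r → ∃ λ y′ → r ℕ.≤ Q × (∀ j → y′ j ℕ.< L) ×
                      cell (σ ℕ.+ suc m ℕ.* suc Q) y ≡ cell r y′

          Reached : ℕ → Set
          Reached m = ∃ λ t → m ℕ.* suc Q ℕ.≤ t × t ℕ.≤ σ ℕ.+ m ℕ.* suc Q × Hit y t

          -- As `r ≤ Q`, the new hit at `T ∸ r` comes strictly after `t`. By `hit-gap` it then comes
          -- at least `Q + 1` later, which is the lower bound required of the next window.
          covered⇒reached : ∀ m → Covered m → Reached m → Reached (suc m)
          covered⇒reached m (r , y′ , r≤Q , y′<L , eq) (t , lo , hi , hit) =
            T ℕ.∸ r
            , ℕ.≤-trans (ℕ.≤-trans (ℕ.≤-reflexive (ℕ.+-comm (suc Q) (m ℕ.* suc Q))) (ℕ.+-monoˡ-≤ (suc Q) lo))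
                (hit-gap y hit hit′ t<T-r)
            , ℕ.m∸n≤m T r
            , hit′
            where
            T = σ ℕ.+ suc m ℕ.* suc Q
            r+t<T : r ℕ.+ t ℕ.< T
            r+t<T = +-mono-≤-suc σ r≤Q hi
            t<T-r : t ℕ.< T ℕ.∸ r
            t<T-r = ℕ.m+n≤o⇒m≤o∸n (suc t) (≡.subst (ℕ._≤ T) (≡.cong suc (ℕ.+-comm r t)) r+t<T)
            hit′ : Hit y (T ℕ.∸ r)
            hit′ = cell-≡⇒hit (ℕ.≤-trans (ℕ.m≤m+n r t) (ℕ.<⇒≤ r+t<T)) y′<L eq

          uncovered-or-reached : ∀ m → (∃ λ m′ → m′ ℕ.< m × ¬ Covered m′) ⊎ Reached m
          uncovered-or-reached zero    = inj₂ (0 , z≤n , z≤n , hit-0 inner)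
          uncovered-or-reached (suc m) = step (uncovered-or-reached m) (excludedMiddle (Covered m))
            where
            step : (∃ λ m′ → m′ ℕ.< m × ¬ Covered m′) ⊎ Reached m → Dec (Covered m) →
                   (∃ λ m′ → m′ ℕ.< suc m × ¬ Covered m′) ⊎ Reached (suc m)
            step (inj₁ (m′ , m′<m , unc)) _      = inj₁ (m′ , ℕ.m<n⇒m<1+n m′<m , unc)
            step (inj₂ reached) (yes covered)    = inj₂ (covered⇒reached m covered reached)
            step (inj₂ reached) (no uncovered)   = inj₁ (m , ℕ.≤-refl , uncovered)

          not-reached : ¬ Reached k
          not-reached (t , lo , hi , hit) = ℕ.<⇒≱ (s≤s ρ≤Q) (ℕ.+-cancelˡ-≤ (k ℕ.* suc Q) (suc Q) ρ (ℕ.≤-trans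
            (ℕ.+-monoˡ-≤ (suc Q) lo) (hit-gap y hit (near⇒hit (k ℕ.* suc Q ℕ.+ ρ) v v-small inner)
              (≡.subst (t ℕ.<_) (ℕ.+-comm ρ _) (ℕ.≤-<-trans hi (ℕ.+-monoˡ-< (k ℕ.* suc Q) σ<ρ))))))

          uncovered : ∃ λ (m : Fin k) → ¬ Covered (toℕ m)
          uncovered = conclude (uncovered-or-reached k)
            where
            conclude : (∃ λ m → m ℕ.< k × ¬ Covered m) ⊎ Reached k → ∃ λ (m : Fin k) → ¬ Covered (toℕ m)
            conclude (inj₁ (m , m<k , unc)) =
              fromℕ< m<k , ≡.subst (¬_ ∘ Covered) (≡.sym (Fin.toℕ-fromℕ< m<k)) unc
            conclude (inj₂ reached) = contradiction reached not-reached

        private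
          -- Which window stays uncovered depends on `σ` and on the inner offset. One copy of the
          -- grid per window keeps the free cells of different windows apart, and each copy also
          -- contains all cells of the cubes at times 0 to `Q`.
          Source : Set
          Source = (Fin ρ × Fin (g ℕ.^ n)) ⊎ (Fin k × (Fin (suc Q) × Fin (L ℕ.^ n)))

          innerPoint : Fin (g ℕ.^ n) → Vector ℕ n
          innerPoint u j = g ℕ.+ toℕ (finToFun {g} {n} u j)

          cubePoint : Fin (L ℕ.^ n) → Vector ℕ n
          cubePoint u j = toℕ (finToFun {L} {n} u j)

          innerPoint-inner : ∀ u → Inner (innerPoint u)
          innerPoint-inner u j = ℕ.m≤m+n g _ ,
            ≡.subst (g ℕ.+ toℕ (finToFun {g} {n} u j) ℕ.<_) (≡.cong (g ℕ.+_) (≡.sym (ℕ.+-identityʳ g)))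
              (ℕ.+-monoʳ-< g (Fin.toℕ<n (finToFun {g} {n} u j)))

          cubePoint<L : ∀ u j → cubePoint u j ℕ.< L
          cubePoint<L u j = Fin.toℕ<n (finToFun {L} {n} u j)

          free : ∀ (σ : Fin ρ) u →
                 ∃ λ (m : Fin k) → ¬ Covered (Fin.toℕ<n σ) (innerPoint-inner u) (toℕ m)
          free σ u = uncovered (Fin.toℕ<n σ) (innerPoint-inner u)

          place : Source → Fin k × Fin (∏ M)
          place (inj₁ (σ , u))     = proj₁ (free σ u) ,
            cell (toℕ σ ℕ.+ suc (toℕ (proj₁ (free σ u))) ℕ.* suc Q) (innerPoint u)
          place (inj₂ (m , r , u)) = m , cell (toℕ r) (cubePoint u)

          uncovered≢ : ∀ σ u m r u′ → place (inj₁ (σ , u)) ≢ place (inj₂ (m , r , u′))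
          uncovered≢ σ u m r u′ eq = proj₂ (free σ u)
            (toℕ r , cubePoint u′ , ℕ.<⇒≤pred (Fin.toℕ<n r) , cubePoint<L u′ , ≡.cong proj₂ eq)

          σ≤Q : ∀ (σ : Fin ρ) → toℕ σ ℕ.≤ Q
          σ≤Q σ = ℕ.<⇒≤ (ℕ.<-≤-trans (Fin.toℕ<n σ) ρ≤Q)

          place-injective : Injective _≡_ _≡_ place
          place-injective {inj₁ (σ , u)} {inj₁ (σ′ , u′)} eq =
            ≡.cong inj₁ (≡.cong₂ _,_
              (Fin.toℕ-injective (ℕ.+-cancelʳ-≡ c (toℕ σ) (toℕ σ′) (proj₁ sep)))
              (finToFun-injective {g} {n} λ j → Fin.toℕ-injective (ℕ.+-cancelˡ-≡ g _ _ (proj₂ sep j))))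
            where
            -- Free cells in the same copy belong to the same window, so their times differ only by
            -- the difference of `σ` and `σ′`, which is at most `Q`; this is all that `separated′`
            -- asks for.
            c = suc (toℕ (proj₁ (free σ u))) ℕ.* suc Q
            sep : toℕ σ ℕ.+ c ≡ toℕ σ′ ℕ.+ c × innerPoint u ≗ innerPoint u′
            sep = separated′ (m+o≤n+o+p (toℕ σ′) c (σ≤Q σ)) (m+o≤n+o+p (toℕ σ) c (σ≤Q σ′))
              (inner<L (innerPoint-inner u)) (inner<L (innerPoint-inner u′))
              (≡.trans (≡.cong proj₂ eq)
                (≡.cong (λ m → cell (toℕ σ′ ℕ.+ suc (toℕ m) ℕ.* suc Q) (innerPoint u′))
                  (≡.sym (≡.cong proj₁ eq))))
          place-injective {inj₁ (σ , u)} {inj₂ (m , r , u′)} eq =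
            contradiction eq (uncovered≢ σ u m r u′)
          place-injective {inj₂ (m , r , u)} {inj₁ (σ , u′)} eq =
            contradiction (≡.sym eq) (uncovered≢ σ u′ m r u)
          place-injective {inj₂ (m , r , u)} {inj₂ (m′ , r′ , u′)} eq =
            ≡.cong inj₂ (≡.cong₂ _,_ (≡.cong proj₁ eq) (≡.cong₂ _,_
              (Fin.toℕ-injective (proj₁ sep))
              (finToFun-injective {L} {n} λ j → Fin.toℕ-injective (proj₂ sep j))))
            where
            r≤Q+ : ∀ (r : Fin (suc Q)) s → toℕ r ℕ.≤ s ℕ.+ Q
            r≤Q+ r s = ℕ.≤-trans (ℕ.<⇒≤pred (Fin.toℕ<n r)) (ℕ.m≤n+m Q s)
            sep : toℕ r ≡ toℕ r′ × cubePoint u ≗ cubePoint u′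
            sep = separated′ (r≤Q+ r (toℕ r′)) (r≤Q+ r′ (toℕ r)) (cubePoint<L u) (cubePoint<L u′)
              (≡.cong proj₂ eq)

          enumerate : Fin (ρ ℕ.* g ℕ.^ n ℕ.+ k ℕ.* (suc Q ℕ.* L ℕ.^ n)) ↔ Source
          enumerate = ↔-trans Fin.+↔⊎ (Fin.*↔× ⊎-↔ ↔-trans Fin.*↔× (↔-refl ×-↔ Fin.*↔×))

        -- The source of the smallness of `ρ`: each `σ` below `ρ` takes `g ^ n` cells outside the
        -- cubes, and the cubes leave few of them.
        packing-bound : ρ ℕ.* g ℕ.^ n ℕ.+ k ℕ.* (suc Q ℕ.* L ℕ.^ n) ℕ.≤ k ℕ.* ∏ M
        packing-bound = Fin.injective⇒≤
          (Injection.injective (↔⇒↣ enumerate) ∘ place-injective ∘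
           Injection.injective (↔⇒↣ (↔-sym (Fin.*↔× {k} {∏ M}))))

-- Estimates with natural numbers

∃-upperBound : ∀ {n} (f : Vector ℕ n) → ∃ λ b → ∀ j → f j ℕ.≤ b
∃-upperBound {zero}  f = 0 , λ ()
∃-upperBound {suc n} f = f zero ℕ.⊔ b , λ where
    zero    → ℕ.m≤m⊔n (f zero) b
    (suc j) → ℕ.≤-trans (proj₂ (∃-upperBound (tail f)) j) (ℕ.m≤n⊔m (f zero) b)
  where b = proj₁ (∃-upperBound (tail f))

-- Bernoulli's inequality (1 - 1/(g+1))ⁿ ≥ 1 - n/(g+1) for g = n + m.
bernoulliℕ : ∀ n m → suc (n ℕ.+ m) ℕ.^ n ℕ.* suc m ℕ.≤ (n ℕ.+ m) ℕ.^ n ℕ.* suc (n ℕ.+ m)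
bernoulliℕ zero    m = ℕ.≤-refl
bernoulliℕ (suc n) m = begin
  (suc g ℕ.* suc g ℕ.^ n) ℕ.* suc m        ≡⟨ solve 3 (λ a x b → (a :* x) :* b := (a :* b) :* x) ≡.refl (suc g) (suc g ℕ.^ n) (suc m) ⟩
  (suc g ℕ.* suc m) ℕ.* suc g ℕ.^ n        ≤⟨ ℕ.*-monoˡ-≤ (suc g ℕ.^ n) [1+g][1+m]≤g[2+m] ⟩
  (g ℕ.* suc (suc m)) ℕ.* suc g ℕ.^ n      ≡⟨ solve 3 (λ a b x → (a :* b) :* x := a :* (x :* b)) ≡.refl g (suc (suc m)) (suc g ℕ.^ n) ⟩
  g ℕ.* (suc g ℕ.^ n ℕ.* suc (suc m))      ≤⟨ ℕ.*-monoʳ-≤ g ih ⟩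
  g ℕ.* (g ℕ.^ n ℕ.* suc g)                ≡⟨ ℕ.*-assoc g (g ℕ.^ n) (suc g) ⟨
  (g ℕ.* g ℕ.^ n) ℕ.* suc g                ∎
  where
  open ℕ.≤-Reasoning
  open ℕ.+-*-Solver using (solve; _:*_; _:=_)
  g = suc n ℕ.+ m
  ih : suc g ℕ.^ n ℕ.* suc (suc m) ℕ.≤ g ℕ.^ n ℕ.* suc g
  ih = ≡.subst (λ g → suc g ℕ.^ n ℕ.* suc (suc m) ℕ.≤ g ℕ.^ n ℕ.* suc g) (ℕ.+-suc n m) (bernoulliℕ n (suc m))
  [1+g][1+m]≤g[2+m] : suc g ℕ.* suc m ℕ.≤ g ℕ.* suc (suc m)
  [1+g][1+m]≤g[2+m] = begin
    suc m ℕ.+ g ℕ.* suc m    ≤⟨ ℕ.+-monoˡ-≤ (g ℕ.* suc m) (s≤s (ℕ.m≤n+m m n)) ⟩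
    g ℕ.+ g ℕ.* suc m        ≡⟨ ℕ.*-suc g (suc m) ⟨
    g ℕ.* suc (suc m)        ∎

powers-nearly-equal : ∀ c n → ∃ λ g → c ℕ.* suc (suc g) ℕ.^ n ℕ.≤ suc c ℕ.* suc g ℕ.^ n
powers-nearly-equal c n = n ℕ.+ c ℕ.* n ,
  ≡.subst (λ g → c ℕ.* suc g ℕ.^ n ℕ.≤ suc c ℕ.* g ℕ.^ n) (ℕ.+-suc n (c ℕ.* n))
  (ℕ.*-cancelʳ-≤ _ _ (suc m) (begin
    (c ℕ.* suc g ℕ.^ n) ℕ.* suc m       ≡⟨ ℕ.*-assoc c _ (suc m) ⟩
    c ℕ.* (suc g ℕ.^ n ℕ.* suc m)       ≤⟨ ℕ.*-monoʳ-≤ c (bernoulliℕ n m) ⟩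
    c ℕ.* (g ℕ.^ n ℕ.* suc g)           ≡⟨ solve 3 (λ c x y → c :* (x :* y) := (c :* y) :* x) ≡.refl c (g ℕ.^ n) (suc g) ⟩
    (c ℕ.* suc g) ℕ.* g ℕ.^ n           ≤⟨ ℕ.*-monoˡ-≤ (g ℕ.^ n) c[1+g]≤ ⟩
    (suc c ℕ.* suc m) ℕ.* g ℕ.^ n       ≡⟨ solve 3 (λ c x y → (c :* y) :* x := (c :* x) :* y) ≡.refl (suc c) (g ℕ.^ n) (suc m) ⟩
    (suc c ℕ.* g ℕ.^ n) ℕ.* suc m       ∎))
  where
  open ℕ.≤-Reasoning
  open ℕ.+-*-Solver using (solve; _:*_; _:+_; _:=_; con)
  -- The inequality `c[1+g]≤` amounts to `c * n ≤ suc m`. The successor also makes `g` positive, so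
  -- that it can be returned as a successor.
  m = suc (c ℕ.* n)
  g = n ℕ.+ m
  c[1+g]≤ : c ℕ.* suc g ℕ.≤ suc c ℕ.* suc m
  c[1+g]≤ = begin
    c ℕ.* suc (n ℕ.+ m)            ≡⟨ solve 3 (λ c n m → c :* (con 1 :+ (n :+ m)) := c :* n :+ c :* (con 1 :+ m)) ≡.refl c n m ⟩
    c ℕ.* n ℕ.+ c ℕ.* suc m        ≤⟨ ℕ.+-monoˡ-≤ (c ℕ.* suc m) (ℕ.≤-trans (ℕ.n≤1+n (c ℕ.* n)) (ℕ.n≤1+n (suc (c ℕ.* n)))) ⟩
    suc m ℕ.+ c ℕ.* suc m          ∎

-- Informally, the last hypothesis gives `ρ * y ≤ k * t * Q * (x - y)`, and `x - y` is at most
-- `y / (K * r * t)`. To avoid subtraction, `K * r * t * Q * y` is added on both sides; the part of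
-- it due to `K ∸ k` is enlarged by `y ≤ x`.
remainder-bound : ∀ {ρ k K r t x y Q} .{{_ : NonZero y}} → k ℕ.≤ K → y ℕ.≤ x →
  (K ℕ.* r ℕ.* t) ℕ.* x ℕ.≤ suc (K ℕ.* r ℕ.* t) ℕ.* y →
  ρ ℕ.* y ℕ.+ k ℕ.* (suc Q ℕ.* (t ℕ.* y)) ℕ.≤ k ℕ.* (t ℕ.* x ℕ.* Q) →
  r ℕ.* ρ ℕ.≤ Q
remainder-bound {ρ} {k} {K} {r} {t} {x} {y} {Q} k≤K y≤x Cx≤[1+C]y bound =
  ℕ.*-cancelʳ-≤ _ _ y (ℕ.+-cancelʳ-≤ ((K ℕ.* r ℕ.* t) ℕ.* Q ℕ.* y) _ _ (begin
    r ℕ.* ρ ℕ.* y ℕ.+ (K ℕ.* r ℕ.* t) ℕ.* Q ℕ.* y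
      ≡⟨ ≡.cong (λ K → r ℕ.* ρ ℕ.* y ℕ.+ (K ℕ.* r ℕ.* t) ℕ.* Q ℕ.* y) k+l≡K ⟨
    r ℕ.* ρ ℕ.* y ℕ.+ ((k ℕ.+ l) ℕ.* r ℕ.* t) ℕ.* Q ℕ.* y
      ≡⟨ solve 7 (λ ρ k l r t y Q → r :* ρ :* y :+ ((k :+ l) :* r :* t) :* Q :* y :=
           r :* (ρ :* y :+ k :* (Q :* (t :* y))) :+ (l :* r :* t :* Q) :* y) ≡.refl ρ k l r t y Q ⟩
    r ℕ.* (ρ ℕ.* y ℕ.+ k ℕ.* (Q ℕ.* (t ℕ.* y))) ℕ.+ (l ℕ.* r ℕ.* t ℕ.* Q) ℕ.* y
      ≤⟨ ℕ.+-mono-≤ (ℕ.*-monoʳ-≤ r (ℕ.≤-trans (ℕ.+-monoʳ-≤ (ρ ℕ.* y) (ℕ.*-monoʳ-≤ k (ℕ.*-monoˡ-≤ (t ℕ.* y) (ℕ.n≤1+n Q)))) bound))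
                    (ℕ.*-monoʳ-≤ (l ℕ.* r ℕ.* t ℕ.* Q) y≤x) ⟩
    r ℕ.* (k ℕ.* (t ℕ.* x ℕ.* Q)) ℕ.+ (l ℕ.* r ℕ.* t ℕ.* Q) ℕ.* x
      ≡⟨ solve 6 (λ k l r t x Q → r :* (k :* (t :* x :* Q)) :+ (l :* r :* t :* Q) :* x :=
           ((k :+ l) :* r :* t) :* x :* Q) ≡.refl k l r t x Q ⟩
    ((k ℕ.+ l) ℕ.* r ℕ.* t) ℕ.* x ℕ.* Q
      ≡⟨ ≡.cong (λ K → (K ℕ.* r ℕ.* t) ℕ.* x ℕ.* Q) k+l≡K ⟩
    (K ℕ.* r ℕ.* t) ℕ.* x ℕ.* Q
      ≤⟨ ℕ.*-monoˡ-≤ Q Cx≤[1+C]y ⟩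
    (y ℕ.+ (K ℕ.* r ℕ.* t) ℕ.* y) ℕ.* Q
      ≡⟨ solve 3 (λ c y Q → (y :+ c :* y) :* Q := Q :* y :+ c :* Q :* y) ≡.refl (K ℕ.* r ℕ.* t) y Q ⟩
    Q ℕ.* y ℕ.+ (K ℕ.* r ℕ.* t) ℕ.* Q ℕ.* y ∎))
  where
  open ℕ.≤-Reasoning
  open ℕ.+-*-Solver using (solve; _:*_; _:+_; _:=_)
  l = K ℕ.∸ k
  k+l≡K : k ℕ.+ l ≡ K
  k+l≡K = ℕ.m+[n∸m]≡n k≤K

-- Dirichlet's theorem and uniform bad approximability

module Approximation (R : CompleteOrderedField) where

  open OrderedField R
  open RealPowers R
  open Cells R
  open Solver using (solve; _:+_; _:*_; _:-_; _:=_)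

  -- Two of the times 0 to `∏ M` share a cell, and `q` is their difference.
  dirichlet : ∀ {n} (α : Vector ℝ n) (M : Vector ℕ n) → (∀ j → NonZero (M j)) →
              ∃ λ q → ∃ λ p → 1 ℕ.≤ q × q ℕ.≤ ∏ M × ∀ j → ∣ fromℕ (M j) * dev α q p j ∣ < 1#
  dirichlet {n} α M M≢0 = conclude (Fin.pigeonhole ℕ.≤-refl place)
    where
    origin : Vector ℕ n
    origin _ = 0
    place : Fin (suc (∏ M)) → Fin (∏ M)
    place t = cell α M M≢0 (toℕ t) origin
    conclude : (∃ λ s → ∃ λ t → s Fin.< t × place s ≡ place t) →
      ∃ λ q → ∃ λ p → 1 ℕ.≤ q × q ℕ.≤ ∏ M × ∀ j → ∣ fromℕ (M j) * dev α q p j ∣ < 1#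
    conclude (s , t , s<t , eq) = q , proj₁ close , ℕ.m<n⇒0<n∸m s<t
      , ℕ.≤-trans (ℕ.m∸n≤m (toℕ t) (toℕ s)) (ℕ.<⇒≤pred (Fin.toℕ<n t))
      , λ j → begin-strict
          ∣ fromℕ (M j) * dev α q (proj₁ close) j ∣                ≈⟨ ∣∣-cong (trans (+-congˡ (-‿inverseʳ 0#)) (+-identityʳ _)) ⟨
          ∣ fromℕ (M j) * dev α q (proj₁ close) j + (0# - 0#) ∣    <⟨ proj₂ close j ⟩
          1#                                                       ∎
      where
      q = toℕ t ℕ.∸ toℕ s
      close = cell-≡⇒close α M M≢0 q (toℕ s) origin origin
        (≡.trans (≡.cong (λ t → cell α M M≢0 t origin) (ℕ.m+[n∸m]≡n (ℕ.<⇒≤ s<t))) (≡.sym eq))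

  ‖x‖≤∣x-k∣ : ∀ x k → ‖ x ‖ ≤ ∣ x - fromℤ k ∣
  ‖x‖≤∣x-k∣ x k = proj₂ (nearestInteger x) k

  x⊔y-sel : ∀ {d x y} → d ≤ x ⊔ y → d ≤ x ⊎ d ≤ y
  x⊔y-sel {d} {x} {y} d≤x⊔y = Sum.swap (Sum.map
    (λ x≤y → ≤-trans d≤x⊔y (⊔-lub x≤y ≤-refl))
    (λ y≤x → ≤-trans d≤x⊔y (⊔-lub ≤-refl y≤x)) (≤-total x y))

  maximum-attained : ∀ {n d} {x : Vector ℝ n} → 0# < d → d ≤ maximum x → ∃ λ j → d ≤ x j
  maximum-attained {zero}  0<d d≤0 = contradiction 0<d (≤⇒≯ d≤0)
  maximum-attained {suc n} 0<d d≤max =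
    [ (zero ,_) , (λ d≤max′ → Product.map suc (λ d≤x → d≤x) (maximum-attained 0<d d≤max′)) ]′
    (x⊔y-sel d≤max)

  open import Relation.Nullary.Construct.Add.Extrema using (_±; ⊥±; ⊤±; [_])
  open import Relation.Binary.Construct.Add.Extrema.Strict _<_
    using ([<]-injective; <±-asym; ⊥±<[_]; [_]<⊤±) renaming ([_] to lift)

  weightedDistance-attained : ∀ {n} (i α : Vector ℝ n) q .{{_ : NonZero q}} {d} → 0# < d →
    d ≤ weightedDistance i α q → ∃ λ j → ∀ p → d ≤ q ^ᵃ i j * ∣ dev α q p j ∣
  weightedDistance-attained i α q {d} 0<d d≤dist =
    Product.map₂ (λ {j} d≤ p → begin
      d                                       ≤⟨ d≤ ⟩
      q ^ʳ i j * ‖ fromℕ q * α j ‖            ≈⟨ *-congʳ (^ᵃ≈^ʳ q (i j)) ⟨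
      q ^ᵃ i j * ‖ fromℕ q * α j ‖            ≤⟨ *-monoʳ-≤ (0≤^ᵃ q (i j)) (‖x‖≤∣x-k∣ _ (p j)) ⟩
      q ^ᵃ i j * ∣ dev α q p j ∣              ∎)
    (maximum-attained {x = λ j → q ^ʳ i j * ‖ fromℕ q * α j ‖} 0<d d≤dist)

  -- A positive supremum of tail infima leaves one positive tail infimum, which is finite because
  -- tails are inhabited. The distance to the nearest integer bounds the errors for all `p`
  -- simultaneously, so `j` can be chosen before `p`; `bad⇒uniform` uses the same `j` for two
  -- vectors `p`.
  bad⇒eventually : ∀ {n} (i α : Vector ℝ n) → Bad i α → ∃ λ d → 0# < d × ∃ λ N →
    ∀ q → N ℕ.≤ q → ∃ λ j → ∀ p → d ≤ suc q ^ᵃ i j * ∣ dev α (suc q) p j ∣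
  bad⇒eventually {n} i α (l , liminf , 0<l) = conclude (proj₂ liminf 0<l)
    where
    a : ℕ → ℝ
    a q = weightedDistance i α (suc q)
    conclude : (∃ λ m → (∃ λ N → IsInfimum _<±_ (Tail a N) m) × [ 0# ] <± m) →
      ∃ λ d → 0# < d × ∃ λ N →
      ∀ q → N ℕ.≤ q → ∃ λ j → ∀ p → d ≤ suc q ^ᵃ i j * ∣ dev α (suc q) p j ∣
    conclude ([ d ] , (N , inf) , 0<d) = d , [<]-injective 0<d , N , λ q N≤q →
      weightedDistance-attained i α (suc q) ([<]-injective 0<d)
        (≮⇒≥ λ aq<d → proj₁ inf (q , N≤q , ≡.refl) (lift aq<d))
    conclude (⊤± , (N , inf) , _) = contradiction [ a N ]<⊤± (proj₁ inf (N , ℕ.≤-refl , ≡.refl))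
    conclude (⊥± , _ , 0<⊥) = contradiction ⊥±<[ 0# ] (<±-asym asym 0<⊥)

  ^ᵃ-≤1 : ∀ q .{{_ : NonZero q}} {x} → 0# ≤ x → x ≤ 0# → q ^ᵃ x ≤ 1#
  ^ᵃ-≤1 q {x} 0≤x x≤0 = ^ᵃ-lub q 0≤x λ { {r} (0≤r , e , b , b≢0 , e≤bx , rᵇ≤qᵉ) →
    ^-cancelˡ-≤ b {{b≢0}} (<⇒≤ 0<1) (begin
      r ^ b             ≤⟨ rᵇ≤qᵉ ⟩
      fromℕ (q ℕ.^ e)   ≡⟨ ≡.cong (λ e → fromℕ (q ℕ.^ e)) (ℕ.n≤0⇒n≡0 (fromℕ-cancel-≤ {e} {0} (begin
          fromℕ e         ≤⟨ e≤bx ⟩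
          fromℕ b * x     ≤⟨ *-monoʳ-≤ (0≤fromℕ b) x≤0 ⟩
          fromℕ b * 0#    ≈⟨ zeroʳ _ ⟩
          0#              ∎))) ⟩
      fromℕ 1           ≈⟨ trans fromℕ-1 (sym (1^n≈1 b)) ⟩
      1# ^ b            ∎) }

  dev-multiple : ∀ {n} (α : Vector ℝ n) m q p j →
                 dev α (m ℕ.* q) (λ j → + m ℤ.* p j) j ≈ fromℕ m * dev α q p j
  dev-multiple α m q p j = begin-equality
    fromℕ (m ℕ.* q) * α j - fromℤ (+ m ℤ.* p j)          ≈⟨ +-cong (*-congʳ (fromℕ-homo-* m q)) (-‿cong (fromℤ-homo-* (+ m) (p j))) ⟩
    (fromℕ m * fromℕ q) * α j - fromℕ m * fromℤ (p j)    ≈⟨ identity (fromℕ m) (fromℕ q) (α j) (fromℤ (p j)) ⟩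
    fromℕ m * (fromℕ q * α j - fromℤ (p j))              ∎
    where
    identity : ∀ m q a p → (m * q) * a - m * p ≈ m * (q * a - p)
    identity = solve 4 (λ m q a p → (m :* q) :* a :- m :* p := m :* (q :* a :- p)) refl

  -- Coordinates of weight zero can be ignored: by Dirichlet's theorem some
  -- bounded multiple of q makes them all small, and passing to a bounded
  -- multiple changes the other coordinates by a bounded factor only.
  bad⇒uniform : ∀ {n} {i α : Vector ℝ n} → (∀ j → 0# ≤ i j × i j ≤ 1#) → Bad i α →
    ∃ λ D → ∀ q .{{_ : NonZero q}} p →
    ∃ λ j → 0# < i j × 1# ≤ fromℕ D * (q ^ᵃ i j * ∣ dev α q p j ∣)
  bad⇒uniform {n} {i} {α} weights bad = B ℕ.* (T ℕ.* T) , uniform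
    where
    eventually = bad⇒eventually i α bad
    d = proj₁ eventually
    0<d = proj₁ (proj₂ eventually)
    N = proj₁ (proj₂ (proj₂ eventually))
    d≤ = proj₂ (proj₂ (proj₂ eventually))
    d⁻¹ = proj₁ (positiveInverse 0<d)
    B = suc (proj₁ (archimedean d⁻¹))
    1≤Bd : 1# ≤ fromℕ B * d
    1≤Bd = begin
      1#             ≈⟨ proj₂ (proj₂ (positiveInverse 0<d)) ⟨
      d * d⁻¹        ≈⟨ *-comm _ _ ⟩
      d⁻¹ * d        ≤⟨ *-monoˡ-≤ (<⇒≤ 0<d) (≤-trans (<⇒≤ (proj₂ (archimedean d⁻¹))) (<⇒≤ (x<1+x _))) ⟩
      fromℕ B * d    ∎
    M : Vector ℕ n
    M _ = B
    T = ∏ M ℕ.* suc N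

    attained : ∀ Q .{{_ : NonZero Q}} → suc N ℕ.≤ Q → ∃ λ j → ∀ p → d ≤ Q ^ᵃ i j * ∣ dev α Q p j ∣
    attained (suc Q) (s≤s N≤Q) = d≤ Q N≤Q

    zero-weight : ∀ Q .{{_ : NonZero Q}} j p → 0# ≈ i j → d ≤ Q ^ᵃ i j * ∣ dev α Q p j ∣ →
                  d ≤ ∣ dev α Q p j ∣
    zero-weight Q j p 0≈i d≤Q = begin
      d                                          ≤⟨ d≤Q ⟩
      Q ^ᵃ i j * ∣ dev α Q p j ∣                 ≤⟨ *-monoˡ-≤ (0≤∣x∣ _) (^ᵃ-≤1 Q (inj₂ 0≈i) (inj₂ (sym 0≈i))) ⟩
      1# * ∣ dev α Q p j ∣                       ≈⟨ *-identityˡ _ ⟩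
      ∣ dev α Q p j ∣                            ∎

    -- Passing from `q` to `s * q` enlarges both the power and the error by at most the factor `s`,
    -- whence the two factors `T`.
    multiple-weight : ∀ Q s q .{{_ : NonZero Q}} .{{_ : NonZero s}} .{{_ : NonZero q}} p j →
      Q ≡ s ℕ.* q → s ℕ.≤ T → d ≤ Q ^ᵃ i j * ∣ dev α Q (λ j → + s ℤ.* p j) j ∣ →
      d ≤ (fromℕ T * q ^ᵃ i j) * (fromℕ T * ∣ dev α q p j ∣)
    multiple-weight Q s q p j Q≡sq s≤T d≤Q = begin
      d                                                  ≤⟨ d≤Q ⟩
      Q ^ᵃ i j * ∣ dev α Q (λ j → + s ℤ.* p j) j ∣       ≤⟨ *-mono-≤ (0≤^ᵃ Q (i j)) (*-nonNeg (0≤fromℕ T) 0≤δ) power norm ⟩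
      (fromℕ T * q ^ᵃ i j) * (fromℕ T * δ)               ∎
      where
      δ = ∣ dev α q p j ∣
      0≤δ = 0≤∣x∣ (dev α q p j)
      power : Q ^ᵃ i j ≤ fromℕ T * q ^ᵃ i j
      power = begin
        Q ^ᵃ i j               ≤⟨ ^ᵃ-≤-multiple (proj₁ (weights j)) (proj₂ (weights j)) (ℕ.≤-reflexive Q≡sq) ⟩
        fromℕ s * q ^ᵃ i j     ≤⟨ *-monoˡ-≤ (0≤^ᵃ q (i j)) (fromℕ-mono-≤ s≤T) ⟩
        fromℕ T * q ^ᵃ i j     ∎
      norm : ∣ dev α Q (λ j → + s ℤ.* p j) j ∣ ≤ fromℕ T * δ
      norm = begin
        ∣ dev α Q (λ j → + s ℤ.* p j) j ∣          ≡⟨ ≡.cong (λ Q → ∣ dev α Q (λ j → + s ℤ.* p j) j ∣) Q≡sq ⟩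
        ∣ dev α (s ℕ.* q) (λ j → + s ℤ.* p j) j ∣  ≈⟨ ∣∣-cong (dev-multiple α s q p j) ⟩
        ∣ fromℕ s * dev α q p j ∣                  ≤⟨ ∣ax∣≤a∣x∣ (0≤fromℕ s) _ ⟩
        fromℕ s * δ                                ≤⟨ *-monoˡ-≤ 0≤δ (fromℕ-mono-≤ s≤T) ⟩
        fromℕ T * δ                                ∎

    uniform : ∀ q .{{_ : NonZero q}} p →
      ∃ λ j → 0# < i j × 1# ≤ fromℕ (B ℕ.* (T ℕ.* T)) * (q ^ᵃ i j * ∣ dev α q p j ∣)
    uniform q p = j
      , [ (λ 0<i → 0<i) , (λ 0≈i → contradiction (proj₂ (proj₂ (proj₂ (proj₂ approximation))) j) (≤⇒≯ (1≤small 0≈i))) ]′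
          (proj₁ (weights j))
      , (begin
        1#                                         ≤⟨ 1≤Bd ⟩
        fromℕ B * d                                ≤⟨ *-monoʳ-≤ (0≤fromℕ B) (multiple-weight Q s q p j ≡.refl s≤T (d≤Q (λ j → + s ℤ.* p j))) ⟩
        fromℕ B * ((fromℕ T * X) * (fromℕ T * δ))  ≈⟨ identity (fromℕ B) (fromℕ T) X δ ⟩
        (fromℕ B * (fromℕ T * fromℕ T)) * (X * δ)  ≈⟨ *-congʳ (trans (fromℕ-homo-* B (T ℕ.* T)) (*-congˡ (fromℕ-homo-* T T))) ⟨
        fromℕ (B ℕ.* (T ℕ.* T)) * (X * δ)          ∎)
      where
      -- The factor `suc N` makes `Q` large enough for `attained`. The multiplier `m` then brings
      -- every coordinate of `Q α` within less than `1 / B ≤ d` of an integer, so the coordinate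
      -- found for `Q` cannot have weight zero.
      β : Vector ℝ n
      β j = fromℕ (suc N ℕ.* q) * α j
      approximation : ∃ λ m → ∃ λ p′ → 1 ℕ.≤ m × m ℕ.≤ ∏ M × ∀ j → ∣ fromℕ B * dev β m p′ j ∣ < 1#
      approximation = dirichlet β M (λ _ → _)
      m = proj₁ approximation
      p′ = proj₁ (proj₂ approximation)
      instance
        m≢0 : NonZero m
        m≢0 = ℕ.>-nonZero (proj₁ (proj₂ (proj₂ approximation)))
      s = m ℕ.* suc N
      instance
        s≢0 : NonZero s
        s≢0 = ℕ.m*n≢0 m (suc N)
      Q = s ℕ.* q
      instance
        Q≢0 : NonZero Q
        Q≢0 = ℕ.m*n≢0 s q
      s≤T : s ℕ.≤ T
      s≤T = ℕ.*-monoˡ-≤ (suc N) (proj₁ (proj₂ (proj₂ (proj₂ approximation))))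
      attained-Q : ∃ λ j → ∀ p → d ≤ Q ^ᵃ i j * ∣ dev α Q p j ∣
      attained-Q = attained Q (ℕ.≤-trans (ℕ.m≤n*m (suc N) m) (ℕ.m≤m*n s q))
      j = proj₁ attained-Q
      d≤Q = proj₂ attained-Q
      X = q ^ᵃ i j
      δ = ∣ dev α q p j ∣
      dev≈ : dev α Q p′ j ≈ dev β m p′ j
      dev≈ = +-congʳ (begin-equality
        fromℕ (m ℕ.* suc N ℕ.* q) * α j            ≡⟨ ≡.cong (λ Q → fromℕ Q * α j) (ℕ.*-assoc m (suc N) q) ⟩
        fromℕ (m ℕ.* (suc N ℕ.* q)) * α j          ≈⟨ *-congʳ (fromℕ-homo-* m (suc N ℕ.* q)) ⟩
        (fromℕ m * fromℕ (suc N ℕ.* q)) * α j      ≈⟨ *-assoc _ _ _ ⟩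
        fromℕ m * (fromℕ (suc N ℕ.* q) * α j)      ∎)
      1≤small : 0# ≈ i j → 1# ≤ ∣ fromℕ B * dev β m p′ j ∣
      1≤small 0≈i = begin
        1#                                         ≤⟨ 1≤Bd ⟩
        fromℕ B * d                                ≤⟨ *-monoʳ-≤ (0≤fromℕ B) (zero-weight Q j p′ 0≈i (d≤Q p′)) ⟩
        fromℕ B * ∣ dev α Q p′ j ∣                 ≈⟨ *-congˡ (∣∣-cong dev≈) ⟩
        fromℕ B * ∣ dev β m p′ j ∣                 ≤⟨ a∣x∣≤∣ax∣ (0≤fromℕ B) _ ⟩
        ∣ fromℕ B * dev β m p′ j ∣                 ∎
      identity : ∀ b t x δ → b * ((t * x) * (t * δ)) ≈ (b * (t * t)) * (x * δ)
      identity = solve 4 (λ b t x δ → b :* ((t :* x) :* (t :* δ)) := (b :* (t :* t)) :* (x :* δ)) refl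

-- Bad approximability against unimprovability

3g+3≤6g : ∀ g₀ → let g = suc g₀ in 3 ℕ.+ 3 ℕ.* g ℕ.≤ 6 ℕ.* g
3g+3≤6g g₀ = ℕ.≤-trans (ℕ.+-monoˡ-≤ (3 ℕ.* suc g₀) (ℕ.m≤m*n 3 (suc g₀)))
  (ℕ.≤-reflexive (≡.sym (ℕ.*-distribʳ-+ (suc g₀) 3 3)))

cross-difference : ∀ k l s {ρ σ} → k ℕ.* σ ℕ.≤ l ℕ.* ρ →
  (l ℕ.* ρ ℕ.∸ k ℕ.* σ) ℕ.+ k ℕ.* (l ℕ.* s ℕ.+ σ) ≡ l ℕ.* (k ℕ.* s ℕ.+ ρ)
cross-difference k l s {ρ} {σ} kσ≤lρ = begin
  (l ℕ.* ρ ℕ.∸ k ℕ.* σ) ℕ.+ k ℕ.* (l ℕ.* s ℕ.+ σ)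
    ≡⟨ solve 5 (λ d k l s σ → d :+ k :* (l :* s :+ σ) := (d :+ k :* σ) :+ l :* (k :* s)) ≡.refl (l ℕ.* ρ ℕ.∸ k ℕ.* σ) k l s σ ⟩
  ((l ℕ.* ρ ℕ.∸ k ℕ.* σ) ℕ.+ k ℕ.* σ) ℕ.+ l ℕ.* (k ℕ.* s)
    ≡⟨ ≡.cong (ℕ._+ l ℕ.* (k ℕ.* s)) (ℕ.m∸n+n≡m kσ≤lρ) ⟩
  l ℕ.* ρ ℕ.+ l ℕ.* (k ℕ.* s)
    ≡⟨ solve 4 (λ k l s ρ → l :* ρ :+ l :* (k :* s) := l :* (k :* s :+ ρ)) ≡.refl k l s ρ ⟩
  l ℕ.* (k ℕ.* s ℕ.+ ρ) ∎
  where
  open ≡.≡-Reasoning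
  open ℕ.+-*-Solver using (solve; _:*_; _:+_; _:=_)

module Improvement (R : CompleteOrderedField) {n : ℕ}
  (i α : Vector (CompleteOrderedField.ℝ R) n) (weight : RealAnalysis.IsWeightVector R i) where

  open OrderedField R
  open RealPowers R
  open Approximation R
  open Cells R α
  open Solver using (solve; _:+_; _:*_; _:-_; _:=_)

  private
    0≤i : ∀ j → 0# ≤ i j
    0≤i j = proj₁ (proj₁ weight j)

    i≤1 : ∀ j → i j ≤ 1#
    i≤1 j = proj₂ (proj₁ weight j)

  fromℕ-∏-≤ : ∀ {n} a (M : Vector ℕ n) (x : Vector ℝ n) → (∀ j → fromℕ (M j) ≤ fromℕ a * x j) →
              fromℕ (∏ M) ≤ fromℕ (a ℕ.^ n) * foldr _*_ 1# x
  fromℕ-∏-≤ {zero}  a M x _    = inj₂ (sym (*-identityʳ _))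
  fromℕ-∏-≤ {suc n} a M x M≤ax = begin
    fromℕ (M zero ℕ.* ∏ (tail M))                   ≈⟨ fromℕ-homo-* (M zero) _ ⟩
    fromℕ (M zero) * fromℕ (∏ (tail M))             ≤⟨ *-mono-≤ (0≤fromℕ (M zero)) (≤-trans (0≤fromℕ (∏ (tail M))) ih) (M≤ax zero) ih ⟩
    (fromℕ a * x zero) * (fromℕ (a ℕ.^ n) * P)      ≈⟨ identity (fromℕ a) (x zero) (fromℕ (a ℕ.^ n)) P ⟩
    (fromℕ a * fromℕ (a ℕ.^ n)) * (x zero * P)      ≈⟨ *-congʳ (fromℕ-homo-* a (a ℕ.^ n)) ⟨
    fromℕ (a ℕ.^ suc n) * (x zero * P)              ∎
    where
    P = foldr _*_ 1# (tail x)
    ih : fromℕ (∏ (tail M)) ≤ fromℕ (a ℕ.^ n) * P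
    ih = fromℕ-∏-≤ a (tail M) (tail x) (M≤ax ∘ suc)
    identity : ∀ a x b p → (a * x) * (b * p) ≈ (a * b) * (x * p)
    identity = solve 4 (λ a x b p → (a :* x) :* (b :* p) := (a :* b) :* (x :* p)) refl

  combine-dev : ∀ d k₁ q₁ k₂ q₂ (p₁ p₂ : Vector ℤ n) j → d ℕ.+ k₂ ℕ.* q₂ ≡ k₁ ℕ.* q₁ →
    dev d (λ j → + k₁ ℤ.* p₁ j ℤ.- + k₂ ℤ.* p₂ j) j ≈
    fromℕ k₁ * dev q₁ p₁ j - fromℕ k₂ * dev q₂ p₂ j
  combine-dev d k₁ q₁ k₂ q₂ p₁ p₂ j eq = begin-equality
    fromℕ d * a - fromℤ (+ k₁ ℤ.* p₁ j ℤ.- + k₂ ℤ.* p₂ j)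
      ≈⟨ +-cong (*-congʳ d≈) (-‿cong (trans (fromℤ-homo-+ (+ k₁ ℤ.* p₁ j) (ℤ.- (+ k₂ ℤ.* p₂ j)))
           (+-cong (fromℤ-homo-* (+ k₁) (p₁ j)) (trans (fromℤ-neg (+ k₂ ℤ.* p₂ j)) (-‿cong (fromℤ-homo-* (+ k₂) (p₂ j))))))) ⟩
    (fromℕ k₁ * fromℕ q₁ - fromℕ k₂ * fromℕ q₂) * a - (fromℕ k₁ * fromℤ (p₁ j) - fromℕ k₂ * fromℤ (p₂ j))
      ≈⟨ identity (fromℕ k₁) (fromℕ q₁) (fromℕ k₂) (fromℕ q₂) a (fromℤ (p₁ j)) (fromℤ (p₂ j)) ⟩
    fromℕ k₁ * dev q₁ p₁ j - fromℕ k₂ * dev q₂ p₂ j ∎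
    where
    a = α j
    d≈ : fromℕ d ≈ fromℕ k₁ * fromℕ q₁ - fromℕ k₂ * fromℕ q₂
    d≈ = begin-equality
      fromℕ d                                                        ≈⟨ [x+y]-y≈x _ _ ⟨
      (fromℕ d + fromℕ k₂ * fromℕ q₂) - fromℕ k₂ * fromℕ q₂          ≈⟨ +-congʳ (+-congˡ (fromℕ-homo-* k₂ q₂)) ⟨
      (fromℕ d + fromℕ (k₂ ℕ.* q₂)) - fromℕ k₂ * fromℕ q₂            ≈⟨ +-congʳ (fromℕ-homo-+ d (k₂ ℕ.* q₂)) ⟨
      fromℕ (d ℕ.+ k₂ ℕ.* q₂) - fromℕ k₂ * fromℕ q₂                  ≡⟨ ≡.cong (λ m → fromℕ m - fromℕ k₂ * fromℕ q₂) eq ⟩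
      fromℕ (k₁ ℕ.* q₁) - fromℕ k₂ * fromℕ q₂                        ≈⟨ +-congʳ (fromℕ-homo-* k₁ q₁) ⟩
      fromℕ k₁ * fromℕ q₁ - fromℕ k₂ * fromℕ q₂                      ∎
    identity : ∀ k q l r a p s →
      (k * q - l * r) * a - (k * p - l * s) ≈ k * (q * a - p) - l * (r * a - s)
    identity = solve 7 (λ k q l r a p s → (k :* q :- l :* r) :* a :- (k :* p :- l :* s) :=
                                          k :* (q :* a :- p) :- l :* (r :* a :- s)) refl

  module _ (Q : ℕ) .{{_ : NonZero Q}} where

    private
      X : Vector ℝ n
      X j = Q ^ᵃ i j

      0≤X : ∀ j → 0# ≤ X j
      0≤X j = 0≤^ᵃ Q (i j)

    -- As the weights add up to 1, the product of the `X j` is at most `Q`.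
    ∏-≤ : ∀ a (M : Vector ℕ n) → (∀ j → fromℕ (M j) ≤ fromℕ a * X j) → ∏ M ℕ.≤ a ℕ.^ n ℕ.* Q
    ∏-≤ a M M≤aX = fromℕ-cancel-≤ (begin
      fromℕ (∏ M)                              ≤⟨ fromℕ-∏-≤ a M X M≤aX ⟩
      fromℕ (a ℕ.^ n) * foldr _*_ 1# X         ≤⟨ *-monoʳ-≤ (0≤fromℕ (a ℕ.^ n)) (product-^ᵃ-≤ Q 0≤i) ⟩
      fromℕ (a ℕ.^ n) * Q ^ᵃ sum i             ≤⟨ *-monoʳ-≤ (0≤fromℕ (a ℕ.^ n)) (^ᵃ-≤-base Q (sum-nonNeg 0≤i) (inj₂ (proj₂ weight))) ⟩
      fromℕ (a ℕ.^ n) * fromℕ Q                ≈⟨ fromℕ-homo-* (a ℕ.^ n) Q ⟨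
      fromℕ (a ℕ.^ n ℕ.* Q)                    ∎)

    gridSizes : ∀ a .{{_ : NonZero a}} → ∃ λ (M : Vector ℕ n) → (∀ j → NonZero (M j)) ×
      (∀ j → fromℕ a * X j ≤ fromℕ (M j)) × (∀ j → fromℕ (M j) ≤ fromℕ (suc a) * X j)
    gridSizes a = (λ j → proj₁ (size j)) , (λ j → proj₁ (proj₂ (size j)))
      , (λ j → proj₁ (proj₂ (proj₂ (size j))))
      , λ j → begin
          fromℕ (proj₁ (size j))     ≤⟨ proj₂ (proj₂ (proj₂ (size j))) ⟩
          -- The rounding error 1 is absorbed by one more multiple of `X j`, which is at least 1.
          1# + fromℕ a * X j         ≤⟨ +-monoˡ-≤ _ (1≤^ᵃ Q (0≤i j)) ⟩
          X j + fromℕ a * X j        ≈⟨ +-congʳ (*-identityˡ (X j)) ⟨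
          1# * X j + fromℕ a * X j   ≈⟨ distribʳ (X j) 1# (fromℕ a) ⟨
          fromℕ (suc a) * X j        ∎
      where
      size : ∀ j → ∃ λ m → NonZero m × fromℕ a * X j ≤ fromℕ m × fromℕ m ≤ 1# + fromℕ a * X j
      size j = ceiling (begin
        1#              ≈⟨ *-identityˡ 1# ⟨
        1# * 1#         ≤⟨ *-mono-≤ (<⇒≤ 0<1) (0≤X j) (1≤fromℕ a) (1≤^ᵃ Q (0≤i j)) ⟩
        fromℕ a * X j   ∎)

    Approximates : ℕ → ℕ → Vector ℤ n → Set
    Approximates h q p = ∀ j → fromℕ h * (X j * ∣ dev q p j ∣) ≤ 1#

    0≤Xdev : ∀ q p j → 0# ≤ X j * ∣ dev q p j ∣
    0≤Xdev q p j = *-nonNeg (0≤X j) (0≤∣x∣ _)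

    approximates-≤ : ∀ {h h′ q p} → h ℕ.≤ h′ → Approximates h′ q p → Approximates h q p
    approximates-≤ {q = q} {p} h≤h′ approx j =
      ≤-trans (*-monoˡ-≤ (0≤Xdev q p j) (fromℕ-mono-≤ h≤h′)) (approx j)

    weighted-dirichlet : ∀ h .{{_ : NonZero h}} →
      ∃ λ q → ∃ λ p → 1 ℕ.≤ q × q ℕ.≤ suc h ℕ.^ n ℕ.* Q × Approximates h q p
    weighted-dirichlet h = conclude (gridSizes h)
      where
      conclude : (∃ λ (M : Vector ℕ n) → (∀ j → NonZero (M j)) ×
          (∀ j → fromℕ h * X j ≤ fromℕ (M j)) × (∀ j → fromℕ (M j) ≤ fromℕ (suc h) * X j)) →
        ∃ λ q → ∃ λ p → 1 ℕ.≤ q × q ℕ.≤ suc h ℕ.^ n ℕ.* Q × Approximates h q p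
      conclude (M , M≢0 , hX≤M , M≤[1+h]X) = q , p , proj₁ bounds
        , ℕ.≤-trans (proj₁ (proj₂ bounds)) (∏-≤ (suc h) M M≤[1+h]X)
        , λ j → begin
            fromℕ h * (X j * ∣ dev q p j ∣)    ≈⟨ *-assoc _ _ _ ⟨
            (fromℕ h * X j) * ∣ dev q p j ∣    ≤⟨ *-monoˡ-≤ (0≤∣x∣ _) (hX≤M j) ⟩
            fromℕ (M j) * ∣ dev q p j ∣        ≤⟨ a∣x∣≤∣ax∣ (0≤fromℕ (M j)) _ ⟩
            ∣ fromℕ (M j) * dev q p j ∣        <⟨ proj₂ (proj₂ bounds) j ⟩
            1#                                 ∎
        where
        found = dirichlet α M M≢0
        q = proj₁ found
        p = proj₁ (proj₂ found)
        bounds : 1 ℕ.≤ q × q ℕ.≤ ∏ M × ∀ j → ∣ fromℕ (M j) * dev q p j ∣ < 1#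
        bounds = proj₂ (proj₂ found)

    -- Failure at `Q` of the constant `(1 + l) / (2 + l)`, with denominators cleared.
    Unimprovable : ℕ → Set
    Unimprovable l = ∀ q p → 1 ℕ.≤ q → q ℕ.≤ Q →
      ¬ (∀ j → fromℕ (2 ℕ.+ l) * (X j * ∣ dev q p j ∣) < fromℕ (1 ℕ.+ l))

    -- The sides `M j` lie between `2 + L` and `3 + L` times `X j`. The lower bound turns
    -- unimprovability into isolation of the cubes. As `3 + L` is `3 * suc g`, the upper bound
    -- allows at most `3 ^ n * suc g ^ n * Q` cells, while the cubes fill `suc Q * 3 ^ n * g ^ n`.
    -- The first hypothesis makes the difference small.
    nearly-multiple : ∀ {K r} g₀ → let g = suc g₀ in
      (K ℕ.* r ℕ.* 3 ℕ.^ n) ℕ.* suc g ℕ.^ n ℕ.≤ suc (K ℕ.* r ℕ.* 3 ℕ.^ n) ℕ.* g ℕ.^ n →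
      Unimprovable (3 ℕ.* g) →
      ∀ {q p} → 1 ℕ.≤ q → q ℕ.≤ K ℕ.* Q → Approximates 6 q p →
      ∃ λ k → ∃ λ ρ → 1 ℕ.≤ k × k ℕ.≤ K × q ≡ k ℕ.* suc Q ℕ.+ ρ × r ℕ.* ρ ℕ.≤ Q
    nearly-multiple {K} {r} g₀ growth unimprovable {q} {p} 1≤q q≤KQ approx =
      k , ρ , 1≤k , k≤K , q≡ , remainder-bound {{ℕ.m^n≢0 g n}} k≤K (ℕ.^-monoˡ-≤ n (ℕ.n≤1+n g)) growth packed
      where
      g = suc g₀
      L = 3 ℕ.* g
      sizes = gridSizes (2 ℕ.+ L)
      M = proj₁ sizes
      M≢0 = proj₁ (proj₂ sizes)
      aX≤M : ∀ j → fromℕ (2 ℕ.+ L) * X j ≤ fromℕ (M j)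
      aX≤M = proj₁ (proj₂ (proj₂ sizes))
      M≤[1+a]X : ∀ j → fromℕ (M j) ≤ fromℕ (3 ℕ.+ L) * X j
      M≤[1+a]X = proj₂ (proj₂ (proj₂ sizes))

      isolated : ∀ d p → 1 ℕ.≤ d → d ℕ.≤ Q → ¬ (∀ j → ∣ fromℕ (M j) * dev d p j ∣ < fromℕ (suc L))
      isolated d p 1≤d d≤Q small = unimprovable d p 1≤d d≤Q λ j → begin-strict
        fromℕ (2 ℕ.+ L) * (X j * ∣ dev d p j ∣)    ≈⟨ *-assoc _ _ _ ⟨
        (fromℕ (2 ℕ.+ L) * X j) * ∣ dev d p j ∣    ≤⟨ *-monoˡ-≤ (0≤∣x∣ _) (aX≤M j) ⟩
        fromℕ (M j) * ∣ dev d p j ∣                ≤⟨ a∣x∣≤∣ax∣ (0≤fromℕ (M j)) _ ⟩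
        ∣ fromℕ (M j) * dev d p j ∣                <⟨ small j ⟩
        fromℕ (suc L)                              ∎

      L<M : ∀ j → L ℕ.< M j
      L<M j = ℕ.<⇒≤ (fromℕ-cancel-≤ (begin
        fromℕ (2 ℕ.+ L)          ≈⟨ *-identityʳ _ ⟨
        fromℕ (2 ℕ.+ L) * 1#     ≤⟨ *-monoʳ-≤ (0≤fromℕ (2 ℕ.+ L)) (1≤^ᵃ Q (0≤i j)) ⟩
        fromℕ (2 ℕ.+ L) * X j    ≤⟨ aX≤M j ⟩
        fromℕ (M j)              ∎))

      -- The constant 6 comes from here: it turns the side bound `3 * suc g` into a displacement of
      -- at most `g`, since `3 * suc g ≤ 6 * g`.
      near : ∀ j → ∣ fromℕ (M j) * dev q p j ∣ ≤ fromℕ g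
      near j = *-cancelˡ-≤ (fromℕ-pos 6) (begin
        fromℕ 6 * ∣ fromℕ (M j) * dev q p j ∣          ≤⟨ *-monoʳ-≤ (0≤fromℕ 6) (∣ax∣≤a∣x∣ (0≤fromℕ (M j)) _) ⟩
        fromℕ 6 * (fromℕ (M j) * δ)                    ≤⟨ *-monoʳ-≤ (0≤fromℕ 6) (*-monoˡ-≤ (0≤∣x∣ _) (M≤[1+a]X j)) ⟩
        fromℕ 6 * ((fromℕ (3 ℕ.+ L) * X j) * δ)        ≈⟨ identity (fromℕ 6) (fromℕ (3 ℕ.+ L)) (X j) δ ⟩
        fromℕ (3 ℕ.+ L) * (fromℕ 6 * (X j * δ))        ≤⟨ *-monoʳ-≤ (0≤fromℕ (3 ℕ.+ L)) (approx j) ⟩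
        fromℕ (3 ℕ.+ L) * 1#                           ≈⟨ *-identityʳ _ ⟩
        fromℕ (3 ℕ.+ L)                                ≤⟨ fromℕ-mono-≤ (3g+3≤6g g₀) ⟩
        fromℕ (6 ℕ.* g)                                ≈⟨ fromℕ-homo-* 6 g ⟩
        fromℕ 6 * fromℕ g                              ∎)
        where
        δ = ∣ dev q p j ∣
        identity : ∀ s a x δ → s * ((a * x) * δ) ≈ a * (s * (x * δ))
        identity = solve 4 (λ s a x δ → s :* ((a :* x) :* δ) := a :* (s :* (x :* δ))) refl

      k = q ℕ./ suc Q
      ρ = q ℕ.% suc Q
      q≡ : q ≡ k ℕ.* suc Q ℕ.+ ρ
      q≡ = ≡.trans (ℕ.m≡m%n+[m/n]*n q (suc Q)) (ℕ.+-comm ρ (k ℕ.* suc Q))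
      ρ≤Q : ρ ℕ.≤ Q
      ρ≤Q = ℕ.<⇒≤pred (ℕ.m%n<n q (suc Q))
      k≤K : k ℕ.≤ K
      k≤K = ℕ.*-cancelʳ-≤ k K (suc Q) (ℕ.≤-trans (ℕ.m/n*n≤m q (suc Q))
        (ℕ.≤-trans q≤KQ (ℕ.*-monoʳ-≤ K (ℕ.n≤1+n Q))))
      -- For `k = 0` the time `q` would be at most `Q` and would itself violate `isolated`.
      1≤k : 1 ℕ.≤ k
      1≤k = ℕ.m≥n⇒m/n>0 (ℕ.≰⇒> λ q≤Q → isolated q p 1≤q q≤Q λ j → begin-strict
        ∣ fromℕ (M j) * dev q p j ∣    ≤⟨ near j ⟩
        fromℕ g                        ≤⟨ fromℕ-mono-≤ (ℕ.m≤m+n g (2 ℕ.* g)) ⟩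
        fromℕ L                        <⟨ x<1+x _ ⟩
        fromℕ (suc L)                  ∎)

      ∏M≤ : ∏ M ℕ.≤ 3 ℕ.^ n ℕ.* suc g ℕ.^ n ℕ.* Q
      ∏M≤ = ℕ.≤-trans (∏-≤ (3 ℕ.+ L) M M≤[1+a]X) (ℕ.*-monoˡ-≤ Q (ℕ.≤-reflexive
        (≡.trans (≡.cong (ℕ._^ n) (≡.sym (ℕ.*-suc 3 g))) (ℕ^-distribʳ-* n 3 (suc g)))))

      packed : ρ ℕ.* g ℕ.^ n ℕ.+ k ℕ.* (suc Q ℕ.* (3 ℕ.^ n ℕ.* g ℕ.^ n)) ℕ.≤
               k ℕ.* (3 ℕ.^ n ℕ.* suc g ℕ.^ n ℕ.* Q)
      packed = ℕ.≤-trans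
        (≡.subst (λ x → ρ ℕ.* g ℕ.^ n ℕ.+ k ℕ.* (suc Q ℕ.* x) ℕ.≤ k ℕ.* ∏ M) (ℕ^-distribʳ-* n 3 g)
          (Packing.packing-bound M M≢0 g Q L<M isolated k ρ ρ≤Q p
            (≡.subst (λ q → ∀ j → ∣ fromℕ (M j) * dev q p j ∣ ≤ fromℕ g) q≡ near)))
        (ℕ.*-monoʳ-≤ k ∏M≤)

    module _ {D : ℕ} (uniform : ∀ q .{{_ : NonZero q}} p →
        ∃ λ j → 0# < i j × 1# ≤ fromℕ D * (q ^ᵃ i j * ∣ dev q p j ∣))
      {K κ : ℕ} (κ≤Q : κ ℕ.≤ Q)
      (ratio : ∀ j → 0# < i j → ∀ {q q′} .{{_ : NonZero q}} .{{_ : NonZero q′}} → κ ℕ.* q ℕ.≤ q′ →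
               fromℕ (suc (D ℕ.* (K ℕ.+ K))) * q ^ᵃ i j ≤ q′ ^ᵃ i j) where

      private
        A : ℕ
        A = suc (D ℕ.* (K ℕ.+ K))

      combination-≤ : ∀ {d k₁ q₁ k₂ q₂} {p₁ p₂ : Vector ℤ n} → d ℕ.+ k₂ ℕ.* q₂ ≡ k₁ ℕ.* q₁ →
        k₁ ℕ.≤ K → k₂ ℕ.≤ K → Approximates 1 q₁ p₁ → Approximates 1 q₂ p₂ → ∀ j →
        X j * ∣ dev d (λ j → + k₁ ℤ.* p₁ j ℤ.- + k₂ ℤ.* p₂ j) j ∣ ≤ fromℕ (K ℕ.+ K)
      combination-≤ {d} {k₁} {q₁} {k₂} {q₂} {p₁} {p₂} eq k₁≤K k₂≤K approx₁ approx₂ j = begin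
        X j * ∣ dev d (λ j → + k₁ ℤ.* p₁ j ℤ.- + k₂ ℤ.* p₂ j) j ∣
          ≈⟨ *-congˡ (∣∣-cong (combine-dev d k₁ q₁ k₂ q₂ p₁ p₂ j eq)) ⟩
        X j * ∣ fromℕ k₁ * dev q₁ p₁ j - fromℕ k₂ * dev q₂ p₂ j ∣
          ≤⟨ *-monoʳ-≤ (0≤X j) (≤-trans (∣x-y∣≤∣x∣+∣y∣ _ _) (+-mono-≤ (∣ax∣≤a∣x∣ (0≤fromℕ k₁) _) (∣ax∣≤a∣x∣ (0≤fromℕ k₂) _))) ⟩
        X j * (fromℕ k₁ * δ₁ + fromℕ k₂ * δ₂)
          ≈⟨ identity (X j) (fromℕ k₁) δ₁ (fromℕ k₂) δ₂ ⟩
        fromℕ k₁ * (X j * δ₁) + fromℕ k₂ * (X j * δ₂)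
          ≤⟨ +-mono-≤ (term k₁ q₁ p₁ k₁≤K approx₁) (term k₂ q₂ p₂ k₂≤K approx₂) ⟩
        fromℕ K + fromℕ K        ≈⟨ fromℕ-homo-+ K K ⟨
        fromℕ (K ℕ.+ K)          ∎
        where
        δ₁ = ∣ dev q₁ p₁ j ∣
        δ₂ = ∣ dev q₂ p₂ j ∣
        identity : ∀ x k δ l ε → x * (k * δ + l * ε) ≈ k * (x * δ) + l * (x * ε)
        identity = solve 5 (λ x k δ l ε → x :* (k :* δ :+ l :* ε) := k :* (x :* δ) :+ l :* (x :* ε)) refl
        term : ∀ k q p → k ℕ.≤ K → Approximates 1 q p → fromℕ k * (X j * ∣ dev q p j ∣) ≤ fromℕ K
        term k q p k≤K approx = begin
          fromℕ k * (X j * ∣ dev q p j ∣)  ≤⟨ *-mono-≤ (0≤fromℕ k) (<⇒≤ 0<1) (fromℕ-mono-≤ k≤K) (begin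
              X j * ∣ dev q p j ∣             ≈⟨ *-identityˡ _ ⟨
              1# * (X j * ∣ dev q p j ∣)      ≈⟨ *-congʳ fromℕ-1 ⟨
              fromℕ 1 * (X j * ∣ dev q p j ∣) ≤⟨ approx j ⟩
              1#                              ∎) ⟩
          fromℕ K * 1#                     ≈⟨ *-identityʳ _ ⟩
          fromℕ K                          ∎

      -- At the coordinate given by `uniform`, `d ^ᵃ i j` is at most `X j / A`. So the error
      -- weighted by `d ^ᵃ i j` is at most `2 * K / A`, which is less than `1 / D` and contradicts
      -- `uniform`.
      no-short-vector : ∀ {d p} → 1 ℕ.≤ d → κ ℕ.* d ℕ.≤ Q →
        ¬ (∀ j → X j * ∣ dev d p j ∣ ≤ fromℕ (K ℕ.+ K))
      no-short-vector {suc d₀} {p} _ κd≤Q short = ℕ.1+n≰n (fromℕ-cancel-≤ {A} {D ℕ.* (K ℕ.+ K)} (begin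
        fromℕ A                                      ≈⟨ *-identityʳ _ ⟨
        fromℕ A * 1#                                 ≤⟨ *-monoʳ-≤ (0≤fromℕ A) 1≤DXδ ⟩
        fromℕ A * (fromℕ D * (d ^ᵃ i j * δ))         ≈⟨ identity (fromℕ A) (fromℕ D) (d ^ᵃ i j) δ ⟩
        fromℕ D * ((fromℕ A * d ^ᵃ i j) * δ)         ≤⟨ *-monoʳ-≤ (0≤fromℕ D) (*-monoˡ-≤ (0≤∣x∣ _) (ratio j 0<i κd≤Q)) ⟩
        fromℕ D * (X j * δ)                          ≤⟨ *-monoʳ-≤ (0≤fromℕ D) (short j) ⟩
        fromℕ D * fromℕ (K ℕ.+ K)                    ≈⟨ fromℕ-homo-* D (K ℕ.+ K) ⟨
        fromℕ (D ℕ.* (K ℕ.+ K))                      ∎))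
        where
        d = suc d₀
        j = proj₁ (uniform d p)
        0<i = proj₁ (proj₂ (uniform d p))
        1≤DXδ = proj₂ (proj₂ (uniform d p))
        δ = ∣ dev d p j ∣
        identity : ∀ a b x δ → a * (b * (x * δ)) ≈ b * ((a * x) * δ)
        identity = solve 4 (λ a b x δ → a :* (b :* (x :* δ)) := b :* ((a :* x) :* δ)) refl

      -- If k₁ q₁ = k₂ q₂ then the two vectors are parallel, so that the first
      -- is as short as the second.
      no-parallel : ∀ {k₁ q₁ k₂ q₂ h K₁} .{{_ : NonZero q₁}} .{{_ : NonZero K₁}} {p₁ p₂ : Vector ℤ n} →
        k₂ ℕ.* q₂ ≡ k₁ ℕ.* q₁ → 1 ℕ.≤ k₁ → k₁ ℕ.≤ K → k₂ ℕ.≤ K → k₂ ℕ.≤ K₁ → q₁ ℕ.≤ K₁ ℕ.* Q →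
        1 ℕ.≤ h → D ℕ.* (K₁ ℕ.* K₁) ℕ.< h → Approximates 1 q₁ p₁ → ¬ Approximates h q₂ p₂
      no-parallel {k₁} {q₁} {k₂} {q₂} {h} {K₁} {p₁} {p₂} eq 1≤k₁ k₁≤K k₂≤K k₂≤K₁ q₁≤K₁Q 1≤h DK₁²<h approx₁ approx₂ =
        ℕ.<⇒≱ DK₁²<h (fromℕ-cancel-≤ (begin
          fromℕ h                                                ≈⟨ *-identityʳ _ ⟨
          fromℕ h * 1#                                           ≤⟨ *-monoʳ-≤ (0≤fromℕ h) 1≤DXδ ⟩
          fromℕ h * (fromℕ D * (q₁ ^ᵃ i j * δ₁))                 ≤⟨ *-monoʳ-≤ (0≤fromℕ h) (*-monoʳ-≤ (0≤fromℕ D) (*-monoˡ-≤ 0≤δ₁ (^ᵃ-≤-multiple (0≤i j) (i≤1 j) q₁≤K₁Q))) ⟩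
          fromℕ h * (fromℕ D * ((fromℕ K₁ * X j) * δ₁))          ≈⟨ identity₁ (fromℕ h) (fromℕ D) (fromℕ K₁) (X j) δ₁ ⟩
          (fromℕ D * fromℕ K₁) * (fromℕ h * (X j * δ₁))          ≤⟨ *-monoʳ-≤ (*-nonNeg (0≤fromℕ D) (0≤fromℕ K₁)) hXδ₁≤K₁ ⟩
          (fromℕ D * fromℕ K₁) * fromℕ K₁                        ≈⟨ *-assoc _ _ _ ⟩
          fromℕ D * (fromℕ K₁ * fromℕ K₁)                        ≈⟨ trans (fromℕ-homo-* D (K₁ ℕ.* K₁)) (*-congˡ (fromℕ-homo-* K₁ K₁)) ⟨
          fromℕ (D ℕ.* (K₁ ℕ.* K₁))                              ∎))
        where
        j = proj₁ (uniform q₁ p₁)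
        0<i = proj₁ (proj₂ (uniform q₁ p₁))
        1≤DXδ = proj₂ (proj₂ (uniform q₁ p₁))
        δ₁ = ∣ dev q₁ p₁ j ∣
        δ₂ = ∣ dev q₂ p₂ j ∣
        0≤δ₁ : 0# ≤ δ₁
        0≤δ₁ = 0≤∣x∣ _
        identity₁ : ∀ h b k x δ → h * (b * ((k * x) * δ)) ≈ (b * k) * (h * (x * δ))
        identity₁ = solve 5 (λ h b k x δ → h :* (b :* ((k :* x) :* δ)) := (b :* k) :* (h :* (x :* δ))) refl
        identity₂ : ∀ h x k δ → h * (x * (k * δ)) ≈ k * (h * (x * δ))
        identity₂ = solve 4 (λ h x k δ → h :* (x :* (k :* δ)) := k :* (h :* (x :* δ))) refl
        p : Vector ℤ n
        p j = + k₁ ℤ.* p₁ j ℤ.- + k₂ ℤ.* p₂ j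
        -- Here `ratio` is applied to the base 1, so that `X j` is at least `A`. The integer `p j`
        -- times `X j` is at most `2 * K` in absolute value, hence `p j` vanishes.
        K+K<X : fromℕ (K ℕ.+ K) * fromℕ D < X j
        K+K<X = begin-strict
          fromℕ (K ℕ.+ K) * fromℕ D        ≈⟨ trans (*-comm _ _) (sym (fromℕ-homo-* D (K ℕ.+ K))) ⟩
          fromℕ (D ℕ.* (K ℕ.+ K))          <⟨ x<1+x _ ⟩
          fromℕ A                          ≈⟨ *-identityʳ _ ⟨
          fromℕ A * 1#                     ≤⟨ *-monoʳ-≤ (0≤fromℕ A) (1≤^ᵃ 1 (0≤i j)) ⟩
          fromℕ A * 1 ^ᵃ i j               ≤⟨ ratio j 0<i (≡.subst (ℕ._≤ Q) (≡.sym (ℕ.*-identityʳ κ)) κ≤Q) ⟩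
          X j                              ∎
        1≤D : 1 ℕ.≤ D
        1≤D = ℕ.n≢0⇒n>0 λ { ≡.refl → ≤⇒≯ 1≤DXδ (begin-strict
          0# * (q₁ ^ᵃ i j * δ₁)   ≈⟨ zeroˡ _ ⟩
          0#                      <⟨ 0<1 ⟩
          1#                      ∎) }
        ∣dev-0∣<1 : ∣ dev 0 p j ∣ < 1#
        ∣dev-0∣<1 = *-cancelˡ-< (0≤X j) (begin-strict
          X j * ∣ dev 0 p j ∣          ≤⟨ combination-≤ {0} {k₁} {q₁} {k₂} {q₂} {p₁} {p₂} eq k₁≤K k₂≤K approx₁ (approximates-≤ {q = q₂} {p₂} 1≤h approx₂) j ⟩
          fromℕ (K ℕ.+ K)              ≈⟨ *-identityʳ _ ⟨
          fromℕ (K ℕ.+ K) * 1#         ≤⟨ *-monoʳ-≤ (0≤fromℕ (K ℕ.+ K)) (1≤fromℕ D {{ℕ.>-nonZero 1≤D}}) ⟩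
          fromℕ (K ℕ.+ K) * fromℕ D    <⟨ K+K<X ⟩
          X j                          ≈⟨ *-identityʳ _ ⟨
          X j * 1#                     ∎)
        p≡0 : p j ≡ + 0
        p≡0 = ∣dev-0∣<1⇒≡0 p j ∣dev-0∣<1
        parallel : fromℕ k₁ * dev q₁ p₁ j ≈ fromℕ k₂ * dev q₂ p₂ j
        parallel = begin-equality
          u              ≈⟨ [x-y]+y≈x u w ⟨
          (u - w) + w    ≈⟨ +-congʳ (combine-dev 0 k₁ q₁ k₂ q₂ p₁ p₂ j eq) ⟨
          dev 0 p j + w  ≈⟨ +-congʳ (trans (dev-0 p j) (trans (-‿cong (reflexive (≡.cong fromℤ p≡0))) -0#≈0#)) ⟩
          0# + w         ≈⟨ +-identityˡ w ⟩
          w              ∎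
          where
          u = fromℕ k₁ * dev q₁ p₁ j
          w = fromℕ k₂ * dev q₂ p₂ j
        hXδ₁≤K₁ : fromℕ h * (X j * δ₁) ≤ fromℕ K₁
        hXδ₁≤K₁ = begin
          fromℕ h * (X j * δ₁)                          ≈⟨ *-identityˡ _ ⟨
          1# * (fromℕ h * (X j * δ₁))                   ≤⟨ *-monoˡ-≤ (*-nonNeg (0≤fromℕ h) (0≤Xdev q₁ p₁ j)) (1≤fromℕ k₁ {{ℕ.>-nonZero 1≤k₁}}) ⟩
          fromℕ k₁ * (fromℕ h * (X j * δ₁))             ≈⟨ identity₂ (fromℕ h) (X j) (fromℕ k₁) δ₁ ⟨
          fromℕ h * (X j * (fromℕ k₁ * δ₁))             ≤⟨ *-monoʳ-≤ (0≤fromℕ h) (*-monoʳ-≤ (0≤X j) k₁δ₁≤k₂δ₂) ⟩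
          fromℕ h * (X j * (fromℕ k₂ * δ₂))             ≈⟨ identity₂ (fromℕ h) (X j) (fromℕ k₂) δ₂ ⟩
          fromℕ k₂ * (fromℕ h * (X j * δ₂))             ≤⟨ *-monoʳ-≤ (0≤fromℕ k₂) (approx₂ j) ⟩
          fromℕ k₂ * 1#                                 ≈⟨ *-identityʳ _ ⟩
          fromℕ k₂                                      ≤⟨ fromℕ-mono-≤ k₂≤K₁ ⟩
          fromℕ K₁                                      ∎
          where
          k₁δ₁≤k₂δ₂ : fromℕ k₁ * δ₁ ≤ fromℕ k₂ * δ₂
          k₁δ₁≤k₂δ₂ = begin
            fromℕ k₁ * δ₁                ≤⟨ a∣x∣≤∣ax∣ (0≤fromℕ k₁) _ ⟩
            ∣ fromℕ k₁ * dev q₁ p₁ j ∣   ≈⟨ ∣∣-cong parallel ⟩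
            ∣ fromℕ k₂ * dev q₂ p₂ j ∣   ≤⟨ ∣ax∣≤a∣x∣ (0≤fromℕ k₂) _ ⟩
            fromℕ k₂ * δ₂                ∎

  module _ {D : ℕ} (uniform : ∀ q .{{_ : NonZero q}} p →
      ∃ λ j → 0# < i j × 1# ≤ fromℕ D * (q ^ᵃ i j * ∣ dev q p j ∣)) where

    private
      -- K₁ bounds the multiplier of the coarse approximation, K that of both;
      -- h beats D K₁² in no-parallel, and A beats 2 D K in no-short-vector.
      K₁ h K A : ℕ
      K₁ = 7 ℕ.^ n
      h = 6 ℕ.+ D ℕ.* (K₁ ℕ.* K₁)
      K = K₁ ℕ.+ suc h ℕ.^ n
      A = suc (D ℕ.* (K ℕ.+ K))

      Ratio : ℕ → Fin n → Set
      Ratio m j = 0# < i j → ∀ {q q′} .{{_ : NonZero q}} .{{_ : NonZero q′}} → m ℕ.* q ℕ.≤ q′ →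
                  fromℕ A * q ^ᵃ i j ≤ q′ ^ᵃ i j

      ratioAt : ∀ j → ∃ λ m → Ratio m j
      ratioAt j = [ (λ 0<i → Product.map₂ (λ ratio _ → proj₂ ratio) (^ᵃ-unbounded-ratio 0<i A))
                  , (λ 0≈i → 0 , λ 0<i → contradiction 0<i (irrefl 0≈i)) ]′ (0≤i j)

      κ : ℕ
      κ = proj₁ (∃-upperBound (proj₁ ∘ ratioAt))

      ratio : ∀ j → Ratio κ j
      ratio j 0<i {q} κq≤q′ = proj₂ (ratioAt j) 0<i
        (ℕ.≤-trans (ℕ.*-monoˡ-≤ q (proj₂ (∃-upperBound (proj₁ ∘ ratioAt)) j)) κq≤q′)

      g₀ : ℕ
      g₀ = proj₁ (powers-nearly-equal (K ℕ.* (κ ℕ.* K) ℕ.* 3 ℕ.^ n) n)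

    gap : ℕ
    gap = 3 ℕ.* suc g₀

    threshold : ℕ
    threshold = κ

    module _ (Q : ℕ) .{{_ : NonZero Q}} (κ≤Q : κ ℕ.≤ Q) where

      private
        NearlyMultiple : ℕ → ℕ → ℕ → Set
        NearlyMultiple q k ρ = 1 ℕ.≤ k × k ℕ.≤ K × q ≡ k ℕ.* suc Q ℕ.+ ρ × (κ ℕ.* K) ℕ.* ρ ℕ.≤ Q

      -- The time of the combination is at most `K * ρ`, so the precision `κ * K` demanded in
      -- `NearlyMultiple` is what brings it into the range of `no-short-vector`. Being symmetric in
      -- the two approximations, it excludes both strict orders.
      remainders-≮ : ∀ {q p k ρ q′ p′ l σ} → NearlyMultiple q k ρ → NearlyMultiple q′ l σ →
        Approximates Q 1 q p → Approximates Q 1 q′ p′ → ¬ (k ℕ.* σ ℕ.< l ℕ.* ρ)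
      remainders-≮ {q} {p} {k} {ρ} {q′} {p′} {l} {σ} (_ , k≤K , q≡ , rρ≤Q) (_ , l≤K , q′≡ , _) approx approx′ kσ<lρ =
        no-short-vector Q {D} uniform {K} {κ} κ≤Q ratio {d} {λ j → + l ℤ.* p j ℤ.- + k ℤ.* p′ j}
          (ℕ.m<n⇒0<n∸m kσ<lρ)
          (ℕ.≤-trans (ℕ.*-monoʳ-≤ κ (ℕ.≤-trans (ℕ.m∸n≤m (l ℕ.* ρ) (k ℕ.* σ)) (ℕ.*-monoˡ-≤ ρ l≤K)))
            (ℕ.≤-trans (ℕ.≤-reflexive (≡.sym (ℕ.*-assoc κ K ρ))) rρ≤Q))
          (combination-≤ Q {D} uniform {K} {κ} κ≤Q ratio {d} {l} {q} {k} {q′} {p} {p′}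
            (≡.trans (≡.cong (λ q′ → d ℕ.+ k ℕ.* q′) q′≡) (≡.trans (cross-difference k l (suc Q) (ℕ.<⇒≤ kσ<lρ)) (≡.cong (l ℕ.*_) (≡.sym q≡))))
            l≤K k≤K approx approx′)
        where
        d = l ℕ.* ρ ℕ.∸ k ℕ.* σ

      refute : Unimprovable Q gap →
        (∃ λ q → ∃ λ p → 1 ℕ.≤ q × q ℕ.≤ K₁ ℕ.* Q × Approximates Q 6 q p) →
        ¬ (∃ λ q → ∃ λ p → 1 ℕ.≤ q × q ℕ.≤ suc h ℕ.^ n ℕ.* Q × Approximates Q h q p)
      refute unimprovable (q , p , 1≤q , q≤K₁Q , approx) (q′ , p′ , 1≤q′ , q′≤ , approx′) =
        compare-remainders (nearly q p 1≤q (ℕ.≤-trans q≤K₁Q (ℕ.*-monoˡ-≤ Q (ℕ.m≤m+n K₁ _))) approx)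
                           (nearly q′ p′ 1≤q′ (ℕ.≤-trans q′≤ (ℕ.*-monoˡ-≤ Q (ℕ.m≤n+m _ K₁)))
                             (approximates-≤ Q {6} {h} {q′} {p′} (ℕ.m≤m+n 6 (D ℕ.* (K₁ ℕ.* K₁))) approx′))
        where
        nearly : ∀ q p → 1 ℕ.≤ q → q ℕ.≤ K ℕ.* Q → Approximates Q 6 q p → ∃ λ k → ∃ λ ρ → NearlyMultiple q k ρ
        nearly q p = nearly-multiple Q {K} {κ ℕ.* K} g₀
          (proj₂ (powers-nearly-equal (K ℕ.* (κ ℕ.* K) ℕ.* 3 ℕ.^ n) n)) unimprovable {q} {p}
        compare-remainders : (∃ λ k → ∃ λ ρ → NearlyMultiple q k ρ) →
                             ¬ (∃ λ l → ∃ λ σ → NearlyMultiple q′ l σ)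
        compare-remainders (k , ρ , v@(_ , k≤K , q≡ , _)) (l , σ , w@(1≤l , l≤K , q′≡ , _)) =
          split (ℕ.<-cmp (k ℕ.* σ) (l ℕ.* ρ))
          where
          short : Approximates Q 1 q p
          short = approximates-≤ Q {1} {6} {q} {p} (s≤s z≤n) approx
          short′ : Approximates Q 1 q′ p′
          short′ = approximates-≤ Q {1} {h} {q′} {p′} (s≤s z≤n) approx′
          split : ¬ Tri (k ℕ.* σ ℕ.< l ℕ.* ρ) (k ℕ.* σ ≡ l ℕ.* ρ) (l ℕ.* ρ ℕ.< k ℕ.* σ)
          split (tri< kσ<lρ _ _) = remainders-≮ {q} {p} {k} {ρ} {q′} {p′} {l} {σ} v w short short′ kσ<lρ
          split (tri> _ _ lρ<kσ) = remainders-≮ {q′} {p′} {l} {σ} {q} {p} {k} {ρ} w v short′ short lρ<kσ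
          split (tri≈ _ kσ≡lρ _) =
            -- The coarse `q` takes the role of the first vector and the precise `q′` that of the
            -- second. The multiplier of `q′` is the `k` of the coarse one, bounded by `K₁` because
            -- `q ≤ K₁ * Q`.
            no-parallel Q {D} uniform {K} {κ} κ≤Q ratio {l} {q} {k} {q′} {h} {K₁} {{ℕ.>-nonZero 1≤q}} {{ℕ.m^n≢0 7 n}} {p} {p′}
              (≡.trans (≡.cong (k ℕ.*_) q′≡) (≡.trans parallel (≡.cong (l ℕ.*_) (≡.sym q≡))))
              1≤l l≤K k≤K
              (ℕ.*-cancelʳ-≤ k K₁ (suc Q) (ℕ.≤-trans (ℕ.m≤m+n _ ρ)
                (ℕ.≤-trans (ℕ.≤-reflexive (≡.sym q≡)) (ℕ.≤-trans q≤K₁Q (ℕ.*-monoʳ-≤ K₁ (ℕ.n≤1+n Q))))))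
              q≤K₁Q (s≤s z≤n) (s≤s (ℕ.m≤n+m (D ℕ.* (K₁ ℕ.* K₁)) 5)) short approx′
            where
            parallel : k ℕ.* (l ℕ.* suc Q ℕ.+ σ) ≡ l ℕ.* (k ℕ.* suc Q ℕ.+ ρ)
            parallel = ≡.trans (≡.cong (ℕ._+ k ℕ.* (l ℕ.* suc Q ℕ.+ σ)) (≡.sym (ℕ.m≤n⇒m∸n≡0 (ℕ.≤-reflexive (≡.sym kσ≡lρ)))))
              (cross-difference k l (suc Q) (ℕ.≤-reflexive kσ≡lρ))

      ¬unimprovable : ¬ Unimprovable Q gap
      ¬unimprovable unimprovable =
        refute unimprovable (weighted-dirichlet Q 6) (weighted-dirichlet Q h)

  -- Return to the definition of Dirichlet improvability

  module _ (l : ℕ) where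

    private
      inv = positiveInverse (fromℕ-pos (2 ℕ.+ l))
      0<inv : 0# < proj₁ inv
      0<inv = proj₁ (proj₂ inv)
      inv≈1 : fromℕ (2 ℕ.+ l) * proj₁ inv ≈ 1#
      inv≈1 = proj₂ (proj₂ inv)

    constant : ℝ
    constant = fromℕ (1 ℕ.+ l) * proj₁ inv

    0<constant : 0# < constant
    0<constant = *-pos (fromℕ-pos (1 ℕ.+ l)) 0<inv

    constant<1 : constant < 1#
    constant<1 = begin-strict
      fromℕ (1 ℕ.+ l) * proj₁ inv  <⟨ *-monoˡ-< 0<inv (x<1+x _) ⟩
      fromℕ (2 ℕ.+ l) * proj₁ inv  ≈⟨ inv≈1 ⟩
      1#                           ∎

    <constant : ∀ {x} → fromℕ (2 ℕ.+ l) * x < fromℕ (1 ℕ.+ l) → x < constant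
    <constant {x} bound = *-cancelˡ-< (0≤fromℕ (2 ℕ.+ l)) (begin-strict
      fromℕ (2 ℕ.+ l) * x                                <⟨ bound ⟩
      fromℕ (1 ℕ.+ l)                                    ≈⟨ *-identityʳ _ ⟨
      fromℕ (1 ℕ.+ l) * 1#                               ≈⟨ *-congˡ inv≈1 ⟨
      fromℕ (1 ℕ.+ l) * (fromℕ (2 ℕ.+ l) * proj₁ inv)    ≈⟨ identity _ _ _ ⟩
      fromℕ (2 ℕ.+ l) * constant                         ∎)
      where
      identity : ∀ a b c → a * (b * c) ≈ b * (a * c)
      identity = solve 3 (λ a b c → a :* (b :* c) := b :* (a :* c)) refl

    Solvable : ∀ Q .{{_ : NonZero Q}} → Set
    Solvable Q = ∃ λ q → 1 ℕ.≤ q × q ℕ.≤ Q × (∀ j → ‖ fromℕ q * α j ‖ < constant * Q ^ʳ (- i j))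

    -- The positive power of `Q` is moved across as the negative power of the definition by
    -- `1≤^ᵃ*^ᵃ-`.
    ¬solvable⇒unimprovable : ∀ Q .{{_ : NonZero Q}} → ¬ Solvable Q → Unimprovable Q l
    ¬solvable⇒unimprovable Q unsolvable q p 1≤q q≤Q small =
      unsolvable (q , 1≤q , q≤Q , λ j → begin-strict
        ‖ fromℕ q * α j ‖                          ≤⟨ ‖x‖≤∣x-k∣ _ (p j) ⟩
        ∣ dev q p j ∣                              ≈⟨ *-identityʳ _ ⟨
        ∣ dev q p j ∣ * 1#                         ≤⟨ *-monoʳ-≤ (0≤∣x∣ _) (1≤^ᵃ*^ᵃ- Q (0≤i j)) ⟩
        ∣ dev q p j ∣ * (Q ^ᵃ i j * Q ^ᵃ (- i j))  ≈⟨ identity _ _ _ ⟩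
        (Q ^ᵃ i j * ∣ dev q p j ∣) * Q ^ᵃ (- i j)  <⟨ *-monoˡ-< (0<^ᵃ- j) (<constant (small j)) ⟩
        constant * Q ^ᵃ (- i j)                    ≈⟨ *-congˡ (^ᵃ≈^ʳ Q (- i j)) ⟩
        constant * Q ^ʳ (- i j)                    ∎)
      where
      0<^ᵃ- : ∀ j → 0# < Q ^ᵃ (- i j)
      0<^ᵃ- j = *-cancelˡ-< (0≤^ᵃ Q (i j)) (begin-strict
        Q ^ᵃ i j * 0#            ≈⟨ zeroʳ _ ⟩
        0#                       <⟨ 0<1 ⟩
        1#                       ≤⟨ 1≤^ᵃ*^ᵃ- Q (0≤i j) ⟩
        Q ^ᵃ i j * Q ^ᵃ (- i j)  ∎)
      identity : ∀ δ x y → δ * (x * y) ≈ (x * δ) * y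
      identity = solve 3 (λ δ x y → δ :* (x :* y) := (x :* δ) :* y) refl

  eventually-¬unimprovable : Bad i α → ∃ λ l → ∃ λ Q₀ →
    ∀ Q .{{_ : NonZero Q}} → Q₀ ℕ.≤ Q → ¬ Unimprovable Q l
  eventually-¬unimprovable bad = conclude (bad⇒uniform {i = i} {α} (proj₁ weight) bad)
    where
    conclude : (∃ λ D → ∀ q .{{_ : NonZero q}} p →
        ∃ λ j → 0# < i j × 1# ≤ fromℕ D * (q ^ᵃ i j * ∣ dev q p j ∣)) →
      ∃ λ l → ∃ λ Q₀ → ∀ Q .{{_ : NonZero Q}} → Q₀ ℕ.≤ Q → ¬ Unimprovable Q l
    conclude (D , uniform) = gap {D} uniform , threshold {D} uniform , ¬unimprovable {D} uniform

  eventually-¬unimprovable⇒dirichletImprovable :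
    (∃ λ l → ∃ λ Q₀ → ∀ Q .{{_ : NonZero Q}} → Q₀ ℕ.≤ Q → ¬ Unimprovable Q l) →
    DirichletImprovable i α
  eventually-¬unimprovable⇒dirichletImprovable (l , Q₀ , ¬unimprovable) =
    constant l , 0<constant l , constant<1 l , Q₀ , solve-or-refute
    where
    solve-or-refute : ∀ Q .{{_ : NonZero Q}} → Q₀ ℕ.≤ Q → Solvable l Q
    -- The argument by contradiction is made for each `Q` separately; the constant and the threshold
    -- are already fixed.
    solve-or-refute Q Q₀≤Q = decidable-stable (excludedMiddle (Solvable l Q))
      λ unsolvable → ¬unimprovable Q Q₀≤Q (¬solvable⇒unimprovable l Q unsolvable)

theorem4p6 : (R : CompleteOrderedField) → let open RealAnalysis R in
    (n : ℕ) (i : Vector ℝ n) → IsWeightVector i → Bad i ⊆ DirichletImprovable i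
theorem4p6 R n i weight {α} bad =
  eventually-¬unimprovable⇒dirichletImprovable (eventually-¬unimprovable bad)
  where open Improvement R i α weight
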